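{- As $n\to\infty$, \[ F(n)\ge h_{\mathbb P}(n)\ge n\exp\!\left( \left(\frac{\log 2}{2}-o(1)\right) \frac{\log n}{\log\log n} \right). \]
   Context: For an integer $m$ and a positive integer $H$, write $I(m,H):=\{m+1,\dots,m+H\}$. For an integer $n\ge1$, $F(n)$ is the least positive integer $H$ such that, for every $m\in\mathbb Z$, the set $I(m,H)$ contains pairwise distinct integers $a_1,\dots,a_n$ satisfying $i\mid a_i$ for all $1\le i\le n$. Similarly, $h_{\mathbb P}(n)$ is the least positive integer $H$ such that, for every $m\in\mathbb Z$, the set $I(m,H)$ contains pairwise distinct integers $a_p$, one for each prime $p\le n$, satisfying $p\mid a_p$ for every prime $p\le n$. The second inequality means: for every $\varepsilon>0$ there is $n_0$ such that for all $n\ge n_0$, $h_{\mathbb P}(n)\ge n\exp\left(\left(\frac{\log 2}{2}-\varepsilon\right)\frac{\log n}{\log\log n}\right)$. Here $\log$ is the natural logarithm. -}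

module Defs where

open import Algebra.Bundles using (CommutativeRing)
open import Data.Empty using (⊥-elim)
import Data.Integer as ℤ
import Data.Integer.Properties as ℤₚ
open import Data.Integer using (ℤ)
open import Data.Integer.Divisibility.Signed
  using (_∣_; divides; _∣?_; ∣m∣n⇒∣m+n; ∣n⇒∣m*n; ∣ᵤ⇒∣)
open import Data.Integer.DivMod using (_%ℕ_; _/ℕ_; n%ℕd<d; a≡a%ℕn+[a/ℕn]*n)
import Data.Integer.Solver as ℤ-Solver
open import Data.List using (List; []; _∷_)
open import Data.List.Membership.DecPropositional ℤ._≟_ using (_∈?_)
import Data.List.Membership.Propositional as List
open import Data.List.Relation.Unary.Any using (here; there)
import Data.Nat as ℕ
import Data.Nat.Divisibility as ℕ∣
import Data.Nat.Properties as ℕₚ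
open import Data.Nat using (ℕ; zero; suc)
open import Data.Nat.Properties using (_!≢0)
open import Data.Nat.Primality using (Prime; prime?; prime⇒nonZero)
import Data.Rational as ℚ
import Data.Rational.Properties as ℚₚ
open import Data.Rational using (ℚ; 0ℚ; 1ℚ; ½)
import Data.Rational.Solver as ℚ-Solver
import Data.Rational.Unnormalised as ℚᵘ
import Data.Rational.Unnormalised.Properties as ℚᵘₚ
open import Data.Product using (Σ; Σ-syntax; ∃; ∃-syntax; _×_; _,_; proj₁; proj₂)
open import Data.Sum using (inj₁; inj₂)
open import Relation.Binary.PropositionalEquality
  using (_≡_; _≢_; refl; sym; trans; cong; cong₂; subst; subst₂)
open import Relation.Binary.Definitions using (tri<; tri≈; tri>)
open import Relation.Nullary using (¬_; Dec; yes; no)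
open import Relation.Nullary.Decidable using (map′; _×-dec_; ¬?; toWitness)
open import Relation.Unary using (Decidable)

import Algebra.Properties.CommutativeSemiring.Exp as Exp
open Exp (CommutativeRing.commutativeSemiring ℚₚ.+-*-commutativeRing)
  using (_^_; ^-assocʳ; ^-distrib-*)

------------------------------------------------------------------------
-- Rational arithmetic

module Rational where
  open import Data.Rational using (_+_; _*_; _-_; -_; _≤_; _<_)
  open import Data.Integer using () renaming (+_ to pos)
  open ℚ-Solver.+-*-Solver

  ≤*ˡ : ∀ {a b c} → 0ℚ ≤ a → b ≤ c → a * b ≤ a * c
  ≤*ˡ {a} h = ℚₚ.*-monoˡ-≤-nonNeg a {{ℚ.nonNegative h}}

  ≤*ʳ : ∀ {a b c} → 0ℚ ≤ a → b ≤ c → b * a ≤ c * a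
  ≤*ʳ {a} h = ℚₚ.*-monoʳ-≤-nonNeg a {{ℚ.nonNegative h}}

  ≥*ˡ : ∀ {a b c} → a ≤ 0ℚ → b ≤ c → a * c ≤ a * b
  ≥*ˡ {a} h = ℚₚ.*-monoˡ-≤-nonPos a {{ℚ.nonPositive h}}

  ≥*ʳ : ∀ {a b c} → a ≤ 0ℚ → b ≤ c → c * a ≤ b * a
  ≥*ʳ {a} h = ℚₚ.*-monoʳ-≤-nonPos a {{ℚ.nonPositive h}}

  <*ˡ : ∀ {a b c} → 0ℚ < a → b < c → a * b < a * c
  <*ˡ {a} h = ℚₚ.*-monoʳ-<-pos a {{ℚ.positive h}}

  <*ʳ : ∀ {a b c} → 0ℚ < a → b < c → b * a < c * a
  <*ʳ {a} h = ℚₚ.*-monoˡ-<-pos a {{ℚ.positive h}}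

  *≥0 : ∀ {a b} → 0ℚ ≤ a → 0ℚ ≤ b → 0ℚ ≤ a * b
  *≥0 {a} {b} ha hb = subst (_≤ a * b) (ℚₚ.*-zeroʳ a) (≤*ˡ ha hb)

  *>0 : ∀ {a b} → 0ℚ < a → 0ℚ < b → 0ℚ < a * b
  *>0 {a} {b} ha hb = subst (_< a * b) (ℚₚ.*-zeroʳ a) (<*ˡ ha hb)

  +≥0 : ∀ {a b} → 0ℚ ≤ a → 0ℚ ≤ b → 0ℚ ≤ a + b
  +≥0 = ℚₚ.+-mono-≤

  *-mono-≤ : ∀ {a b c d} → 0ℚ ≤ a → a ≤ b → 0ℚ ≤ c → c ≤ d → a * c ≤ b * d
  *-mono-≤ ha ab hc cd = ℚₚ.≤-trans (≤*ˡ ha cd) (≤*ʳ (ℚₚ.≤-trans hc cd) ab)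

  ≤⇒0≤- : ∀ {a b} → a ≤ b → 0ℚ ≤ b - a
  ≤⇒0≤- {a} {b} h = subst (_≤ b - a) (ℚₚ.+-inverseʳ a) (ℚₚ.+-monoˡ-≤ (- a) h)

  <⇒0<- : ∀ {a b} → a < b → 0ℚ < b - a
  <⇒0<- {a} {b} h = subst (_< b - a) (ℚₚ.+-inverseʳ a) (ℚₚ.+-monoˡ-< (- a) h)

  0≤-⇒≤ : ∀ {a b} → 0ℚ ≤ b - a → a ≤ b
  0≤-⇒≤ {a} {b} h = subst₂ _≤_ (ℚₚ.+-identityʳ a)
    (solve 2 (λ a b → a :+ (b :- a) := b) refl a b) (ℚₚ.+-monoʳ-≤ a h)

  0<-⇒< : ∀ {a b} → 0ℚ < b - a → a < b
  0<-⇒< {a} {b} h = subst₂ _<_ (ℚₚ.+-identityʳ a)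
    (solve 2 (λ a b → a :+ (b :- a) := b) refl a b) (ℚₚ.+-monoʳ-< a h)

  0<1 : 0ℚ < 1ℚ
  0<1 = ℚₚ.positive⁻¹ 1ℚ

  0≤1 : 0ℚ ≤ 1ℚ
  0≤1 = ℚₚ.<⇒≤ 0<1

  -1<0 : - 1ℚ < 0ℚ
  -1<0 = ℚₚ.negative⁻¹ (- 1ℚ)

  <⇒≱ : ∀ {a b} → a < b → ¬ (b ≤ a)
  <⇒≱ h h′ = ℚₚ.<-irrefl refl (ℚₚ.<-≤-trans h h′)

  neg-involutive : ∀ a → - (- a) ≡ a
  neg-involutive = solve 1 (λ a → :- (:- a) := a) refl

  sq≥0 : ∀ a → 0ℚ ≤ a * a
  sq≥0 a with ℚₚ.≤-total 0ℚ a
  ... | inj₁ h = *≥0 h h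
  ... | inj₂ h = subst (_≤ a * a) (ℚₚ.*-zeroʳ a) (≥*ˡ h h)

  q-1<q : ∀ q → q - 1ℚ < q
  q-1<q q = subst (q - 1ℚ <_) (ℚₚ.+-identityʳ q) (ℚₚ.+-monoʳ-< q -1<0)

  q<q+1 : ∀ q → q < q + 1ℚ
  q<q+1 q = subst (_< q + 1ℚ) (ℚₚ.+-identityʳ q) (ℚₚ.+-monoʳ-< q 0<1)

  ^≥0 : ∀ {a} n → 0ℚ ≤ a → 0ℚ ≤ a ^ n
  ^≥0 zero    h = 0≤1
  ^≥0 (suc n) h = *≥0 h (^≥0 n h)

  ^-mono : ∀ {a b} n → 0ℚ ≤ a → a ≤ b → a ^ n ≤ b ^ n
  ^-mono zero    ha ab = ℚₚ.≤-refl
  ^-mono (suc n) ha ab = *-mono-≤ ha ab (^≥0 n ha) (^-mono n ha ab)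

  ^≤1 : ∀ {a} n → 0ℚ ≤ a → a ≤ 1ℚ → a ^ n ≤ 1ℚ
  ^≤1 zero    ha h = ℚₚ.≤-refl
  ^≤1 (suc n) ha h = *-mono-≤ ha h (^≥0 n ha) (^≤1 n ha h)

  ι : ℕ → ℚ
  ι n = pos n ℚ./ 1

  ι-suc : ∀ n → ι (suc n) ≡ 1ℚ + ι n
  ι-suc n = ℚₚ.toℚᵘ-injective (begin
    ℚ.toℚᵘ (ι (suc n))                    ≈⟨ ℚₚ.toℚᵘ-fromℚᵘ (ℚᵘ.mkℚᵘ (pos (suc n)) 0) ⟩
    ℚᵘ.mkℚᵘ (pos (suc n)) 0                   ≈⟨ ℚᵘ.*≡* (cong (ℤ._* pos 1)
        (sym (cong (ℤ._+_ (pos 1)) (ℤₚ.*-identityʳ (pos n))))) ⟩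
    ℚᵘ.1ℚᵘ ℚᵘ.+ ℚᵘ.mkℚᵘ (pos n) 0           ≈⟨ ℚᵘₚ.+-congʳ ℚᵘ.1ℚᵘ (ℚₚ.toℚᵘ-fromℚᵘ (ℚᵘ.mkℚᵘ (pos n) 0)) ⟨
    ℚᵘ.1ℚᵘ ℚᵘ.+ ℚ.toℚᵘ (ι n)              ≈⟨ ℚₚ.toℚᵘ-homo-+ 1ℚ (ι n) ⟨
    ℚ.toℚᵘ (1ℚ + ι n)                     ∎)
    where open ℚᵘₚ.≃-Reasoning

  ι≥0 : ∀ n → 0ℚ ≤ ι n
  ι≥0 zero    = ℚₚ.≤-refl
  ι≥0 (suc n) = subst (0ℚ ≤_) (sym (ι-suc n)) (+≥0 0≤1 (ι≥0 n))

  ι-mono : ∀ {m n} → m ℕ.≤ n → ι m ≤ ι n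
  ι-mono {n = n} ℕ.z≤n = ι≥0 n
  ι-mono {suc m} {suc n} (ℕ.s≤s h) =
    subst₂ _≤_ (sym (ι-suc m)) (sym (ι-suc n)) (ℚₚ.+-monoʳ-≤ 1ℚ (ι-mono h))

  recip : ℕ → ℚ
  recip k = pos 1 ℚ./ suc k

  recip>0 : ∀ k → 0ℚ < recip k
  recip>0 k = ℚₚ.positive⁻¹ (recip k) {{ℚₚ.normalize-pos 1 (suc k)}}

  recip≥0 : ∀ k → 0ℚ ≤ recip k
  recip≥0 k = ℚₚ.<⇒≤ (recip>0 k)

  ι*recip : ∀ k → ι (suc k) * recip k ≡ 1ℚ
  ι*recip k = ℚₚ.toℚᵘ-injective (begin
    ℚ.toℚᵘ (ι (suc k) * recip k)                     ≈⟨ ℚₚ.toℚᵘ-homo-* (ι (suc k)) (recip k) ⟩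
    ℚ.toℚᵘ (ι (suc k)) ℚᵘ.* ℚ.toℚᵘ (recip k)         ≈⟨ ℚᵘₚ.*-cong
        (ℚₚ.toℚᵘ-fromℚᵘ (ℚᵘ.mkℚᵘ (pos (suc k)) 0)) (ℚₚ.toℚᵘ-fromℚᵘ (ℚᵘ.mkℚᵘ (pos 1) k)) ⟩
    ℚᵘ.mkℚᵘ (pos (suc k)) 0 ℚᵘ.* ℚᵘ.mkℚᵘ (pos 1) k         ≈⟨ ℚᵘ.*≡*
        (trans (ℤₚ.*-identityʳ (pos (suc k) ℤ.* pos 1)) (trans (ℤₚ.*-identityʳ (pos (suc k)))
          (sym (trans (ℤₚ.*-identityˡ (pos (1 ℕ.* suc k))) (cong pos (ℕₚ.*-identityˡ (suc k))))))) ⟩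
    ℚᵘ.1ℚᵘ                                           ∎)
    where open ℚᵘₚ.≃-Reasoning

  recip≤1 : ∀ k → recip k ≤ 1ℚ
  recip≤1 k = subst₂ _≤_ (ℚₚ.*-identityˡ (recip k)) (ι*recip k)
    (≤*ʳ (recip≥0 k) (ι-mono {1} {suc k} (ℕ.s≤s ℕ.z≤n)))

  recip-* : ∀ k j → recip (j ℕ.+ k ℕ.* suc j) ≡ recip k * recip j
  recip-* k j = ℚₚ.toℚᵘ-injective (begin
    ℚ.toℚᵘ (recip (j ℕ.+ k ℕ.* suc j))         ≈⟨ ℚₚ.toℚᵘ-fromℚᵘ _ ⟩
    ℚᵘ.mkℚᵘ (pos 1) k ℚᵘ.* ℚᵘ.mkℚᵘ (pos 1) j       ≈⟨ ℚᵘₚ.*-cong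
        (ℚₚ.toℚᵘ-fromℚᵘ (ℚᵘ.mkℚᵘ (pos 1) k)) (ℚₚ.toℚᵘ-fromℚᵘ (ℚᵘ.mkℚᵘ (pos 1) j)) ⟨
    ℚ.toℚᵘ (recip k) ℚᵘ.* ℚ.toℚᵘ (recip j)     ≈⟨ ℚₚ.toℚᵘ-homo-* (recip k) (recip j) ⟨
    ℚ.toℚᵘ (recip k * recip j)                 ∎)
    where open ℚᵘₚ.≃-Reasoning

  archimedean : ∀ q → ∃[ n ] q ≤ ι n
  archimedean q@(ℚ.mkℚ a d _) = ℤ.∣ a ∣ , ℚₚ.toℚᵘ-cancel-≤
    (ℚᵘₚ.≤-trans {j = ℚᵘ.mkℚᵘ (pos ℤ.∣ a ∣) 0} (ℚᵘ.*≤* le)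
      (ℚᵘₚ.≤-reflexive (ℚᵘₚ.≃-sym (ℚₚ.toℚᵘ-fromℚᵘ (ℚᵘ.mkℚᵘ (pos ℤ.∣ a ∣) 0)))))
    where
    aux : ∀ a → a ℤ.* pos 1 ℤ.≤ pos ℤ.∣ a ∣ ℤ.* pos (suc d)
    aux (pos n) = subst₂ ℤ._≤_ (ℤₚ.pos-* n 1) (ℤₚ.pos-* n (suc d))
      (ℤ.+≤+ (ℕₚ.*-monoʳ-≤ n (ℕ.s≤s ℕ.z≤n)))
    aux ℤ.-[1+ n ] = ℤ.-≤+
    le : a ℤ.* pos 1 ℤ.≤ pos ℤ.∣ a ∣ ℤ.* pos (suc d)
    le = aux a

  bernoulli : ∀ u n → 0ℚ ≤ 1ℚ + u → 1ℚ + ι n * u ≤ (1ℚ + u) ^ n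
  bernoulli u zero h = ℚₚ.≤-reflexive (trans (cong (1ℚ +_) (ℚₚ.*-zeroˡ u)) (ℚₚ.+-identityʳ 1ℚ))
  bernoulli u (suc n) h = ℚₚ.≤-trans (0≤-⇒≤ (subst (0ℚ ≤_)
    (trans
      (solve 2 (λ u m → m :* (u :* u) := (con 1ℚ :+ u) :* (con 1ℚ :+ m :* u)
                           :- (con 1ℚ :+ (con 1ℚ :+ m) :* u)) refl u (ι n))
      (cong (λ z → (1ℚ + u) * (1ℚ + ι n * u) - (1ℚ + z * u)) (sym (ι-suc n))))
    (*≥0 (ι≥0 n) (sq≥0 u))))
    (≤*ˡ h (bernoulli u n h))

  compound : ℚ → ℕ → ℚ
  compound p k = 1ℚ + p * recip k

  -- (1 + p/K)^K with K = suc k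
  approx : ℚ → ℕ → ℚ
  approx p k = compound p k ^ suc k

  -- If 1 + x ≥ 0 and 0 ≤ t ≤ 1 then 1 + t x ≥ 0.
  convex : ∀ {x t} → 0ℚ ≤ 1ℚ + x → 0ℚ ≤ t → t ≤ 1ℚ → 0ℚ ≤ 1ℚ + x * t
  convex {x} {t} hx ht t1 = subst (0ℚ ≤_)
    (solve 2 (λ x t → (con 1ℚ :- t) :+ t :* (con 1ℚ :+ x) := con 1ℚ :+ x :* t) refl x t)
    (+≥0 (≤⇒0≤- t1) (*≥0 ht hx))

  bernoulli′ : ∀ x j → 0ℚ ≤ 1ℚ + x → 1ℚ + x ≤ (1ℚ + x * recip j) ^ suc j
  bernoulli′ x j h = subst (_≤ (1ℚ + x * recip j) ^ suc j)
    (cong (1ℚ +_) (trans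
      (solve 3 (λ m x r → m :* (x :* r) := x :* (m :* r)) refl (ι (suc j)) x (recip j))
      (trans (cong (x *_) (ι*recip j)) (ℚₚ.*-identityʳ x))))
    (bernoulli (x * recip j) (suc j) (convex {x} h (recip≥0 j) (recip≤1 j)))

  approx≥0 : ∀ p k → 0ℚ ≤ compound p k → 0ℚ ≤ approx p k
  approx≥0 p k h = ^≥0 {compound p k} (suc k) h

  approx-≤ : ∀ p q k → 0ℚ ≤ compound p k → compound p k ≤ compound q k → approx p k ≤ approx q k
  approx-≤ p q k h le = ^-mono {compound p k} {compound q k} (suc k) h le

  approx-mono : ∀ p k j → 0ℚ ≤ compound p k → approx p k ≤ approx p (j ℕ.+ k ℕ.* suc j)
  approx-mono p k j h = ℚₚ.≤-trans
    (^-mono {compound p k} {(1ℚ + p * recip k * recip j) ^ suc j} (suc k) h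
      (bernoulli′ (p * recip k) j h))
    (ℚₚ.≤-reflexive (trans
      (^-assocʳ (1ℚ + p * recip k * recip j) (suc j) (suc k))
      (cong₂ _^_
        (cong (1ℚ +_) (trans (ℚₚ.*-assoc p (recip k) (recip j)) (cong (p *_) (sym (recip-* k j)))))
        (ℕₚ.*-comm (suc j) (suc k)))))

  -- (1 + p/k)^k · (1 - p/m)^m ≤ 1
  approx-upper : ∀ p k m → 0ℚ ≤ compound p k → 0ℚ ≤ compound (- p) m →
                 approx p k * approx (- p) m ≤ 1ℚ
  approx-upper p k m hk hm = ℚₚ.≤-trans
    (*-mono-≤ {approx p k} {((1ℚ + u) ^ suc m) ^ suc k} {approx (- p) m} {((1ℚ + v) ^ suc k) ^ suc m}
      (approx≥0 p k hk) (^-mono {compound p k} {(1ℚ + u) ^ suc m} (suc k) hk b₁)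
      (approx≥0 (- p) m hm) (^-mono {compound (- p) m} {(1ℚ + v) ^ suc k} (suc m) hm b₂))
    (ℚₚ.≤-trans (ℚₚ.≤-reflexive eq) (^≤1 {w} N w≥0 w≤1))
    where
    u v : ℚ
    u = p * recip k * recip m
    v = - p * recip m * recip k
    N : ℕ
    N = suc m ℕ.* suc k
    b₁ : compound p k ≤ (1ℚ + u) ^ suc m
    b₁ = bernoulli′ (p * recip k) m hk
    b₂ : compound (- p) m ≤ (1ℚ + v) ^ suc k
    b₂ = bernoulli′ (- p * recip m) k hm
    w : ℚ
    w = (1ℚ + u) * (1ℚ + v)
    w≥0 : 0ℚ ≤ w
    w≥0 = *≥0 (convex {p * recip k} hk (recip≥0 m) (recip≤1 m)) (convex { - p * recip m} hm (recip≥0 k) (recip≤1 k))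
    w≤1 : w ≤ 1ℚ
    w≤1 = 0≤-⇒≤ (subst (0ℚ ≤_)
      (solve 3 (λ p r s → (p :* r :* s) :* (p :* r :* s) :=
         con 1ℚ :- (con 1ℚ :+ p :* r :* s) :* (con 1ℚ :+ (:- p) :* s :* r)) refl p (recip k) (recip m))
      (sq≥0 u))
    eq : ((1ℚ + u) ^ suc m) ^ suc k * ((1ℚ + v) ^ suc k) ^ suc m ≡ w ^ N
    eq = trans (cong₂ _*_ (^-assocʳ (1ℚ + u) (suc m) (suc k))
                 (trans (^-assocʳ (1ℚ + v) (suc k) (suc m)) (cong ((1ℚ + v) ^_) (ℕₚ.*-comm (suc k) (suc m)))))
               (sym (^-distrib-* (1ℚ + u) (1ℚ + v) N))

  compound-large : ∀ p k → - p ≤ ι (suc k) → 0ℚ ≤ compound p k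
  compound-large p k h = subst (0ℚ ≤_)
    (trans (solve 3 (λ m p r → (m :- (:- p)) :* r := m :* r :+ p :* r) refl (ι (suc k)) p (recip k))
           (cong (_+ p * recip k) (ι*recip k)))
    (*≥0 (≤⇒0≤- h) (recip≥0 k))

  compound>0 : ∀ p k → - p < ι (suc k) → 0ℚ < compound p k
  compound>0 p k h = subst (0ℚ <_)
    (trans (solve 3 (λ m p r → (m :- (:- p)) :* r := m :* r :+ p :* r) refl (ι (suc k)) p (recip k))
           (cong (_+ p * recip k) (ι*recip k)))
    (*>0 (<⇒0<- h) (recip>0 k))

  ^>0 : ∀ {a} n → 0ℚ < a → 0ℚ < a ^ n
  ^>0 zero    h = 0<1
  ^>0 (suc n) h = *>0 h (^>0 n h)

  approx>0 : ∀ p k → 0ℚ < compound p k → 0ℚ < approx p k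
  approx>0 p k h = ^>0 {compound p k} (suc k) h

  compound-mono : ∀ {p q} k → p ≤ q → compound p k ≤ compound q k
  compound-mono k h = ℚₚ.+-monoʳ-≤ 1ℚ (≤*ʳ (recip≥0 k) h)

  ι≤ι-suc : ∀ n → ι n ≤ ι (suc n)
  ι≤ι-suc n = ι-mono (ℕₚ.n≤1+n n)

  1/pos : ∀ {d} → 0ℚ < d → ∃[ e ] (0ℚ < e × d * e ≡ 1ℚ)
  1/pos {d} h = ℚ.1/ d , ℚₚ.positive⁻¹ _ {{ℚₚ.1/pos⇒pos d}} , ℚₚ.*-inverseʳ d
    where instance
      d-pos : ℚ.Positive d
      d-pos = ℚ.positive h
      nz : ℚ.NonZero d
      nz = ℚₚ.pos⇒nonZero d


open Rational

------------------------------------------------------------------------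
-- Real numbers

-- One-sided Dedekind cuts, as in Rudin: a real is given by the set of rationals
-- strictly below it, and a rational q satisfies x ≤ q iff it is not in that set.
-- Locatedness (p < q implies p ∈ x or q ∉ x) holds classically and is not demanded,
-- so classically these are exactly the real numbers.
record ℝ : Set₁ where
  field
    lower     : ℚ → Set
    inhabited : ∃[ q ] lower q
    bounded   : ∃[ q ] ¬ lower q
    closed    : ∀ {p q} → p ℚ.< q → lower q → lower p
    rounded   : ∀ {p} → lower p → ∃[ q ] (p ℚ.< q × lower q)

open ℝ

infix 4 _∈_ _∉_ _≤ℝ_ _<ℝ_ _≥ℝ_
infixl 6 _-ℝ_
infixl 7 _*ℝ_ _÷ℝ_

_∈_ _∉_ : ℚ → ℝ → Set
q ∈ x = lower x q
q ∉ x = ¬ q ∈ x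

_≤ℝ_ _≥ℝ_ : ℝ → ℝ → Set
x ≤ℝ y = ∀ q → q ∈ x → q ∈ y
x ≥ℝ y = y ≤ℝ x

_<ℝ_ : ℝ → ℝ → Set
x <ℝ y = ∃[ q ] (q ∉ x × q ∈ y)

∈∉⇒< : ∀ x {p q} → p ∈ x → q ∉ x → p ℚ.< q
∈∉⇒< x {p} {q} hp hq with ℚₚ.<-cmp p q
... | tri< p<q _ _    = p<q
... | tri≈ _ refl _   = ⊥-elim (hq hp)
... | tri> _ _ q<p    = ⊥-elim (hq (closed x q<p hp))

∉-up : ∀ x {p q} → p ∉ x → p ℚ.≤ q → q ∉ x
∉-up x {p} {q} hp p≤q hq = ℚₚ.<-irrefl refl (ℚₚ.<-≤-trans (∈∉⇒< x hq hp) p≤q)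

⊔-∈ : ∀ x {p q} → p ∈ x → q ∈ x → p ℚ.⊔ q ∈ x
⊔-∈ x {p} {q} hp hq with ℚₚ.⊔-sel p q
... | inj₁ e = subst (_∈ x) (sym e) hp
... | inj₂ e = subst (_∈ x) (sym e) hq

fromℚ : ℚ → ℝ
fromℚ q = record
  { lower     = λ p → p ℚ.< q
  ; inhabited = q ℚ.- 1ℚ , q-1<q q
  ; bounded   = q , ℚₚ.<-irrefl refl
  ; closed    = ℚₚ.<-trans
  ; rounded   = ℚₚ.<-dense
  }

fromℕ : ℕ → ℝ
fromℕ n = fromℚ (ι n)

0ℝ 1ℝ : ℝ
0ℝ = fromℚ 0ℚ
1ℝ = fromℚ 1ℚ

_-ℝ_ : ℝ → ℝ → ℝ
x -ℝ y = record
  { lower     = λ q → ∃[ a ] ∃[ b ] (a ∈ x × b ∉ y × q ℚ.< a ℚ.- b)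
  ; inhabited = let (a , ha) = inhabited x ; (b , hb) = bounded y in
                a ℚ.- b ℚ.- 1ℚ , a , b , ha , hb , q-1<q (a ℚ.- b)
  ; bounded   = let (a , ha) = bounded x ; (b , hb) = inhabited y in
                a ℚ.- b , λ { (a′ , b′ , ha′ , hb′ , lt) → ℚₚ.<-asym lt
                  (ℚₚ.+-mono-< (∈∉⇒< x ha′ ha) (ℚₚ.neg-antimono-< (∈∉⇒< y hb hb′))) }
  ; closed    = λ { p<q (a , b , ha , hb , lt) → a , b , ha , hb , ℚₚ.<-trans p<q lt }
  ; rounded   = λ { (a , b , ha , hb , lt) → let (r , l₁ , l₂) = ℚₚ.<-dense lt in
                    r , l₁ , a , b , ha , hb , l₂ }
  }

module Product where
  open import Data.Rational using (_+_; _*_; _-_; -_; _≤_; _<_; ∣_∣; _⊓_; _⊔_)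

  <box₁ : ∀ {q a b s c} → q < a * c → q < b * c → a ≤ s → s ≤ b → q < s * c
  <box₁ {c = c} h₁ h₂ as sb with ℚₚ.≤-total 0ℚ c
  ... | inj₁ c≥0 = ℚₚ.<-≤-trans h₁ (≤*ʳ c≥0 as)
  ... | inj₂ c≤0 = ℚₚ.<-≤-trans h₂ (≥*ʳ c≤0 sb)

  <box₂ : ∀ {q a c d t} → q < a * c → q < a * d → c ≤ t → t ≤ d → q < a * t
  <box₂ {q} {a} {c} {d} {t} h₁ h₂ ct td = subst (q <_) (ℚₚ.*-comm t a)
    (<box₁ {c = a} (subst (q <_) (ℚₚ.*-comm a c) h₁) (subst (q <_) (ℚₚ.*-comm a d) h₂) ct td)

  ≤∣∣ : ∀ p → p ≤ ∣ p ∣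
  ≤∣∣ p with ℚₚ.≤-total 0ℚ p
  ... | inj₁ h = ℚₚ.≤-reflexive (sym (ℚₚ.0≤p⇒∣p∣≡p h))
  ... | inj₂ h = ℚₚ.≤-trans h (ℚₚ.0≤∣p∣ p)

  ∣∣-bound : ∀ {a b s} → a ≤ s → s ≤ b → ∣ s ∣ ≤ ∣ a ∣ + ∣ b ∣
  ∣∣-bound {a} {b} {s} as sb with ℚₚ.∣p∣≡p∨∣p∣≡-p s
  ... | inj₁ e = subst (_≤ ∣ a ∣ + ∣ b ∣) (trans (ℚₚ.+-identityˡ s) (sym e))
                   (ℚₚ.+-mono-≤ (ℚₚ.0≤∣p∣ a) (ℚₚ.≤-trans sb (≤∣∣ b)))
  ... | inj₂ e = subst (_≤ ∣ a ∣ + ∣ b ∣) (trans (ℚₚ.+-identityʳ (- s)) (sym e))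
                   (ℚₚ.+-mono-≤ (ℚₚ.≤-trans (ℚₚ.neg-antimono-≤ as) (-p≤∣p∣ a)) (ℚₚ.0≤∣p∣ b))
    where
    -p≤∣p∣ : ∀ p → - p ≤ ∣ p ∣
    -p≤∣p∣ p with ℚₚ.≤-total 0ℚ p
    ... | inj₁ h = ℚₚ.≤-trans (ℚₚ.neg-antimono-≤ h) (ℚₚ.0≤∣p∣ p)
    ... | inj₂ h = ℚₚ.≤-trans (ℚₚ.≤-reflexive (sym (ℚₚ.0≤p⇒∣p∣≡p (ℚₚ.neg-antimono-≤ h))))
                     (ℚₚ.≤-reflexive (ℚₚ.∣-p∣≡∣p∣ p))

  *-bound : ∀ {s t M N} → ∣ s ∣ ≤ M → ∣ t ∣ ≤ N → s * t ≤ M * N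
  *-bound {s} {t} hs ht = ℚₚ.≤-trans (≤∣∣ (s * t))
    (ℚₚ.≤-trans (ℚₚ.≤-reflexive (ℚₚ.∣p*q∣≡∣p∣*∣q∣ s t)) (*-mono-≤ (ℚₚ.0≤∣p∣ s) hs (ℚₚ.0≤∣p∣ t) ht))

  below₂ : ∀ {q u v} → q < u → q < v → ∃[ r ] (q < r × r < u × r < v)
  below₂ {q} {u} {v} hu hv with ℚₚ.<-dense hu | ℚₚ.<-dense hv
  ... | (r , qr , ru) | (s , qs , sv) with ℚₚ.≤-total r s
  ...   | inj₁ rs = r , qr , ru , ℚₚ.≤-<-trans rs sv
  ...   | inj₂ sr = s , qs , ℚₚ.≤-<-trans sr ru , sv

-- The rationals below x *ℝ y are those below all products of two points of some
-- box (a , b] × (c , d] containing (x , y), that is, below the products at its corners.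
_*ℝ_ : ℝ → ℝ → ℝ
x *ℝ y = record
  { lower     = below
  ; inhabited = inhabited′
  ; bounded   = bounded′
  ; closed    = λ { p<q (a , b , c , d , ha , hb , hc , hd , h₁ , h₂ , h₃ , h₄) →
                  a , b , c , d , ha , hb , hc , hd ,
                  ℚₚ.<-trans p<q h₁ , ℚₚ.<-trans p<q h₂ , ℚₚ.<-trans p<q h₃ , ℚₚ.<-trans p<q h₄ }
  ; rounded   = rounded′
  }
  where
  open Product
  below : ℚ → Set
  below q = ∃[ a ] ∃[ b ] ∃[ c ] ∃[ d ]
    (a ∈ x × b ∉ x × c ∈ y × d ∉ y ×
     q ℚ.< a ℚ.* c × q ℚ.< a ℚ.* d × q ℚ.< b ℚ.* c × q ℚ.< b ℚ.* d)

  rounded′ : ∀ {p} → below p → ∃[ q ] (p ℚ.< q × below q)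
  rounded′ (a , b , c , d , ha , hb , hc , hd , h₁ , h₂ , h₃ , h₄) =
    let (r , pr , r₁ , r₂) = below₂ h₁ h₂
        (s , ps , s₃ , s₄) = below₂ h₃ h₄
        (t , pt , tr , ts) = below₂ pr ps
    in t , pt , a , b , c , d , ha , hb , hc , hd ,
       ℚₚ.<-trans tr r₁ , ℚₚ.<-trans tr r₂ , ℚₚ.<-trans ts s₃ , ℚₚ.<-trans ts s₄

  inhabited′ : ∃[ q ] below q
  inhabited′ with inhabited x | bounded x | inhabited y | bounded y
  ... | a , ha | b , hb | c , hc | d , hd =
    m ℚ.- 1ℚ , a , b , c , d , ha , hb , hc , hd ,
    lt (ℚₚ.≤-trans (ℚₚ.p⊓q≤p uv wz) (ℚₚ.p⊓q≤p u v)) ,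
    lt (ℚₚ.≤-trans (ℚₚ.p⊓q≤p uv wz) (ℚₚ.p⊓q≤q u v)) ,
    lt (ℚₚ.≤-trans (ℚₚ.p⊓q≤q uv wz) (ℚₚ.p⊓q≤p w z)) ,
    lt (ℚₚ.≤-trans (ℚₚ.p⊓q≤q uv wz) (ℚₚ.p⊓q≤q w z))
    where
    u v w z uv wz m : ℚ
    u = a ℚ.* c
    v = a ℚ.* d
    w = b ℚ.* c
    z = b ℚ.* d
    uv = u ℚ.⊓ v
    wz = w ℚ.⊓ z
    m = uv ℚ.⊓ wz
    lt : ∀ {t} → m ℚ.≤ t → m ℚ.- 1ℚ ℚ.< t
    lt = ℚₚ.<-≤-trans (q-1<q m)

  bounded′ : ∃[ q ] ¬ below q
  bounded′ with inhabited x | bounded x | inhabited y | bounded y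
  ... | a , ha | b , hb | c , hc | d , hd =
    (ℚ.∣ a ∣ ℚ.+ ℚ.∣ b ∣) ℚ.* (ℚ.∣ c ∣ ℚ.+ ℚ.∣ d ∣) ,
    λ { (a′ , b′ , c′ , d′ , ha′ , hb′ , hc′ , hd′ , h₁ , h₂ , h₃ , h₄) →
      let s  = a ℚ.⊔ a′
          t  = c ℚ.⊔ c′
          hs = ⊔-∈ x ha ha′
          ht = ⊔-∈ y hc hc′
          a′s = ℚₚ.p≤q⊔p a a′
          c′t = ℚₚ.p≤q⊔p c c′
          sb′ = ℚₚ.<⇒≤ (∈∉⇒< x hs hb′)
          td′ = ℚₚ.<⇒≤ (∈∉⇒< y ht hd′)
      in ℚₚ.<-irrefl refl (ℚₚ.<-≤-trans
           (<box₂ {a = s} (<box₁ {c = c′} h₁ h₃ a′s sb′) (<box₁ {c = d′} h₂ h₄ a′s sb′) c′t td′)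
           (*-bound {s} {t} (∣∣-bound (ℚₚ.p≤p⊔q a a′) (ℚₚ.<⇒≤ (∈∉⇒< x hs hb)))
                            (∣∣-bound (ℚₚ.p≤p⊔q c c′) (ℚₚ.<⇒≤ (∈∉⇒< y ht hd))))) }

0<⇒∃ : ∀ x → 0ℝ <ℝ x → ∃[ r ] (0ℚ ℚ.< r × r ∈ x)
0<⇒∃ x (p , hp , p∈x) with rounded x p∈x
... | r , pr , r∈x = r , ℚₚ.≤-<-trans (ℚₚ.≮⇒≥ hp) pr , r∈x

-- An upper bound d of y > 0 is positive, and q < 1/y as soon as q < 1/d.
reciprocal : (y : ℝ) → 0ℝ <ℝ y → ℝ
reciprocal y y>0 = record
  { lower     = λ q → ∃[ d ] (d ∉ y × q ℚ.* d ℚ.< 1ℚ)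
  ; inhabited = 0ℚ , proj₁ (bounded y) , proj₂ (bounded y) ,
                subst (ℚ._< 1ℚ) (sym (ℚₚ.*-zeroˡ (proj₁ (bounded y)))) 0<1
  ; bounded   = bounded′
  ; closed    = λ { p<q (d , hd , lt) → d , hd , ℚₚ.<-trans (<*ʳ (d>0 hd) p<q) lt }
  ; rounded   = rounded′
  }
  where
  r : ℚ
  r = proj₁ (0<⇒∃ y y>0)
  r>0 : 0ℚ ℚ.< r
  r>0 = proj₁ (proj₂ (0<⇒∃ y y>0))
  r∈y : r ∈ y
  r∈y = proj₂ (proj₂ (0<⇒∃ y y>0))
  d>0 : ∀ {d} → d ∉ y → 0ℚ ℚ.< d
  d>0 hd = ℚₚ.<-trans r>0 (∈∉⇒< y r∈y hd)

  bounded′ : ∃[ q ] ¬ (∃[ d ] (d ∉ y × q ℚ.* d ℚ.< 1ℚ))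
  bounded′ with 1/pos r>0
  ... | e , e>0 , re = e , λ { (d , hd , lt) → ℚₚ.<-asym lt
    (subst (ℚ._< e ℚ.* d) (trans (ℚₚ.*-comm e r) re) (<*ˡ e>0 (∈∉⇒< y r∈y hd))) }

  rounded′ : ∀ {p} → ∃[ d ] (d ∉ y × p ℚ.* d ℚ.< 1ℚ) →
             ∃[ q ] (p ℚ.< q × ∃[ d ] (d ∉ y × q ℚ.* d ℚ.< 1ℚ))
  rounded′ {p} (d , hd , lt) with 1/pos (d>0 hd) | ℚₚ.<-dense lt
  ... | e , e>0 , de | t , l₁ , l₂ = t ℚ.* e ,
    subst (ℚ._< t ℚ.* e) (trans (ℚₚ.*-assoc p d e) (trans (cong (p ℚ.*_) de) (ℚₚ.*-identityʳ p)))
      (<*ʳ e>0 l₁) ,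
    d , hd , subst (ℚ._< 1ℚ) (sym (trans (ℚₚ.*-assoc t e d)
      (trans (cong (t ℚ.*_) (trans (ℚₚ.*-comm e d) de)) (ℚₚ.*-identityʳ t)))) l₂

_÷ℝ_ : ℝ → Σ ℝ (0ℝ <ℝ_) → ℝ
x ÷ℝ (y , y>0) = x *ℝ reciprocal y y>0

-- (1 - b/M)^(-M) bounds (1 + p/K)^K for all p < b.
exp-bound : ∀ x {b r} m → b ∉ x → 0ℚ ℚ.≤ compound (ℚ.- b) m → 1ℚ ℚ.≤ r ℚ.* approx (ℚ.- b) m →
            ∀ p k → p ∈ x → 0ℚ ℚ.≤ compound p k → approx p k ℚ.≤ r
exp-bound x {b} {r} m hb hm hr p k hp hk = ℚₚ.≮⇒≥ λ lt →
  ℚₚ.<-irrefl {1ℚ} refl (ℚₚ.<-≤-trans (ℚₚ.≤-<-trans hr (<*ʳ {e} e>0 lt))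
    (ℚₚ.≤-trans (≤*ˡ {approx p k} {e} {approx (ℚ.- p) m} (approx≥0 p k hk)
        (approx-≤ (ℚ.- b) (ℚ.- p) m hm mono))
      (approx-upper p k m hk (ℚₚ.≤-trans hm mono))))
  where
  e : ℚ
  e = approx (ℚ.- b) m
  mono : compound (ℚ.- b) m ℚ.≤ compound (ℚ.- p) m
  mono = compound-mono m (ℚₚ.neg-antimono-≤ (ℚₚ.<⇒≤ (∈∉⇒< x hp hb)))
  e>0 : 0ℚ ℚ.< e
  e>0 = ℚₚ.≰⇒> λ e≤0 → <⇒≱ 0<1 (ℚₚ.≤-trans hr (ℚₚ.≤-reflexive
    (trans (cong (r ℚ.*_) (ℚₚ.≤-antisym e≤0 (approx≥0 (ℚ.- b) m hm))) (ℚₚ.*-zeroʳ r))))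

-- exp x is the supremum of (1 + p/K)^K over all rationals p < x and all integers
-- K = suc k ≥ 1 with 1 + p/K ≥ 0.  In this range (1 + p/K)^K is nondecreasing
-- along multiples of K, with limit e^p.
exp : ℝ → ℝ
exp x = record
  { lower     = λ q → ∃[ p ] ∃[ k ] (p ∈ x × 0ℚ ℚ.≤ compound p k × q ℚ.< approx p k)
  ; inhabited = inhabited′
  ; bounded   = bounded′
  ; closed    = λ { p<q (p , k , hp , hk , lt) → p , k , hp , hk , ℚₚ.<-trans p<q lt }
  ; rounded   = λ { (p , k , hp , hk , lt) → let (r , l₁ , l₂) = ℚₚ.<-dense lt in
                    r , l₁ , p , k , hp , hk , l₂ }
  }
  where
  inhabited′ : ∃[ q ] ∃[ p ] ∃[ k ] (p ∈ x × 0ℚ ℚ.≤ compound p k × q ℚ.< approx p k)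
  inhabited′ =
    let (p , hp) = inhabited x
        (k , hk) = archimedean (ℚ.- p)
    in approx p k ℚ.- 1ℚ , p , k , hp ,
       compound-large p k (ℚₚ.≤-trans hk (ι≤ι-suc k)) , q-1<q (approx p k)

  bounded′ : ∃[ q ] ¬ (∃[ p ] ∃[ k ] (p ∈ x × 0ℚ ℚ.≤ compound p k × q ℚ.< approx p k))
  bounded′ = proj₁ inv , λ { (p , k , hp , hk , lt) → <⇒≱ lt
      (exp-bound x m (proj₂ (bounded x)) (ℚₚ.<⇒≤ hc) (ℚₚ.≤-reflexive (sym
        (trans (ℚₚ.*-comm (proj₁ inv) (approx (ℚ.- b) m)) (proj₂ (proj₂ inv))))) p k hp hk) }
    where
    b : ℚ
    b = proj₁ (bounded x)
    m : ℕ
    m = proj₁ (archimedean (b ℚ.+ 1ℚ))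
    hc : 0ℚ ℚ.< compound (ℚ.- b) m
    hc = compound>0 (ℚ.- b) m (subst (ℚ._< ι (suc m)) (sym (neg-involutive b))
           (ℚₚ.<-≤-trans (q<q+1 b) (ℚₚ.≤-trans (proj₂ (archimedean (b ℚ.+ 1ℚ))) (ι≤ι-suc m))))
    inv : ∃[ e ] (0ℚ ℚ.< e × approx (ℚ.- b) m ℚ.* e ≡ 1ℚ)
    inv = 1/pos {approx (ℚ.- b) m} (approx>0 (ℚ.- b) m hc)

∉exp-bound : ∀ x {b r} m → b ∉ x → 0ℚ ℚ.≤ compound (ℚ.- b) m → 1ℚ ℚ.≤ r ℚ.* approx (ℚ.- b) m → r ∉ exp x
∉exp-bound x m hb hm hr (p , k , hp , hk , lt) = <⇒≱ lt (exp-bound x m hb hm hr p k hp hk)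

module Logarithm where
  open import Data.Rational using (_+_; _*_; _-_; -_; _≤_; _<_)
  open ℚ-Solver.+-*-Solver

  ∉exp⇒≥ : ∀ x {r} p k → r ∉ exp x → p ∈ x → 0ℚ ≤ compound p k → approx p k ≤ r
  ∉exp⇒≥ x p k hr hp hk = ℚₚ.≮⇒≥ λ lt → hr (p , k , hp , hk , lt)

  ∉exp⇒≥0 : ∀ x {r} → r ∉ exp x → 0ℚ ≤ r
  ∉exp⇒≥0 x hr =
    let (p , hp) = inhabited x
        (k , hk) = archimedean (- p)
        h = compound-large p k (ℚₚ.≤-trans hk (ι≤ι-suc k))
    in ℚₚ.≤-trans (approx≥0 p k h) (∉exp⇒≥ x p k hr hp h)

  -- e^(p₀+δ) ≤ e^p₀ · e^(2δ), at a level K with 1 + p₀/K ≥ 1/2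
  approx-+ : ∀ p₀ δ k → 0ℚ ≤ δ → ½ ≤ compound p₀ k →
             approx (p₀ + δ) k ≤ approx p₀ k * approx (δ + δ) k
  approx-+ p₀ δ k hδ hc = ℚₚ.≤-trans
    (^-mono {compound (p₀ + δ) k} {compound p₀ k * compound (δ + δ) k} (suc k) c≥0 (0≤-⇒≤ (subst (0ℚ ≤_)
      (solve 3 (λ p d r → (con 1ℚ :+ p :* r :- con ½) :* ((d :+ d) :* r) :=
         (con 1ℚ :+ p :* r) :* (con 1ℚ :+ (d :+ d) :* r) :- (con 1ℚ :+ (p :+ d) :* r)) refl p₀ δ (recip k))
      (*≥0 (≤⇒0≤- hc) (*≥0 (+≥0 hδ hδ) (recip≥0 k))))))
    (ℚₚ.≤-reflexive (^-distrib-* (compound p₀ k) (compound (δ + δ) k) (suc k)))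
    where
    0≤½ : 0ℚ ≤ ½
    0≤½ = ℚₚ.nonNegative⁻¹ ½
    c≥0 : 0ℚ ≤ compound (p₀ + δ) k
    c≥0 = ℚₚ.≤-trans (ℚₚ.≤-trans 0≤½ hc)
      (compound-mono k (subst (_≤ p₀ + δ) (ℚₚ.+-identityʳ p₀) (ℚₚ.+-monoʳ-≤ p₀ hδ)))

  compound≥½ : ∀ p k → - (p + p) ≤ ι (suc k) → ½ ≤ compound p k
  compound≥½ p k h = 0≤-⇒≤ (subst (0ℚ ≤_)
    (trans (solve 3 (λ m p r → con ½ :* (m :- (:- (p :+ p))) :* r := con ½ :* (m :* r) :+ p :* r)
              refl (ι (suc k)) p (recip k))
      (trans (cong (λ z → ½ * z + p * recip k) (ι*recip k))
        (solve 2 (λ p r → con ½ :* con 1ℚ :+ p :* r := con 1ℚ :+ p :* r :- con ½) refl p (recip k))))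
    (*≥0 (*≥0 (ℚₚ.nonNegative⁻¹ ½) (≤⇒0≤- h)) (recip≥0 k)))

  approx0 : ∀ q → approx q 0 ≡ 1ℚ + q
  approx0 q = trans (ℚₚ.*-identityʳ (compound q 0)) (cong (1ℚ +_) (ℚₚ.*-identityʳ q))

  -- A step δ for which b ≤ a (1 - 2δ).
  step : ∀ {a b} → 0ℚ ≤ b → b < a →
         ∃[ δ ] (0ℚ < δ × 0ℚ < 1ℚ + - (δ + δ) × b ≤ a * (1ℚ + - (δ + δ)))
  step {a} {b} hb lt with 1/pos (ℚₚ.≤-<-trans hb lt)
  ... | e , e>0 , ae = δ , *>0 ½>0 D>0 ,
      subst (0ℚ <_) (sym w≡) (ℚₚ.+-mono-<-≤ ½>0 (*≥0 ½≥0 (*≥0 hb (ℚₚ.<⇒≤ e>0)))) ,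
      0≤-⇒≤ (subst (0ℚ ≤_) (sym gap) (*≥0 ½≥0 (ℚₚ.<⇒≤ (<⇒0<- lt))))
    where
    D δ : ℚ
    D = ½ * ((a - b) * e)
    δ = ½ * D
    ½>0 : 0ℚ < ½
    ½>0 = ℚₚ.positive⁻¹ ½
    ½≥0 : 0ℚ ≤ ½
    ½≥0 = ℚₚ.<⇒≤ ½>0
    D>0 : 0ℚ < D
    D>0 = *>0 ½>0 (*>0 (<⇒0<- lt) e>0)
    half : ∀ x → ½ * x + ½ * x ≡ x
    half = solve 1 (λ x → con ½ :* x :+ con ½ :* x := x) refl
    expand : ∀ a b e → 1ℚ + - (½ * ((a - b) * e)) ≡ 1ℚ + - (½ * (a * e)) + ½ * (b * e)
    expand = solve 3 (λ a b e → con 1ℚ :+ :- (con ½ :* ((a :- b) :* e)) :=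
               con 1ℚ :+ :- (con ½ :* (a :* e)) :+ con ½ :* (b :* e)) refl
    w≡ : 1ℚ + - (δ + δ) ≡ ½ + ½ * (b * e)
    w≡ = trans (cong (λ z → 1ℚ + - z) (half D))
           (trans (expand a b e) (cong (λ z → 1ℚ + - (½ * z) + ½ * (b * e)) ae))
    expand′ : ∀ a b e → a * (½ + ½ * (b * e)) - b ≡ ½ * a + ½ * ((a * e) * b) - b
    expand′ = solve 3 (λ a b e → a :* (con ½ :+ con ½ :* (b :* e)) :- b :=
               con ½ :* a :+ con ½ :* ((a :* e) :* b) :- b) refl
    gap′ : ∀ a b → ½ * a + ½ * (1ℚ * b) - b ≡ ½ * (a - b)
    gap′ = solve 2 (λ a b → con ½ :* a :+ con ½ :* (con 1ℚ :* b) :- b := con ½ :* (a :- b)) refl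
    gap : a * (1ℚ + - (δ + δ)) - b ≡ ½ * (a - b)
    gap = trans (cong (λ z → a * z - b) w≡) (trans (expand′ a b e)
            (trans (cong (λ z → ½ * a + ½ * (z * b) - b) ae) (gap′ a b)))

  module _ (q : ℚ) {r r′ : ℚ} (hr : r ∉ exp (fromℚ q)) (δ : ℚ) (δ>0 : 0ℚ < δ)
           (w>0 : 0ℚ < 1ℚ + - (δ + δ)) (gap : r ≤ r′ * (1ℚ + - (δ + δ))) where

    exp-step : r′ ∉ exp (fromℚ (q + δ))
    exp-step (p , k , hp , hk , lt) = <⇒≱ step₁ (ℚₚ.≤-trans step₂ gap)
      where
      j K : ℕ
      j = proj₁ (archimedean (- ((p - δ) + (p - δ))))
      K = j ℕ.+ k ℕ.* suc j
      p₀ w A B : ℚ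
      p₀ = p - δ
      w = 1ℚ + - (δ + δ)
      A = approx p₀ K
      B = approx (δ + δ) K
      p₀<q : p₀ < q
      p₀<q = subst (p₀ <_) (solve 2 (λ q d → q :+ d :- d := q) refl q δ) (ℚₚ.+-monoˡ-< (- δ) hp)
      hK : ½ ≤ compound p₀ K
      hK = compound≥½ p₀ K
        (ℚₚ.≤-trans (proj₂ (archimedean (- (p₀ + p₀)))) (ι-mono (ℕₚ.≤-trans (ℕₚ.m≤m+n j (k ℕ.* suc j)) (ℕₚ.n≤1+n K))))
      hK≥0 : 0ℚ ≤ compound p₀ K
      hK≥0 = ℚₚ.≤-trans (ℚₚ.nonNegative⁻¹ ½) hK
      p₀+δ : p₀ + δ ≡ p
      p₀+δ = solve 2 (λ p d → p :- d :+ d := p) refl p δ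
      hδK : 0ℚ ≤ compound (δ + δ) K
      hδK = +≥0 0≤1 (*≥0 (+≥0 (ℚₚ.<⇒≤ δ>0) (ℚₚ.<⇒≤ δ>0)) (recip≥0 K))
      w≡ : 1ℚ + - (δ + δ) ≡ compound (- (δ + δ)) 0
      w≡ = cong (1ℚ +_) (sym (ℚₚ.*-identityʳ (- (δ + δ))))
      approx≤ : approx p K ≤ A * B
      approx≤ = subst (λ z → approx z K ≤ A * B) p₀+δ (approx-+ p₀ δ K (ℚₚ.<⇒≤ δ>0) hK)
      step₁ : r′ * w < A * B * w
      step₁ = <*ʳ {w} {r′} {A * B} w>0 (ℚₚ.<-≤-trans lt (ℚₚ.≤-trans (approx-mono p k j hk) approx≤))
      Bw≤1 : B * w ≤ 1ℚ
      Bw≤1 = subst (λ z → B * z ≤ 1ℚ) (approx0 (- (δ + δ)))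
        (approx-upper (δ + δ) K 0 hδK (subst (0ℚ ≤_) w≡ (ℚₚ.<⇒≤ w>0)))
      A≤r : A ≤ r
      A≤r = ∉exp⇒≥ (fromℚ q) p₀ K hr p₀<q hK≥0
      step₂ : A * B * w ≤ r
      step₂ = ℚₚ.≤-trans (ℚₚ.≤-reflexive (ℚₚ.*-assoc A B w))
        (ℚₚ.≤-trans (≤*ˡ {A} {B * w} {1ℚ} (approx≥0 p₀ K hK≥0) Bw≤1)
          (ℚₚ.≤-trans (ℚₚ.≤-reflexive (ℚₚ.*-identityʳ A)) A≤r))

  exp-rounded : ∀ q {r r′} → r ∉ exp (fromℚ q) → r < r′ → ∃[ q′ ] (q < q′ × r′ ∉ exp (fromℚ q′))
  exp-rounded q {r} {r′} hr lt = finish (step {r′} {r} (∉exp⇒≥0 (fromℚ q) hr) lt)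
    where
    finish : ∃[ δ ] (0ℚ < δ × 0ℚ < 1ℚ + - (δ + δ) × r ≤ r′ * (1ℚ + - (δ + δ))) →
             ∃[ q′ ] (q < q′ × r′ ∉ exp (fromℚ q′))
    finish (δ , δ>0 , w>0 , gap) = q + δ ,
      subst (_< q + δ) (ℚₚ.+-identityʳ q) (ℚₚ.+-monoʳ-< q δ>0) ,
      exp-step q {r} {r′} hr δ δ>0 w>0 gap

  -- exp (-n) ≤ 1 / (1 + n)
  small-exp : ∀ n {r} → 1ℚ ≤ r * ι n → 0ℚ ≤ r → r ∉ exp (fromℚ (- ι n))
  small-exp n {r} hr r≥0 = ∉exp-bound (fromℚ (- ι n)) 0 (ℚₚ.<-irrefl refl)
    (subst (0ℚ ≤_) (sym c≡) 1+n≥0)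
    (subst (λ z → 1ℚ ≤ r * z) (sym a≡) (ℚₚ.≤-trans hr (≤*ˡ {r} r≥0 n≤1+n)))
    where
    c≡ : compound (- (- ι n)) 0 ≡ 1ℚ + ι n
    c≡ = cong (1ℚ +_) (trans (ℚₚ.*-identityʳ (- (- ι n))) (neg-involutive (ι n)))
    a≡ : approx (- (- ι n)) 0 ≡ 1ℚ + ι n
    a≡ = trans (ℚₚ.*-identityʳ (compound (- (- ι n)) 0)) c≡
    1+n≥0 : 0ℚ ≤ 1ℚ + ι n
    1+n≥0 = +≥0 0≤1 (ι≥0 n)
    n≤1+n : ι n ≤ 1ℚ + ι n
    n≤1+n = subst (_≤ 1ℚ + ι n) (ℚₚ.+-identityˡ (ι n)) (ℚₚ.+-monoˡ-≤ (ι n) 0≤1)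

-- q < log x  iff  exp q < x
log : (x : ℝ) → 0ℝ <ℝ x → ℝ
log x x>0 = record
  { lower     = λ q → exp (fromℚ q) <ℝ x
  ; inhabited = inhabited′
  ; bounded   = bounded′
  ; closed    = λ { p<q (r , hr , r∈x) →
                  r , (λ { (s , k , hs , hk , lt) → hr (s , k , ℚₚ.<-trans hs p<q , hk , lt) }) , r∈x }
  ; rounded   = λ { {p} (r , hr , r∈x) →
                  let (r′ , lt , r′∈x) = rounded x r∈x
                      (q′ , lt′ , hr′) = exp-rounded p hr lt
                  in q′ , lt′ , r′ , hr′ , r′∈x }
  }
  where
  open Logarithm
  inhabited′ : ∃[ q ] exp (fromℚ q) <ℝ x
  inhabited′ =
    let (r , r>0 , r∈x) = 0<⇒∃ x x>0
        (e , e>0 , re)  = 1/pos r>0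
        (n , hn)        = archimedean e
    in ℚ.- ι n , r , small-exp n (subst (ℚ._≤ r ℚ.* ι n) re (≤*ˡ {r} (ℚₚ.<⇒≤ r>0) hn)) (ℚₚ.<⇒≤ r>0) , r∈x

  bounded′ : ∃[ q ] ¬ (exp (fromℚ q) <ℝ x)
  bounded′ with bounded x
  ... | b , hb = b , λ { (r , hr , r∈x) →
    let lt = ∈∉⇒< x r∈x hb
        r≥0 = ∉exp⇒≥0 (fromℚ b) hr
        h = ∉exp⇒≥ (fromℚ b) r 0 hr lt (+≥0 0≤1 (*≥0 r≥0 (recip≥0 0)))
    in <⇒≱ (q<q+1 r) (subst (ℚ._≤ r) (trans (approx0 r) (ℚₚ.+-comm 1ℚ r)) h) }

log>0 : ∀ {x} (x>0 : 0ℝ <ℝ x) → 1ℝ <ℝ x → 0ℝ <ℝ log x x>0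
log>0 {x} x>0 (r , hr , r∈x) = 0ℚ , ℚₚ.<-irrefl refl , r , bound , r∈x
  where
  bound : r ∉ exp 0ℝ
  bound = ∉exp-bound 0ℝ 0 (ℚₚ.<-irrefl refl) 0≤1
    (subst (1ℚ ℚ.≤_) (sym (ℚₚ.*-identityʳ r)) (ℚₚ.≮⇒≥ hr))

fromℕ>0 : ∀ n → 0ℝ <ℝ fromℕ (suc n)
fromℕ>0 n = 0ℚ , ℚₚ.<-irrefl refl ,
  ℚₚ.<-≤-trans 0<1 (ι-mono {1} {suc n} (ℕ.s≤s ℕ.z≤n))

logℕ : (n : ℕ) → 1 ℕ.≤ n → ℝ
logℕ (suc n) _ = log (fromℕ (suc n)) (fromℕ>0 n)

-- For n ≥ 3 we have log n > 1, because e ≤ (6/5)⁶ < 3.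
1<logℕ : ∀ n (n≥1 : 1 ℕ.≤ n) → 3 ℕ.≤ n → 1ℝ <ℝ logℕ n n≥1
1<logℕ (suc n) _ n≥3 = 1ℚ , ℚₚ.<-irrefl refl , r ,
  ∉exp-bound 1ℝ {1ℚ} {r} 5 (ℚₚ.<-irrefl refl) (toWitness {a? = 0ℚ ℚ.≤? compound (ℚ.- 1ℚ) 5} _)
    (toWitness {a? = 1ℚ ℚ.≤? r ℚ.* approx (ℚ.- 1ℚ) 5} _) ,
  ℚₚ.<-≤-trans (toWitness {a? = r ℚ.<? ι 3} _) (ι-mono n≥3)
  where
  r : ℚ
  r = ℤ.+ 46656 ℚ./ 15625

1<⇒0< : ∀ {x} → 1ℝ <ℝ x → 0ℝ <ℝ x
1<⇒0< (q , hq , q∈x) = q , (λ q<0 → hq (ℚₚ.<-trans q<0 0<1)) , q∈x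

log-over-loglog : (n : ℕ) → 3 ℕ.≤ n → ℝ
log-over-loglog n n≥3 = log-n ÷ℝ (log log-n log-n>0 , log>0 {log-n} log-n>0 1<log-n)
  where
  n≥1 : 1 ℕ.≤ n
  n≥1 = ℕₚ.≤-trans (ℕ.s≤s ℕ.z≤n) n≥3
  log-n : ℝ
  log-n = logℕ n n≥1
  1<log-n : 1ℝ <ℝ log-n
  1<log-n = 1<logℕ n n≥1 n≥3
  log-n>0 : 0ℝ <ℝ log-n
  log-n>0 = 1<⇒0< {log-n} 1<log-n

log2/2 : ℝ
log2/2 = logℕ 2 (ℕ.s≤s ℕ.z≤n) *ℝ fromℚ ½

------------------------------------------------------------------------
-- Distinct multiples in an interval

-- {m+1,…,m+H}
I : ℤ → ℕ → ℤ → Set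
I m H a = m ℤ.< a × a ℤ.≤ m ℤ.+ ℤ.+ H

-- {m+1,…,m+H} contains pairwise distinct multiples a i of the i satisfying S
-- (the values of a outside S are irrelevant).
HasDistinctMultiples : (ℕ → Set) → ℤ → ℕ → Set
HasDistinctMultiples S m H = Σ[ a ∈ (ℕ → ℤ) ]
  ((∀ i → S i → I m H (a i) × ℤ.+ i ∣ a i) ×
   (∀ i j → S i → S j → i ≢ j → a i ≢ a j))

Sufficient : (ℕ → Set) → ℕ → Set
Sufficient S H = 1 ℕ.≤ H × (∀ m → HasDistinctMultiples S m H)

IsLeast : (ℕ → Set) → ℕ → Set
IsLeast P H = P H × (∀ K → P K → H ℕ.≤ K)

UpTo PrimeUpTo : ℕ → ℕ → Set
UpTo n i = 1 ℕ.≤ i × i ℕ.≤ n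
PrimeUpTo n p = Prime p × p ℕ.≤ n

upTo? : ∀ n → Decidable (UpTo n)
upTo? n i = (1 ℕ.≤? i) ×-dec (i ℕ.≤? n)

primeUpTo? : ∀ n → Decidable (PrimeUpTo n)
primeUpTo? n p = prime? p ×-dec (p ℕ.≤? n)

primeUpTo⇒upTo : ∀ n {p} → PrimeUpTo n p → UpTo n p
primeUpTo⇒upTo n {p} (p-prime , p≤n) = ℕ.>-nonZero⁻¹ p {{prime⇒nonZero p-prime}} , p≤n

least : ∀ {P : ℕ → Set} → Decidable P → ∀ b → P b → ∃ (IsLeast P)
least {P} P? b hb = go b (b , ℕₚ.≤-refl , hb)
  where
  go : ∀ b → ∃[ k ] (k ℕ.≤ b × P k) → ∃ (IsLeast P)
  go b (k , k≤b , hk) with ℕₚ.anyUpTo? P? k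
  go b       (k , k≤b , hk) | no none = k , hk , λ K hK → ℕₚ.≮⇒≥ λ K<k → none (K , K<k , hK)
  go zero    (zero , k≤b , hk) | yes (_ , () , _)
  go (suc b) (k , k≤b , hk) | yes (l , l<k , hl) = go b (l , ℕ.s≤s⁻¹ (ℕₚ.≤-trans l<k k≤b) , hl)

module Existence (n : ℕ) (S : ℕ → Set) (S? : Decidable S) (S⊆ : ∀ {i} → S i → UpTo n i) where

  -- For fixed m the choice of the a i is a finite search.

  Choice : ℤ → ℕ → ℕ → List ℤ → Set
  Choice m H k used = Σ[ a ∈ (ℕ → ℤ) ]
    ((∀ i → i ℕ.< k → S i → I m H (a i) × ℤ.+ i ∣ a i × ¬ (a i List.∈ used)) ×
     (∀ i j → i ℕ.< k → j ℕ.< k → S i → S j → i ≢ j → a i ≢ a j))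

  private
    offset : ∀ {a m H} → I m H a → ∃[ t ] (t ℕ.< H × a ≡ m ℤ.+ ℤ.+ suc t)
    offset {a} {m} {H} (m<a , a≤) = from-diff (a ℤ.- m) refl
      where
      open ℤ-Solver.+-*-Solver
      a≡ : a ≡ m ℤ.+ (a ℤ.- m)
      a≡ = solve 2 (λ a m → a := m :+ (a :- m)) refl a m
      0<d : ℤ.0ℤ ℤ.< a ℤ.- m
      0<d = subst (ℤ._< a ℤ.- m) (ℤₚ.+-inverseʳ m) (ℤₚ.+-monoˡ-< (ℤ.- m) m<a)
      d≤H : a ℤ.- m ℤ.≤ ℤ.+ H
      d≤H = subst (a ℤ.- m ℤ.≤_) (solve 2 (λ m h → m :+ h :- m := h) refl m (ℤ.+ H))
              (ℤₚ.+-monoˡ-≤ (ℤ.- m) a≤)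
      from-diff : ∀ d → d ≡ a ℤ.- m → ∃[ t ] (t ℕ.< H × a ≡ m ℤ.+ ℤ.+ suc t)
      from-diff (ℤ.+ zero) e = ⊥-elim (ℤₚ.<-irrefl e 0<d)
      from-diff (ℤ.+ suc t) e = t , ℤₚ.drop‿+≤+ (subst (ℤ._≤ ℤ.+ H) (sym e) d≤H) ,
        trans a≡ (cong (ℤ._+_ m) (sym e))
      from-diff ℤ.-[1+ t ] e = ⊥-elim (ℤₚ.<-asym (subst (ℤ.0ℤ ℤ.<_) (sym e) 0<d) ℤ.-<+)

    inside : ∀ m {t H} → t ℕ.< H → I m H (m ℤ.+ ℤ.+ suc t)
    inside m {t} t<H =
      subst (ℤ._< m ℤ.+ ℤ.+ suc t) (ℤₚ.+-identityʳ m) (ℤₚ.+-monoʳ-< m (ℤ.+<+ ℕ.z<s)) ,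
      ℤₚ.+-monoʳ-≤ m (ℤ.+≤+ t<H)

    update : (ℕ → ℤ) → ℕ → ℤ → ℕ → ℤ
    update a k v i with i ℕ.≟ k
    ... | yes _ = v
    ... | no  _ = a i

    Candidate : ℤ → ℕ → ℕ → List ℤ → ℕ → Set
    Candidate m H k used t =
      ℤ.+ k ∣ v × ¬ (v List.∈ used) × Choice m H k (v ∷ used)
      where
      v : ℤ
      v = m ℤ.+ ℤ.+ suc t

    extend : ∀ {m H k used} → ∃[ t ] (t ℕ.< H × Candidate m H k used t) → Choice m H (suc k) used
    extend {m} {H} {k} {used} (t , t<H , k∣v , v∉ , a , good , distinct) = a′ , good′ , distinct′
      where
      v : ℤ
      v = m ℤ.+ ℤ.+ suc t
      a′ : ℕ → ℤ
      a′ = update a k v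
      below : ∀ {i} → i ℕ.< suc k → i ≢ k → i ℕ.< k
      below i<sk i≢k = ℕₚ.≤∧≢⇒< (ℕ.s≤s⁻¹ i<sk) i≢k
      good′ : ∀ i → i ℕ.< suc k → S i → I m H (a′ i) × ℤ.+ i ∣ a′ i × ¬ (a′ i List.∈ used)
      good′ i i<sk si with i ℕ.≟ k
      ... | yes refl = inside m t<H , k∣v , v∉
      ... | no i≢k = let (g₁ , g₂ , g₃) = good i (below i<sk i≢k) si in g₁ , g₂ , λ h → g₃ (there h)
      fresh : ∀ i → i ℕ.< k → S i → a i ≢ v
      fresh i i<k si e = proj₂ (proj₂ (good i i<k si)) (here e)
      distinct′ : ∀ i j → i ℕ.< suc k → j ℕ.< suc k → S i → S j → i ≢ j → a′ i ≢ a′ j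
      distinct′ i j i<sk j<sk si sj i≢j with i ℕ.≟ k | j ℕ.≟ k
      ... | yes refl | yes refl = λ _ → i≢j refl
      ... | yes refl | no j≢k   = λ e → fresh j (below j<sk j≢k) sj (sym e)
      ... | no i≢k   | yes refl = fresh i (below i<sk i≢k) si
      ... | no i≢k   | no j≢k   = distinct i j (below i<sk i≢k) (below j<sk j≢k) si sj i≢j

    restrict : ∀ {m H k used} → S k → Choice m H (suc k) used → ∃[ t ] (t ℕ.< H × Candidate m H k used t)
    restrict {m} {H} {k} {used} sk (a , good , distinct) =
      let (ak∈ , k∣ak , ak∉) = good k ℕₚ.≤-refl sk
          (t , t<H , ak≡) = offset ak∈
      in t , t<H , subst (ℤ.+ k ∣_) ak≡ k∣ak , (λ h → ak∉ (subst (List._∈ used) (sym ak≡) h)) , a ,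
         (λ i i<k si → let (g₁ , g₂ , g₃) = good i (ℕₚ.m≤n⇒m≤1+n i<k) si in g₁ , g₂ ,
            λ { (here e)  → distinct i k (ℕₚ.m≤n⇒m≤1+n i<k) ℕₚ.≤-refl si sk (ℕₚ.<⇒≢ i<k) (trans e (sym ak≡))
              ; (there h) → g₃ h }) ,
         (λ i j i<k j<k → distinct i j (ℕₚ.m≤n⇒m≤1+n i<k) (ℕₚ.m≤n⇒m≤1+n j<k))

    skip : ∀ {m H k used} → ¬ S k → Choice m H k used → Choice m H (suc k) used
    skip {k = k} ¬sk (a , good , distinct) = a ,
      (λ i i<sk si → good i (below i<sk si) si) ,
      (λ i j i<sk j<sk si sj → distinct i j (below i<sk si) (below j<sk sj) si sj)
      where
      below : ∀ {i} → i ℕ.< suc k → S i → i ℕ.< k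
      below i<sk si = ℕₚ.≤∧≢⇒< (ℕ.s≤s⁻¹ i<sk) λ { refl → ¬sk si }

    unskip : ∀ {m H k used} → Choice m H (suc k) used → Choice m H k used
    unskip (a , good , distinct) = a ,
      (λ i i<k → good i (ℕₚ.m≤n⇒m≤1+n i<k)) ,
      (λ i j i<k j<k → distinct i j (ℕₚ.m≤n⇒m≤1+n i<k) (ℕₚ.m≤n⇒m≤1+n j<k))

    choice? : ∀ m H k used → Dec (Choice m H k used)
    choice? m H zero used = yes ((λ _ → ℤ.0ℤ) , (λ _ ()) , (λ _ _ ()))
    choice? m H (suc k) used with S? k
    ... | no ¬sk = map′ (skip ¬sk) unskip (choice? m H k used)
    ... | yes sk = map′ extend (restrict sk)
      (ℕₚ.anyUpTo? (λ t → (ℤ.+ k ∣? m ℤ.+ ℤ.+ suc t) ×-dec (¬? (m ℤ.+ ℤ.+ suc t ∈? used) ×-dec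
                            choice? m H k (m ℤ.+ ℤ.+ suc t ∷ used))) H)

  hasDistinctMultiples? : ∀ m H → Dec (HasDistinctMultiples S m H)
  hasDistinctMultiples? m H = map′ to from (choice? m H (suc n) [])
    where
    bound : ∀ {i} → S i → i ℕ.< suc n
    bound si = ℕ.s≤s (proj₂ (S⊆ si))
    to : Choice m H (suc n) [] → HasDistinctMultiples S m H
    to (a , good , distinct) = a ,
      (λ i si → let (g₁ , g₂ , _) = good i (bound si) si in g₁ , g₂) ,
      (λ i j si sj → distinct i j (bound si) (bound sj) si sj)
    from : HasDistinctMultiples S m H → Choice m H (suc n) []
    from (a , good , distinct) = a ,
      (λ i _ si → let (g₁ , g₂) = good i si in g₁ , g₂ , λ ()) ,
      (λ i j _ _ → distinct i j)

  -- The condition on m only depends on m modulo n!.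

  private
    ∣! : ∀ {i} → UpTo n i → ℤ.+ i ∣ ℤ.+ (n ℕ.!)
    ∣! {suc i} (_ , i≤n) = ∣ᵤ⇒∣ (ℕ∣.∣-trans (ℕ∣.m∣m*n (i ℕ.!)) (ℕ∣.m≤n⇒m!∣n! i≤n))

    translate : ∀ {m H} c → HasDistinctMultiples S m H →
                HasDistinctMultiples S (m ℤ.+ c ℤ.* ℤ.+ (n ℕ.!)) H
    translate {m} {H} c (a , good , distinct) = (λ i → a i ℤ.+ d) ,
      (λ i si → let ((l , u) , i∣a) = good i si in
        (ℤₚ.+-monoˡ-< d l , subst (a i ℤ.+ d ℤ.≤_) swap (ℤₚ.+-monoˡ-≤ d u)) ,
        ∣m∣n⇒∣m+n i∣a (∣n⇒∣m*n c (∣! (S⊆ si)))) ,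
      (λ i j si sj i≢j e → distinct i j si sj i≢j (trans (undo (a i)) (trans (cong (ℤ._- d) e) (sym (undo (a j))))))
      where
      open ℤ-Solver.+-*-Solver
      d : ℤ
      d = c ℤ.* ℤ.+ (n ℕ.!)
      undo : ∀ z → z ≡ z ℤ.+ d ℤ.- d
      undo z = solve 2 (λ z d → z := z :+ d :- d) refl z d
      swap : m ℤ.+ ℤ.+ H ℤ.+ d ≡ m ℤ.+ d ℤ.+ ℤ.+ H
      swap = solve 3 (λ m h d → m :+ h :+ d := m :+ d :+ h) refl m (ℤ.+ H) d

    instance
      n!≢0 : ℕ.NonZero (n ℕ.!)
      n!≢0 = n !≢0

  sufficient? : Decidable (Sufficient S)
  sufficient? H = (1 ℕ.≤? H) ×-dec map′ to (λ all {r} _ → all (ℤ.+ r))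
    (ℕₚ.allUpTo? (λ r → hasDistinctMultiples? (ℤ.+ r) H) (n ℕ.!))
    where
    to : (∀ {r} → r ℕ.< n ℕ.! → HasDistinctMultiples S (ℤ.+ r) H) → ∀ m → HasDistinctMultiples S m H
    to residues m = subst (λ z → HasDistinctMultiples S z H) (sym (a≡a%ℕn+[a/ℕn]*n m (n ℕ.!)))
      (translate (m /ℕ (n ℕ.!)) (residues (n%ℕd<d m (n ℕ.!))))

  -- H = n² + 1 suffices: take a i to be the largest multiple of i that is at most m + i n.

  private
    multiple : ℤ → ℕ → ℤ
    multiple m zero = ℤ.0ℤ
    multiple m i@(suc _) = x ℤ.- ℤ.+ (x %ℕ i)
      where
      x : ℤ
      x = m ℤ.+ ℤ.+ (i ℕ.* n)

    multiple-spec : ∀ m i → UpTo n (suc i) →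
      m ℤ.+ ℤ.+ (i ℕ.* n) ℤ.< multiple m (suc i) ×
      multiple m (suc i) ℤ.≤ m ℤ.+ ℤ.+ (suc i ℕ.* n) ×
      ℤ.+ suc i ∣ multiple m (suc i)
    multiple-spec m i (_ , i<n) = lower′ , upper′ , div
      where
      open ℤ-Solver.+-*-Solver
      x : ℤ
      x = m ℤ.+ ℤ.+ (suc i ℕ.* n)
      r : ℕ
      r = x %ℕ suc i
      lower′ : m ℤ.+ ℤ.+ (i ℕ.* n) ℤ.< x ℤ.- ℤ.+ r
      lower′ = subst₂ ℤ._<_
        (solve 3 (λ m p r → m :+ (r :+ p) :- r := m :+ p) refl m (ℤ.+ (i ℕ.* n)) (ℤ.+ r))
        refl
        (ℤₚ.+-monoˡ-< (ℤ.- ℤ.+ r) (ℤₚ.+-monoʳ-< m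
          (ℤ.+<+ (ℕₚ.+-monoˡ-< (i ℕ.* n) (ℕₚ.<-≤-trans (n%ℕd<d x (suc i)) i<n)))))
      upper′ : x ℤ.- ℤ.+ r ℤ.≤ x
      upper′ = subst (x ℤ.- ℤ.+ r ℤ.≤_) (ℤₚ.+-identityʳ x) (ℤₚ.+-monoʳ-≤ x ℤₚ.neg-≤-pos)
      div : ℤ.+ suc i ∣ x ℤ.- ℤ.+ r
      div = divides (x /ℕ suc i) (trans (cong (ℤ._- ℤ.+ r) (a≡a%ℕn+[a/ℕn]*n x (suc i)))
        (solve 2 (λ r y → r :+ y :- r := y) refl (ℤ.+ r) (x /ℕ suc i ℤ.* ℤ.+ suc i)))

  sufficient-bound : Sufficient S (suc (n ℕ.* n))
  sufficient-bound = ℕ.s≤s ℕ.z≤n , λ m → multiple m , good m , distinct m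
    where
    good : ∀ m i → S i → I m (suc (n ℕ.* n)) (multiple m i) × ℤ.+ i ∣ multiple m i
    good m zero si with S⊆ si
    ... | () , _
    good m (suc i) si = let (l , u , d) = multiple-spec m i (S⊆ si) in
      (ℤₚ.≤-<-trans (ℤₚ.i≤i+j m (ℤ.+ (i ℕ.* n))) l ,
       ℤₚ.≤-trans u (ℤₚ.+-monoʳ-≤ m (ℤ.+≤+
         (ℕₚ.m≤n⇒m≤1+n (ℕₚ.*-monoˡ-≤ n (proj₂ (S⊆ si))))))) , d
    increasing : ∀ m i j → S i → S j → i ℕ.< j → multiple m i ℤ.< multiple m j
    increasing m zero j si _ _ with S⊆ si
    ... | () , _
    increasing m (suc i) (suc j) si sj i<j =
      ℤₚ.≤-<-trans (proj₁ (proj₂ (multiple-spec m i (S⊆ si))))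
        (ℤₚ.≤-<-trans (ℤₚ.+-monoʳ-≤ m (ℤ.+≤+ (ℕₚ.*-monoˡ-≤ n (ℕ.s≤s⁻¹ i<j))))
          (proj₁ (multiple-spec m j (S⊆ sj))))
    distinct : ∀ m i j → S i → S j → i ≢ j → multiple m i ≢ multiple m j
    distinct m i j si sj i≢j e with ℕₚ.<-cmp i j
    ... | tri< i<j _ _ = ℤₚ.<-irrefl e (increasing m i j si sj i<j)
    ... | tri≈ _ i≡j _ = i≢j i≡j
    ... | tri> _ _ j<i = ℤₚ.<-irrefl (sym e) (increasing m j i sj si j<i)

  least-sufficient : ∃ (IsLeast (Sufficient S))
  least-sufficient = least sufficient? (suc (n ℕ.* n)) sufficient-bound

private
  module F-existence n = Existence n (UpTo n) (upTo? n) (λ h → h)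
  module hℙ-existence n = Existence n (PrimeUpTo n) (primeUpTo? n) (primeUpTo⇒upTo n)

F hℙ : ℕ → ℕ
F n = proj₁ (F-existence.least-sufficient n)
hℙ n = proj₁ (hℙ-existence.least-sufficient n)

F-isLeast : ∀ n → IsLeast (Sufficient (UpTo n)) (F n)
F-isLeast n = proj₂ (F-existence.least-sufficient n)

hℙ-isLeast : ∀ n → IsLeast (Sufficient (PrimeUpTo n)) (hℙ n)
hℙ-isLeast n = proj₂ (hℙ-existence.least-sufficient n)

-- Let Q be a product of r odd primes q of size about log n, where r ~ log n / log log n and
-- Q ≤ n^(1 - o(1)). For primes p = P₀ + δ with δ < Q, choose m by the Chinese remainder theorem
-- so that the multiples of p in {m+1,…,m+H} are m + c + k p, where c ≡ -η² and 2η ≡ δ (mod Q).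
-- Completing the square, c + k δ ≡ k² - (k - η)² (mod Q), which for fixed k takes only (q + 1) / 2
-- values modulo each q. Hence the multiples of all these p lie in a set of about K² Q / 2^r
-- integers if H = n K, while by Chebyshev's bound some block [P₀, P₀ + Q) contains about Q / log n
-- primes. By pigeonhole this is impossible for distinct multiples if K is slightly smaller than
-- 2^(r/2) = n^((log 2 / 2) / log log n).

module Submission where

open import Defs
open Rational
open ℝ
open import Data.Nat using (ℕ; _≤_; _≥_)
open import Data.Product using (∃-syntax; _×_)
open import Data.Fin using (Fin; combine; fromℕ<)
import Data.Fin.Properties as Finₚ
import Data.Integer as ℤ
import Data.Integer.Divisibility.Signed as ℤ∣
import Data.Integer.Properties as ℤₚ
import Data.Integer.Solver as ℤ-Solver
open import Data.List using (List; []; _∷_; length; lookup; map)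
open import Data.List.Relation.Unary.All as All using (All; []; _∷_)
open import Data.List.Relation.Unary.AllPairs using ([]; _∷_)
open import Data.List.Relation.Unary.Unique.Propositional using (Unique)
open import Data.Nat using (zero; suc; _+_; _*_; _∸_; _^_; _<_; _≤?_; z≤n; s≤s; NonZero; ∣_-_∣)
open import Data.Nat.Combinatorics using (_C_; nCk+nC[k+1]≡[n+1]C[k+1]; nC1≡n; k>n⇒nCk≡0)
open import Data.Nat.Divisibility
  using (_∣_; _∣?_; divides; 1∣_; ∣-refl; ∣⇒≤; ∣m⇒∣m*n; ∣n⇒∣m*n; *-pres-∣; m∣m*n; ∣m∣n⇒∣m+n; ∣m+n∣m⇒∣n; n∣m*n)
open import Data.Nat.DivMod using (_/_; _%_; m≡m%n+[m/n]*n; m%n<n; m<n*o⇒m/o<n; m/n*n≤m; m*n/n≡m; /-monoˡ-≤)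
open import Data.Nat.Induction using (<-rec)
open import Data.Nat.ListAction using (product)
open import Data.Nat.Primality
  using (Prime; prime?; prime⇒nonZero; prime⇒nonTrivial; prime⇒irreducible; euclidsLemma)
open import Data.Nat.Coprimality using (Coprime; coprime-Bézout)
open import Data.Nat.GCD using (module Bézout)
open import Data.Nat.ListAction.Properties using (∈⇒∣product)
open import Data.List.Membership.Propositional.Properties using (∈-lookup)
open import Data.Nat.Primality.Factorisation using (factorise; factorisationHasAllPrimeFactors)
import Data.Nat as ℕ
import Data.Nat.Properties as ℕₚ
open import Data.Nat.Tactic.RingSolver using (solve-∀)
open import Data.Product using (_,_; proj₁; proj₂)
open import Data.Sum using (_⊎_; inj₁; inj₂; [_,_]′)
open import Relation.Binary.PropositionalEquality
  using (_≡_; _≢_; refl; sym; trans; cong; cong₂; subst; subst₂; module ≡-Reasoning)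
open import Relation.Nullary using (¬_; yes; no; contradiction)
open import Algebra.Bundles using (CommutativeRing)
import Algebra.Properties.CommutativeSemiring.Exp as Exp
import Data.Rational as ℚ
import Data.Rational.Properties as ℚₚ
import Data.Rational.Solver as ℚ-Solver
open import Data.Rational using (ℚ; 0ℚ; 1ℚ; ½)
open Exp (CommutativeRing.commutativeSemiring ℚₚ.+-*-commutativeRing) using (^-assocʳ) renaming (_^_ to _^ℚ_)

-- The gain is `2 ^ (r / 2)` and not `2 ^ r` because of the square in `K²`: a point is recorded by
-- `k`, by the quotient of `c + k δ` by `Q`, each with about `K` values, and by the class of a
-- square modulo `Q`. The quotient is indispensable, since a collision must be an equality of
-- integers and not a congruence. The class `c` can be prescribed for each `p` separately because
-- the Chinese remainder theorem works modulo the primes `p`, while the compression happens modulo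
-- the primes `q`. The main sizes are powers of two, so that the counting compares exponents in ℕ;
-- constant factors and powers of `log n` disappear in the `o(1)`. The cuts carry no locatedness, so
-- the real bound is proved on rational points: `exp x ≤ b` is used in the form `approx p k ≤ ι b`
-- for all `p ∈ x` and all admissible levels `k`. The number `log 2` enters through rationals `a₁`
-- below it, which occur both in the exponent and in the lower bound `τ a₁` for `log log n`, and
-- cancel.

-- Integer logarithms

2≤prime : ∀ {p} → Prime p → 2 ≤ p
2≤prime {p} pp = ℕ.nonTrivial⇒n>1 p {{prime⇒nonTrivial pp}}

n<b^n : ∀ {b} → 2 ≤ b → ∀ n → n < b ^ n
n<b^n 2≤b zero = s≤s z≤n
n<b^n {b} 2≤b (suc n) = begin-strict
  suc n          ≤⟨ n<b^n 2≤b n ⟩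
  b ^ n          <⟨ ℕₚ.m<m+n (b ^ n) (ℕₚ.<-≤-trans (s≤s z≤n) (n<b^n 2≤b n)) ⟩
  b ^ n + b ^ n  ≡⟨ cong (b ^ n +_) (sym (ℕₚ.+-identityʳ (b ^ n))) ⟩
  2 * b ^ n      ≤⟨ ℕₚ.*-monoˡ-≤ (b ^ n) 2≤b ⟩
  b * b ^ n      ∎
  where open ℕₚ.≤-Reasoning

greatestExponent : ℕ → ℕ → ℕ → ℕ
greatestExponent b n zero = 0
greatestExponent b n (suc k) with b ^ suc k ≤? n
... | yes _ = suc k
... | no  _ = greatestExponent b n k

-- Starting the downward search at `n` misses no exponent, since `e < b ^ e` for `b ≥ 2`.
⌊log⌋ : ℕ → ℕ → ℕ
⌊log⌋ b n = greatestExponent b n n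

b^⌊log⌋≤n : ∀ b {n} → 1 ≤ n → b ^ ⌊log⌋ b n ≤ n
b^⌊log⌋≤n b {n} 1≤n = go n
  where
  go : ∀ k → b ^ greatestExponent b n k ≤ n
  go zero = 1≤n
  go (suc k) with b ^ suc k ≤? n
  ... | yes h = h
  ... | no  _ = go k

b^e≤n⇒e≤⌊log⌋ : ∀ {b e n} → 2 ≤ b → b ^ e ≤ n → e ≤ ⌊log⌋ b n
b^e≤n⇒e≤⌊log⌋ {b} {e} {n} 2≤b h = go n (ℕₚ.<⇒≤ (ℕₚ.<-≤-trans (n<b^n 2≤b e) h))
  where
  go : ∀ k → e ≤ k → e ≤ greatestExponent b n k
  go zero e≤0 = e≤0
  go (suc k) e≤k with b ^ suc k ≤? n
  ... | yes _  = e≤k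
  ... | no ¬le with ℕₚ.m≤n⇒m<n∨m≡n e≤k
  ...   | inj₁ e<sk = go k (ℕ.s≤s⁻¹ e<sk)
  ...   | inj₂ refl = contradiction h ¬le

n<b^[1+⌊log⌋] : ∀ {b} n → 2 ≤ b → n < b ^ suc (⌊log⌋ b n)
n<b^[1+⌊log⌋] n 2≤b = ℕₚ.≰⇒> λ h → ℕₚ.<-irrefl refl (b^e≤n⇒e≤⌊log⌋ 2≤b h)

-- Counting primes in intervals

primesFrom : ℕ → ℕ → List ℕ
primesFrom a zero = []
primesFrom a (suc k) with prime? (a + k)
... | yes _ = a + k ∷ primesFrom a k
... | no  _ = primesFrom a k

π : ℕ → ℕ → ℕ
π a k = length (primesFrom a k)

PrimeIn : ℕ → ℕ → ℕ → Set
PrimeIn a b p = Prime p × a ≤ p × p < b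

primesFrom-all : ∀ a k → All (PrimeIn a (a + k)) (primesFrom a k)
primesFrom-all a zero = []
primesFrom-all a (suc k) with prime? (a + k)
... | yes pp = (pp , ℕₚ.m≤m+n a k , ℕₚ.+-monoʳ-< a (ℕₚ.n<1+n k)) ∷ All.map widen (primesFrom-all a k)
  where
  widen : ∀ {p} → PrimeIn a (a + k) p → PrimeIn a (a + suc k) p
  widen (pp , l , u) = pp , l , ℕₚ.<-trans u (ℕₚ.+-monoʳ-< a (ℕₚ.n<1+n k))
... | no  _  = All.map widen (primesFrom-all a k)
  where
  widen : ∀ {p} → PrimeIn a (a + k) p → PrimeIn a (a + suc k) p
  widen (pp , l , u) = pp , l , ℕₚ.<-trans u (ℕₚ.+-monoʳ-< a (ℕₚ.n<1+n k))

primesFrom-unique : ∀ a k → Unique (primesFrom a k)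
primesFrom-unique a zero = []
primesFrom-unique a (suc k) with prime? (a + k)
... | yes _ = All.map (λ (_ , _ , u) e → ℕₚ.<-irrefl (sym e) u) (primesFrom-all a k) ∷ primesFrom-unique a k
... | no  _ = primesFrom-unique a k

π-+ : ∀ a j k → π a (j + k) ≡ π a j + π (a + j) k
π-+ a j zero = trans (cong (π a) (ℕₚ.+-identityʳ j)) (sym (ℕₚ.+-identityʳ (π a j)))
π-+ a j (suc k) = trans (cong (π a) (ℕₚ.+-suc j k)) step
  where
  step : π a (suc (j + k)) ≡ π a j + π (a + j) (suc k)
  step with prime? (a + (j + k)) | prime? (a + j + k)
  ... | yes _  | yes _  = trans (cong suc (π-+ a j k)) (sym (ℕₚ.+-suc (π a j) (π (a + j) k)))
  ... | no _   | no _   = π-+ a j k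
  ... | yes pp | no ¬pp = contradiction (subst Prime (sym (ℕₚ.+-assoc a j k)) pp) ¬pp
  ... | no ¬pp | yes pp = contradiction (subst Prime (ℕₚ.+-assoc a j k) pp) ¬pp

π≤ : ∀ a k → π a k ≤ k
π≤ a zero = z≤n
π≤ a (suc k) with prime? (a + k)
... | yes _ = s≤s (π≤ a k)
... | no  _ = ℕₚ.m≤n⇒m≤1+n (π≤ a k)

-- The count grows by at most one per step. This allows the choice of exactly `r` primes `q`.
π-intermediate : ∀ a k r → r ≤ π a k → ∃[ j ] (j ≤ k × π a j ≡ r)
π-intermediate a zero r r≤ = 0 , z≤n , sym (ℕₚ.n≤0⇒n≡0 r≤)
π-intermediate a (suc k) r r≤ with ℕₚ.m≤n⇒m<n∨m≡n r≤
... | inj₂ e = suc k , ℕₚ.≤-refl , sym e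
... | inj₁ lt = let (j , j≤k , e) = π-intermediate a k r (below lt) in j , ℕₚ.m≤n⇒m≤1+n j≤k , e
  where
  below : r < π a (suc k) → r ≤ π a k
  below lt with prime? (a + k)
  ... | yes _ = ℕ.s≤s⁻¹ lt
  ... | no  _ = ℕₚ.<⇒≤ lt

-- Chebyshev's lower bound for the number of primes

[1+k]C[1+n,1+k]≡[1+n]C[n,k] : ∀ n k → suc k * (suc n C suc k) ≡ suc n * (n C k)
[1+k]C[1+n,1+k]≡[1+n]C[n,k] n zero = trans (ℕₚ.+-identityʳ _) (trans (nC1≡n (suc n)) (sym (ℕₚ.*-identityʳ (suc n))))
[1+k]C[1+n,1+k]≡[1+n]C[n,k] zero (suc k) =
  trans (cong (suc (suc k) *_) (k>n⇒nCk≡0 {1} {suc (suc k)} (s≤s (s≤s z≤n))))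
    (trans (ℕₚ.*-zeroʳ (suc (suc k))) (sym (cong (1 *_) (k>n⇒nCk≡0 {0} {suc k} (s≤s z≤n)))))
[1+k]C[1+n,1+k]≡[1+n]C[n,k] (suc n) (suc k) = begin
  suc (suc k) * (suc (suc n) C suc (suc k))  ≡⟨ cong (suc (suc k) *_) (sym (nCk+nC[k+1]≡[n+1]C[k+1] (suc n) (suc k))) ⟩
  suc (suc k) * (A + (suc n C suc (suc k)))  ≡⟨ ring₁ (suc k) A (suc n C suc (suc k)) ⟩
  A + (suc k * A + suc (suc k) * (suc n C suc (suc k)))
    ≡⟨ cong (A +_) (cong₂ _+_ ([1+k]C[1+n,1+k]≡[1+n]C[n,k] n k) ([1+k]C[1+n,1+k]≡[1+n]C[n,k] n (suc k))) ⟩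
  A + (suc n * (n C k) + suc n * (n C suc k))  ≡⟨ cong (A +_) (sym (ℕₚ.*-distribˡ-+ (suc n) (n C k) (n C suc k))) ⟩
  A + suc n * ((n C k) + (n C suc k))        ≡⟨ cong (λ z → A + suc n * z) (nCk+nC[k+1]≡[n+1]C[k+1] n k) ⟩
  suc (suc n) * A                            ∎
  where
  open ≡-Reasoning
  A : ℕ
  A = suc n C suc k
  ring₁ : ∀ k a b → suc k * (a + b) ≡ a + (k * a + suc k * b)
  ring₁ = solve-∀

-- The quotients D / ((n + 1) C(n, k)) satisfy the recurrence of Leibniz's harmonic triangle.
[1+n]C[n,k]∣ : ∀ {D} n k → k ≤ n → (∀ i → 1 ≤ i → i ≤ suc n → i ∣ D) → ℤ.+ (suc n * (n C k)) ℤ∣.∣ ℤ.+ D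
[1+n]C[n,k]∣ {D} n zero _ h = ℤ∣.∣ᵤ⇒∣ (subst (_∣ D) (sym (ℕₚ.*-identityʳ (suc n))) (h (suc n) (s≤s z≤n) ℕₚ.≤-refl))
[1+n]C[n,k]∣ {D} (suc n) (suc k) (s≤s k≤n) h
  with [1+n]C[n,k]∣ (suc n) k (ℕₚ.m≤n⇒m≤1+n k≤n) h | [1+n]C[n,k]∣ n k k≤n (λ i 1≤i i≤ → h i 1≤i (ℕₚ.m≤n⇒m≤1+n i≤))
-- The new quotient is a difference, hence the passage to ℤ. The equation is checked after
-- multiplication by `k + 1`, which turns the next binomial coefficient into known ones.
... | ℤ∣.divides z₁ e₁ | ℤ∣.divides z₂ e₂ = ℤ∣.divides (z₂ ℤ.- z₁)
  (ℤₚ.*-cancelˡ-≡ (ℤ.+ suc k) (ℤ.+ D) _ (sym main))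
  where
  open ℤ-Solver.+-*-Solver
  A B k′ n′ : ℤ.ℤ
  A = ℤ.+ (suc n C k)
  B = ℤ.+ (suc n C suc k)
  k′ = ℤ.+ suc k
  n′ = ℤ.+ suc n
  -- This is `(k + 1) C(N, k + 1) = (N - k) C(N, k)` for `N = n + 1`, with the subtracted term moved
  -- to the left.
  absorb : suc k * (suc n C suc k) + k * (suc n C k) ≡ suc n * (suc n C k)
  absorb = ℕₚ.+-cancelˡ-≡ (suc n C k) _ _ (trans (ring₁ k (suc n C k) (suc n C suc k))
    (trans (cong (suc k *_) (nCk+nC[k+1]≡[n+1]C[k+1] (suc n) k)) ([1+k]C[1+n,1+k]≡[1+n]C[n,k] (suc n) k)))
    where
    ring₁ : ∀ k a b → a + (suc k * b + k * a) ≡ suc k * (a + b)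
    ring₁ = solve-∀
  absorb′ : k′ ℤ.* B ℤ.+ ℤ.+ k ℤ.* A ≡ n′ ℤ.* A
  absorb′ = trans (cong₂ ℤ._+_ (sym (ℤₚ.pos-* (suc k) _)) (sym (ℤₚ.pos-* k _)))
    (trans (cong ℤ.+_ absorb) (ℤₚ.pos-* (suc n) _))
  e₁′ : ℤ.+ D ≡ z₁ ℤ.* ((ℤ.+ 1 ℤ.+ n′) ℤ.* A)
  e₁′ = trans e₁ (cong (z₁ ℤ.*_) (ℤₚ.pos-* (suc (suc n)) (suc n C k)))
  e₂′ : ℤ.+ D ≡ z₂ ℤ.* (k′ ℤ.* B)
  e₂′ = trans e₂ (cong (z₂ ℤ.*_) (trans (cong ℤ.+_ (sym ([1+k]C[1+n,1+k]≡[1+n]C[n,k] n k))) (ℤₚ.pos-* (suc k) _)))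
  main : k′ ℤ.* ((z₂ ℤ.- z₁) ℤ.* ℤ.+ (suc (suc n) * (suc n C suc k))) ≡ k′ ℤ.* ℤ.+ D
  main = trans (cong (λ z → k′ ℤ.* ((z₂ ℤ.- z₁) ℤ.* z)) (ℤₚ.pos-* (suc (suc n)) (suc n C suc k)))
    (trans (solve 5 (λ k z₁ z₂ n b → k :* ((z₂ :- z₁) :* ((con (ℤ.+ 1) :+ n) :* b)) :=
        (con (ℤ.+ 1) :+ n) :* (z₂ :* (k :* b)) :- z₁ :* ((con (ℤ.+ 1) :+ n) :* (k :* b))) refl k′ z₁ z₂ n′ B)
    (trans (cong₂ (λ u v → (ℤ.+ 1 ℤ.+ n′) ℤ.* u ℤ.- z₁ ℤ.* ((ℤ.+ 1 ℤ.+ n′) ℤ.* v)) (sym e₂′) kB)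
    (trans (solve 5 (λ d z₁ n k a → (con (ℤ.+ 1) :+ n) :* d :- z₁ :* ((con (ℤ.+ 1) :+ n) :* (n :* a :- k :* a)) :=
        (con (ℤ.+ 1) :+ n) :* d :- (n :- k) :* (z₁ :* ((con (ℤ.+ 1) :+ n) :* a))) refl (ℤ.+ D) z₁ n′ (ℤ.+ k) A)
    (trans (cong (λ u → (ℤ.+ 1 ℤ.+ n′) ℤ.* ℤ.+ D ℤ.- (n′ ℤ.- ℤ.+ k) ℤ.* u) (sym e₁′))
      (solve 3 (λ d n k → (con (ℤ.+ 1) :+ n) :* d :- (n :- k) :* d := (con (ℤ.+ 1) :+ k) :* d) refl (ℤ.+ D) n′ (ℤ.+ k))))))
    where
    kB : k′ ℤ.* B ≡ n′ ℤ.* A ℤ.- ℤ.+ k ℤ.* A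
    kB = trans (solve 2 (λ x y → x := x :+ y :- y) refl (k′ ℤ.* B) (ℤ.+ k ℤ.* A)) (cong (ℤ._- ℤ.+ k ℤ.* A) absorb′)

-- The induction carries both middle entries of row `2j + 1`: their sum is the middle entry of row
-- `2j + 2`, which is a summand of each middle entry of row `2j + 3`.
2^j≤central : ∀ j → 2 ^ j ≤ suc (2 * j) C j × 2 ^ j ≤ suc (2 * j) C suc j
2^j≤central zero = s≤s z≤n , s≤s z≤n
2^j≤central (suc j) = subst (λ z → 2 ^ suc j ≤ z C suc j × 2 ^ suc j ≤ z C suc (suc j)) (sym idx)
  ( ℕₚ.≤-trans mid (subst (M ≤_) (nCk+nC[k+1]≡[n+1]C[k+1] (suc (suc (2 * j))) j) (ℕₚ.m≤n+m M _))
  , ℕₚ.≤-trans mid (subst (M ≤_) (nCk+nC[k+1]≡[n+1]C[k+1] (suc (suc (2 * j))) (suc j)) (ℕₚ.m≤m+n M _)))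
  where
  M : ℕ
  M = suc (suc (2 * j)) C suc j
  idx : suc (2 * suc j) ≡ suc (suc (suc (2 * j)))
  idx = cong suc (ℕₚ.*-suc 2 j)
  mid : 2 ^ suc j ≤ M
  mid = subst₂ _≤_ (cong (2 ^ j +_) (sym (ℕₚ.+-identityʳ (2 ^ j)))) (nCk+nC[k+1]≡[n+1]C[k+1] (suc (2 * j)) j)
    (ℕₚ.+-mono-≤ (proj₁ (2^j≤central j)) (proj₂ (2^j≤central j)))

-- `D` is a multiple of `2m C(2m - 1, m - 1)`, of which the first factor is at least 2 and the
-- second at least `2 ^ (m - 1)`.
2^m≤common-multiple : ∀ {D} m → 1 ≤ D → 1 ≤ m → (∀ i → 1 ≤ i → i ≤ 2 * m → i ∣ D) → 2 ^ m ≤ D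
2^m≤common-multiple {D@(suc _)} (suc j) _ _ h = begin
  2 * 2 ^ j                          ≤⟨ ℕₚ.*-mono-≤ (s≤s (s≤s (z≤n {2 * j}))) (proj₁ (2^j≤central j)) ⟩
  suc (suc (2 * j)) * (suc (2 * j) C j)  ≤⟨ ∣⇒≤ (ℤ∣.∣⇒∣ᵤ ([1+n]C[n,k]∣ (suc (2 * j)) j (ℕₚ.m≤n⇒m≤1+n (ℕₚ.m≤m+n j _))
                                          (λ i 1≤i i≤ → h i 1≤i (subst (i ≤_) (sym (ℕₚ.*-suc 2 j)) i≤)))) ⟩
  D                                  ∎
  where open ℕₚ.≤-Reasoning

p-part : ∀ {p} → Prime p → ∀ i → 1 ≤ i → ∃[ e ] ∃[ i′ ] (i ≡ p ^ e * i′ × ¬ (p ∣ i′))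
p-part {p} pp = <-rec _ go
  where
  go : ∀ i → (∀ {j} → j < i → 1 ≤ j → ∃[ e ] ∃[ i′ ] (j ≡ p ^ e * i′ × ¬ (p ∣ i′))) →
       1 ≤ i → ∃[ e ] ∃[ i′ ] (i ≡ p ^ e * i′ × ¬ (p ∣ i′))
  go i rec 1≤i with p ∣? i
  ... | no p∤i = 0 , i , sym (ℕₚ.+-identityʳ i) , p∤i
  ... | yes (divides zero e) = contradiction (subst (1 ≤_) e 1≤i) λ ()
  ... | yes (divides j@(suc _) e)
    with e′ , i′ , eq , p∤i′ ← rec (subst (j <_) (sym e) (ℕₚ.m<m*n j p (2≤prime pp))) (s≤s z≤n) =
    suc e′ , i′ , trans e (trans (cong (_* p) eq) (trans (ℕₚ.*-comm _ p) (sym (ℕₚ.*-assoc p (p ^ e′) i′)))) , p∤i′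

-- If `ps` lists the primes up to `n`, the product of `primePowers n ps` is lcm(1, ..., n).
primePowers : ℕ → List ℕ → List ℕ
primePowers n = map (λ p → p ^ ⌊log⌋ p n)

-- Induction on the bound `b` for the prime factors of `i`: passing a prime `b` strips the full
-- `b`-part from `i`, whose exponent is at most `⌊log⌋ b n` because `i ≤ n`.
∣product-primePowers : ∀ n b i → 1 ≤ i → i ≤ n → (∀ {p} → Prime p → p ∣ i → p < b) →
                       i ∣ product (primePowers n (primesFrom 0 b))
∣product-primePowers n zero (suc i) _ _ small with factorise (suc i)
... | record { factors = [] ; isFactorisation = e } = subst (_∣ 1) (sym e) ∣-refl
... | record { factors = p ∷ ps ; isFactorisation = e ; factorsPrime = pp ∷ _ } =
  contradiction (small pp (subst (p ∣_) (sym e) (m∣m*n (product ps)))) λ ()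
∣product-primePowers n (suc b) i 1≤i i≤n small with prime? b
... | no ¬pb = ∣product-primePowers n b i 1≤i i≤n
        λ pp p∣i → ℕₚ.≤∧≢⇒< (ℕ.s≤s⁻¹ (small pp p∣i)) λ { refl → ¬pb pp }
... | yes pb with p-part pb i 1≤i
...   | e , i′@(suc _) , refl , b∤i′ = *-pres-∣
        (subst (b ^ e ∣_) (trans (sym (ℕₚ.^-distribˡ-+-* b e _)) (cong (b ^_) (ℕₚ.m+[n∸m]≡n e≤)))
          (m∣m*n (b ^ (⌊log⌋ b n ∸ e))))
        (∣product-primePowers n b i′ (s≤s z≤n)
          (ℕₚ.≤-trans (ℕₚ.m≤n*m i′ (b ^ e) {{ℕₚ.m^n≢0 b e {{prime⇒nonZero pb}}}}) i≤n)
          λ pp p∣i′ → ℕₚ.≤∧≢⇒< (ℕ.s≤s⁻¹ (small pp (∣n⇒∣m*n (b ^ e) p∣i′))) λ { refl → b∤i′ p∣i′ })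
  where
  e≤ : e ≤ ⌊log⌋ b n
  e≤ = b^e≤n⇒e≤⌊log⌋ (2≤prime pb) (ℕₚ.≤-trans (ℕₚ.m≤m*n (b ^ e) i′) i≤n)
...   | e , zero , refl , b∤0 = contradiction (divides 0 refl) b∤0

product-primePowers≤ : ∀ {n} → 1 ≤ n → ∀ ps → product (primePowers n ps) ≤ n ^ length ps
product-primePowers≤ 1≤n [] = ℕₚ.≤-refl
product-primePowers≤ 1≤n (p ∷ ps) = ℕₚ.*-mono-≤ (b^⌊log⌋≤n p 1≤n) (product-primePowers≤ 1≤n ps)

product-primePowers≥1 : ∀ n {ps} → All Prime ps → 1 ≤ product (primePowers n ps)
product-primePowers≥1 n [] = ℕₚ.≤-refl
product-primePowers≥1 n {p ∷ _} (pp ∷ pps) =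
  ℕₚ.*-mono-≤ (ℕₚ.m^n>0 p {{prime⇒nonZero pp}} (⌊log⌋ p n)) (product-primePowers≥1 n pps)

-- For `n = 2 ^ (ℓ + 1)`, lcm(1, ..., n) is at least `2 ^ (n / 2)` and at most
-- `n ^ π(n) = 2 ^ ((ℓ + 1) π(n))`; the exponents are compared.
chebyshev : ∀ ℓ → 2 ^ ℓ ≤ suc ℓ * π 0 (suc (2 ^ suc ℓ))
chebyshev ℓ = ℕₚ.≮⇒≥ λ lt → ℕₚ.<⇒≱ (ℕₚ.^-monoʳ-< 2 (s≤s (s≤s z≤n)) lt) (begin
  2 ^ 2 ^ ℓ                        ≤⟨ 2^m≤common-multiple (2 ^ ℓ)
                                        (product-primePowers≥1 n (All.map proj₁ (primesFrom-all 0 (suc n))))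
                                        (ℕₚ.m^n>0 2 ℓ)
                                        (λ { i@(suc _) 1≤i i≤ → ∣product-primePowers n (suc n) i 1≤i i≤
                                          λ _ p∣i → s≤s (ℕₚ.≤-trans (∣⇒≤ p∣i) i≤) }) ⟩
  product (primePowers n (primesFrom 0 (suc n)))  ≤⟨ product-primePowers≤ (ℕₚ.m^n>0 2 (suc ℓ)) (primesFrom 0 (suc n)) ⟩
  n ^ π 0 (suc n)                  ≡⟨ ℕₚ.^-*-assoc 2 (suc ℓ) (π 0 (suc n)) ⟩
  2 ^ (suc ℓ * π 0 (suc n))        ∎)
  where
  open ℕₚ.≤-Reasoning
  n : ℕ
  n = 2 ^ suc ℓ

-- Congruences

∣-residues-unique : ∀ {d a b} → a < d → b < d → ℤ.+ d ℤ∣.∣ ℤ.+ a ℤ.- ℤ.+ b → a ≡ b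
∣-residues-unique {d} {a} {b} a<d b<d d∣a-b = ℤₚ.+-injective (ℤₚ.i-j≡0⇒i≡j (ℤ.+ a) (ℤ.+ b) (ℤₚ.∣i∣≡0⇒i≡0 (zero-of (ℤ∣.∣⇒∣ᵤ d∣a-b) small)))
  where
  small : ℤ.∣ ℤ.+ a ℤ.- ℤ.+ b ∣ < d
  small = ℕₚ.≤-<-trans (subst (λ z → ℤ.∣ z ∣ ≤ a ℕ.⊔ b) (sym (ℤₚ.m-n≡m⊖n a b)) (ℤₚ.∣m⊝n∣≤m⊔n a b))
    (ℕₚ.⊔-lub a<d b<d)
  zero-of : ∀ {x} → d ∣ x → x < d → x ≡ 0
  zero-of {zero} _ _ = refl
  zero-of {suc _} d∣x x<d = contradiction (∣⇒≤ d∣x) (ℕₚ.<⇒≱ x<d)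

prime∤product : ∀ {p ps} → Prime p → All Prime ps → All (p ≢_) ps → ¬ (p ∣ product ps)
prime∤product pp pps p≢ h = All.lookup p≢ (factorisationHasAllPrimeFactors pp h pps) refl

product-∣ : ∀ {z} qs → All Prime qs → Unique qs → All (_∣ z) qs → product qs ∣ z
product-∣ [] _ _ _ = 1∣ _
product-∣ {z} (q ∷ qs) (pq ∷ pqs) (q≢ ∷ uqs) (q∣z ∷ qs∣z) with product-∣ qs pqs uqs qs∣z
... | divides w refl with euclidsLemma w (product qs) pq q∣z
...   | inj₁ q∣w = *-pres-∣ q∣w ∣-refl
...   | inj₂ q∣P = contradiction q∣P (prime∤product pq pqs q≢)

-- `j` is an inverse of `-n`, a sign that keeps the statement in ℕ.
prime-inverse : ∀ {p n} → Prime p → ¬ (p ∣ n) → ∃[ j ] p ∣ 1 + n * j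
prime-inverse {p@(suc p-1)} {n} pp p∤n with coprime-Bézout {p} {n} coprime
  where
  coprime : Coprime p n
  coprime (d∣p , d∣n) with prime⇒irreducible pp d∣p
  ... | inj₁ d≡1 = d≡1
  ... | inj₂ refl = contradiction d∣n p∤n
... | Bézout.+- x y e = y , divides x (trans (cong suc (ℕₚ.*-comm n y)) e)
-- Here `y` is an inverse of `n` itself, and `p - 1` supplies the factor -1.
... | Bézout.-+ x y e = y * p-1 , divides (1 + x * p-1)
        (trans (cong suc (trans (ring₁ n y p-1) (cong (_* p-1) (sym e)))) (ring₂ x p-1))
  where
  ring₁ : ∀ n y p → n * (y * p) ≡ y * n * p
  ring₁ = solve-∀
  ring₂ : ∀ x p → 1 + (1 + x * suc p) * p ≡ (1 + x * p) * suc p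
  ring₂ = solve-∀
prime-inverse {zero} pp _ = contradiction (2≤prime pp) λ ()

-- Adding `N * j * (m + c p)`, where `N * j ≡ -1` modulo `p`, multiplies `m + c p` by `1 + N * j`,
-- and changes nothing modulo the primes in `N`.
chinese-remainder : ∀ (c : ℕ → ℕ) ps → All Prime ps → Unique ps → ∃[ m ] All (λ p → p ∣ m + c p) ps
chinese-remainder c [] _ _ = 0 , []
chinese-remainder c (p ∷ ps) (pp ∷ pps) (p≢ ∷ ups)
  with chinese-remainder c ps pps ups | prime-inverse pp (prime∤product pp pps p≢)
... | m , h | j , p∣ = m + N * j * u ,
      subst (p ∣_) (ring₁ m (c p) N j) (∣n⇒∣m*n u p∣) ∷
      All.zipWith (λ {q} (q∣ , q∣N) → subst (q ∣_) (ring₂ m (c q) (N * j * u)) (∣m∣n⇒∣m+n q∣ (∣m⇒∣m*n u (∣m⇒∣m*n j q∣N))))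
        (h , All.tabulate ∈⇒∣product)
  where
  N u : ℕ
  N = product ps
  u = m + c p
  ring₁ : ∀ m c N j → (m + c) * (1 + N * j) ≡ m + N * j * (m + c) + c
  ring₁ = solve-∀
  ring₂ : ∀ m c x → m + c + x ≡ m + x + c
  ring₂ = solve-∀

-- Squares modulo q and modulo Q

-- For an odd prime `q` this is `(q + 1) / 2`, the number of squares modulo `q`, zero included.
half : ℕ → ℕ
half q = suc (q / 2)

-- The distance from `z` to the nearest multiple of `q`: a representative of `±z`, hence sufficient
-- for `z²` modulo `q`.
fold : ∀ q → .{{NonZero q}} → ℕ → ℕ
fold q z = z % q ℕ.⊓ (q ∸ z % q)

fold<half : ∀ q .{{_ : NonZero q}} z → fold q z < half q
fold<half q z = s≤s (subst (_≤ q / 2) (m*n/n≡m (fold q z) 2) (/-monoˡ-≤ 2 (begin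
  fold q z * 2        ≡⟨ ℕₚ.*-comm (fold q z) 2 ⟩
  fold q z + (fold q z + 0)  ≡⟨ cong (fold q z +_) (ℕₚ.+-identityʳ (fold q z)) ⟩
  fold q z + fold q z ≤⟨ ℕₚ.+-mono-≤ (ℕₚ.m⊓n≤m e (q ∸ e)) (ℕₚ.m⊓n≤n e (q ∸ e)) ⟩
  e + (q ∸ e)         ≡⟨ ℕₚ.m+[n∸m]≡n (ℕₚ.<⇒≤ (m%n<n z q)) ⟩
  q                   ∎)))
  where
  open ℕₚ.≤-Reasoning
  e : ℕ
  e = z % q

infix 8 _²

_² : ℕ → ℤ.ℤ
z ² = ℤ.+ z ℤ.* ℤ.+ z

∣z²-fold² : ∀ q .{{_ : NonZero q}} z → ℤ.+ q ℤ∣.∣ z ² ℤ.- fold q z ²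
∣z²-fold² q z = subst (ℤ.+ q ℤ∣.∣_) (telescope (z ²) (e ²) (fold q z ²)) (ℤ∣.∣m∣n⇒∣m+n reduce reflect)
  where
  open ℤ-Solver.+-*-Solver
  e k : ℕ
  e = z % q
  k = z / q
  telescope : ∀ a b c → (a ℤ.- b) ℤ.+ (b ℤ.- c) ≡ a ℤ.- c
  telescope = solve 3 (λ a b c → (a :- b) :+ (b :- c) := a :- c) refl
  z≡ : ℤ.+ z ≡ ℤ.+ e ℤ.+ ℤ.+ k ℤ.* ℤ.+ q
  z≡ = trans (cong ℤ.+_ (m≡m%n+[m/n]*n z q)) (cong (ℤ._+_ (ℤ.+ e)) (ℤₚ.pos-* k q))
  reduce : ℤ.+ q ℤ∣.∣ z ² ℤ.- e ²
  reduce = ℤ∣.divides (ℤ.+ k ℤ.* (ℤ.+ z ℤ.+ ℤ.+ e)) (trans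
    (solve 2 (λ z e → z :* z :- e :* e := (z :- e) :* (z :+ e)) refl (ℤ.+ z) (ℤ.+ e))
    (trans (cong (λ w → (w ℤ.- ℤ.+ e) ℤ.* (ℤ.+ z ℤ.+ ℤ.+ e)) z≡)
      (solve 4 (λ z e k q → (e :+ k :* q :- e) :* (z :+ e) := k :* (z :+ e) :* q) refl (ℤ.+ z) (ℤ.+ e) (ℤ.+ k) (ℤ.+ q))))
  q-e : ℤ.+ (q ∸ e) ≡ ℤ.+ q ℤ.- ℤ.+ e
  q-e = trans (sym (ℤₚ.⊖-≥ (ℕₚ.<⇒≤ (m%n<n z q)))) (sym (ℤₚ.m-n≡m⊖n q e))
  reflect : ℤ.+ q ℤ∣.∣ e ² ℤ.- fold q z ²
  reflect with ℕₚ.⊓-sel e (q ∸ e)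
  ... | inj₁ s = subst (λ f → ℤ.+ q ℤ∣.∣ e ² ℤ.- f ²) (sym s) (ℤ∣.divides (ℤ.+ 0) (ℤₚ.+-inverseʳ (e ²)))
  ... | inj₂ s = subst (λ f → ℤ.+ q ℤ∣.∣ e ² ℤ.- f ²) (sym s) (ℤ∣.divides (ℤ.+ e ℤ.+ ℤ.+ e ℤ.- ℤ.+ q)
    (trans (cong (λ w → e ² ℤ.- w ℤ.* w) q-e)
      (solve 2 (λ e q → e :* e :- (q :- e) :* (q :- e) := (e :+ e :- q) :* q) refl (ℤ.+ e) (ℤ.+ q))))

encode : ∀ qs → All NonZero qs → ℕ → Fin (product (map half qs))
encode [] _ _ = Fin.zero
encode (q ∷ qs) (q≢0 ∷ qs≢0) z = combine (fromℕ< (fold<half q {{q≢0}} z)) (encode qs qs≢0 z)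

encode-squares : ∀ qs (nz : All NonZero qs) {z z′} → encode qs nz z ≡ encode qs nz z′ →
                 All (λ q → ℤ.+ q ℤ∣.∣ z ² ℤ.- z′ ²) qs
encode-squares [] _ _ = []
encode-squares (q ∷ qs) (q≢0 ∷ qs≢0) {z} {z′} e
  with e₁ , e₂ ← Finₚ.combine-injective (fromℕ< (fold<half q {{q≢0}} z)) (encode qs qs≢0 z) _ _ e =
  subst (ℤ.+ q ℤ∣.∣_) (telescope (z ²) (fold q z ²) (z′ ²))
    (ℤ∣.∣m∣n⇒∣m-n (∣z²-fold² q z) (subst (λ f → ℤ.+ q ℤ∣.∣ z′ ² ℤ.- f ²) (sym fold≡) (∣z²-fold² q z′))) ∷
  encode-squares qs qs≢0 e₂
  where
  open ℤ-Solver.+-*-Solver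
  instance
    nz : NonZero q
    nz = q≢0
  fold≡ : fold q z ≡ fold q z′
  fold≡ = Finₚ.fromℕ<-injective _ _ (fold<half q z) (fold<half q z′) e₁
  telescope : ∀ a b c → (a ℤ.- b) ℤ.- (c ℤ.- b) ≡ a ℤ.- c
  telescope = solve 3 (λ a b c → (a :- b) :- (c :- b) := a :- c) refl

-- The expansion of `(a - b)²` without subtraction. The sign of `k - η` is unknown, but only its
-- square matters.
∣-∣-square : ∀ a b → ∣ a - b ∣ * ∣ a - b ∣ + 2 * (a * b) ≡ a * a + b * b
∣-∣-square a b with ℕₚ.≤-total a b
... | inj₁ a≤b = subst₂ (λ d c → d * d + 2 * (a * c) ≡ a * a + c * c)
        (sym (ℕₚ.m≤n⇒∣m-n∣≡n∸m a≤b)) (ℕₚ.m+[n∸m]≡n a≤b) (ring₁ a (b ∸ a))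
  where
  ring₁ : ∀ a d → d * d + 2 * (a * (a + d)) ≡ a * a + (a + d) * (a + d)
  ring₁ = solve-∀
... | inj₂ b≤a = subst₂ (λ d c → d * d + 2 * (c * b) ≡ c * c + b * b)
        (sym (ℕₚ.m≤n⇒∣n-m∣≡n∸m b≤a)) (ℕₚ.m+[n∸m]≡n b≤a) (ring₁ b (a ∸ b))
  where
  ring₁ : ∀ b d → d * d + 2 * ((b + d) * b) ≡ (b + d) * (b + d) + b * b
  ring₁ = solve-∀

lookup-distinct : ∀ {A : Set} {xs : List A} → Unique xs → ∀ {i j} → i Data.Fin.< j → lookup xs i ≢ lookup xs j
lookup-distinct {xs = _ ∷ xs} (x≢ ∷ _) {Fin.zero} {Fin.suc j} _ = All.lookup x≢ (∈-lookup j)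
lookup-distinct {xs = _ ∷ xs} (_ ∷ u) {Fin.suc i} {Fin.suc j} (s≤s i<j) = lookup-distinct u i<j

-- Collisions among the multiples of the primes of a block

ForcesCollision : ℕ → ℕ → ℕ → Set
ForcesCollision a b H = ∃[ m ] ∀ (α : ℕ → ℕ) →
  (∀ p → PrimeIn a b p → p ∣ α p × m < α p × α p ≤ m + H) →
  ∃[ p ] ∃[ p′ ] (PrimeIn a b p × PrimeIn a b p′ × p ≢ p′ × α p ≡ α p′)

-- With p = P₀ + δ, 2η ≡ δ and c ≡ -η² (mod Q), the k-th point X = c + k p of the
-- class of c modulo p satisfies X - k P₀ = c + k δ ≡ k² - (k - η)² (mod Q). For fixed k
-- this takes at most (q + 1) / 2 values modulo each odd prime q dividing Q.
module Compression (qs : List ℕ) (qs-prime : All Prime qs) (qs-unique : Unique qs)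
  (G : ℕ) (Q-odd : product qs ≡ suc (2 * G)) (P₀ : ℕ) (Q≤P₀ : product qs ≤ P₀) where

  Q : ℕ
  Q = product qs

  private
    instance
      Q≢0 : NonZero Q
      Q≢0 = subst NonZero (sym Q-odd) _

    qs≢0 : All NonZero qs
    qs≢0 = All.map prime⇒nonZero qs-prime

  -- Modulo `Q = 2G + 1`, `suc G` is the inverse of 2 and `2 * G` is -1. Thus `η` is half of
  -- `p ∸ P₀`, and `c` is `-η²` reduced to a number below `Q`.
  η c : ℕ → ℕ
  η p = (p ∸ P₀) * suc G
  c p = (2 * G * (η p * η p)) % Q

  c<Q : ∀ p → c p < Q
  c<Q p = m%n<n (2 * G * (η p * η p)) Q

  y : ℕ → ℕ → ℕ
  y p k = c p + k * (p ∸ P₀)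

  Q∣y+[k-η]²-k² : ∀ p k → ℤ.+ Q ℤ∣.∣ ℤ.+ y p k ℤ.+ ∣ k - η p ∣ ² ℤ.- k ²
  Q∣y+[k-η]²-k² p k = ℤ∣.divides (ℤ.+ η p ℤ.* ℤ.+ η p ℤ.- ℤ.+ B ℤ.- ℤ.+ (k * δ)) (begin
    ℤ.+ y p k ℤ.+ z ² ℤ.- k ²                 ≡⟨ cong (λ w → ℤ.+ y p k ℤ.+ w ℤ.- k ²) (sym (ℤₚ.pos-* z z)) ⟩
    ℤ.+ (y p k + z * z) ℤ.- k ²               ≡⟨ add-sub (ℤ.+ (y p k + z * z)) (k ²) (ℤ.+ (k * δ * Q + B * Q)) ⟩
    ℤ.+ (y p k + z * z + (k * δ * Q + B * Q)) ℤ.- ℤ.+ (k * δ * Q + B * Q) ℤ.- k ²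
      ≡⟨ cong (λ w → ℤ.+ w ℤ.- ℤ.+ (k * δ * Q + B * Q) ℤ.- k ²) nat ⟩
    ℤ.+ (k * k + Q * (η p * η p)) ℤ.- ℤ.+ (k * δ * Q + B * Q) ℤ.- k ²
      ≡⟨ cong₂ (λ u v → u ℤ.- v ℤ.- k ²)
          (cong₂ ℤ._+_ (ℤₚ.pos-* k k) (trans (ℤₚ.pos-* Q (η p * η p)) (cong (ℤ.+ Q ℤ.*_) (ℤₚ.pos-* (η p) (η p)))))
          (cong₂ ℤ._+_ (ℤₚ.pos-* (k * δ) Q) (ℤₚ.pos-* B Q)) ⟩
    (k ² ℤ.+ ℤ.+ Q ℤ.* η p ²) ℤ.- (ℤ.+ (k * δ) ℤ.* ℤ.+ Q ℤ.+ ℤ.+ B ℤ.* ℤ.+ Q) ℤ.- k ²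
      ≡⟨ solve 5 (λ k² Q η² d b → (k² :+ Q :* η²) :- (d :* Q :+ b :* Q) :- k² := (η² :- b :- d) :* Q) refl
          (k ²) (ℤ.+ Q) (η p ²) (ℤ.+ (k * δ)) (ℤ.+ B) ⟩
    (η p ² ℤ.- ℤ.+ B ℤ.- ℤ.+ (k * δ)) ℤ.* ℤ.+ Q  ∎)
    where
    open ≡-Reasoning
    open ℤ-Solver.+-*-Solver
    δ z B : ℕ
    δ = p ∸ P₀
    z = ∣ k - η p ∣
    B = 2 * G * (η p * η p) / Q
    add-sub : ∀ a b s → a ℤ.- b ≡ a ℤ.+ s ℤ.- s ℤ.- b
    add-sub = solve 3 (λ a b s → a :- b := a :+ s :- s :- b) refl
    ring₁ : ∀ c k δ z² R S → c + k * δ + z² + (k * δ * R + S) ≡ (c + S) + (z² + k * (δ + δ * R))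
    ring₁ = solve-∀
    ring₂ : ∀ δ G → δ + δ * suc (2 * G) ≡ 2 * (δ * suc G)
    ring₂ = solve-∀
    ring₃ : ∀ η² z² k h → η² + (z² + k * (2 * h)) ≡ η² + (z² + 2 * (k * h))
    ring₃ = solve-∀
    ring₄ : ∀ G e k² → 2 * G * e + (k² + e) ≡ k² + suc (2 * G) * e
    ring₄ = solve-∀
    -- The added multiples of `Q` avoid subtraction: `B * Q` restores `c` to `2 * G * η²`, and
    -- `k * δ * Q` turns `k * δ` into `2 * k * η`.
    nat : y p k + z * z + (k * δ * Q + B * Q) ≡ k * k + Q * (η p * η p)
    nat = trans (ring₁ (c p) k δ (z * z) Q (B * Q))
      (trans (cong₂ (λ u v → u + (z * z + k * v)) (sym (m≡m%n+[m/n]*n (2 * G * (η p * η p)) Q))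
          (trans (cong (λ R → δ + δ * R) Q-odd) (ring₂ δ G)))
      (trans (ring₃ (2 * G * (η p * η p)) (z * z) k (η p))
      (trans (cong (2 * G * (η p * η p) +_) (∣-∣-square k (η p)))
      (trans (ring₄ G (η p * η p) (k * k)) (cong (λ R → k * k + R * (η p * η p)) (sym Q-odd))))))

  module _ (J : ℕ) where

    y/Q<J : ∀ p k → p < P₀ + Q → k < J → y p k / Q < J
    y/Q<J p k p< k<J = m<n*o⇒m/o<n (begin-strict
      c p + k * (p ∸ P₀)  <⟨ ℕₚ.+-mono-<-≤ (c<Q p) (ℕₚ.*-monoʳ-≤ k δ≤Q) ⟩
      Q + k * Q           ≤⟨ ℕₚ.*-monoˡ-≤ Q k<J ⟩
      J * Q               ∎)
      where
      open ℕₚ.≤-Reasoning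
      δ≤Q : p ∸ P₀ ≤ Q
      δ≤Q = ℕₚ.m≤n+o⇒m∸n≤o p P₀ (ℕₚ.<⇒≤ p<)

    -- The two factors `J` count `k` and the quotient of `y` by `Q`; the residue of `y` is left to
    -- the squares.
    code : ∀ p k → p < P₀ + Q → k < J → Fin (J * (J * product (map half qs)))
    code p k p< k<J = combine (fromℕ< k<J) (combine (fromℕ< (y/Q<J p k p< k<J)) (encode qs qs≢0 ∣ k - η p ∣))

    -- `p` itself is not recovered, nor should it be: `k` and `y` determine the point
    -- `X = y + k P₀`.
    code-injective : ∀ p k p< k<J p′ k′ p′< k′<J →
                     code p k p< k<J ≡ code p′ k′ p′< k′<J → k ≡ k′ × y p k ≡ y p′ k′
    code-injective p k p< k<J p′ k′ p′< k′<J e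
      with e₁ , e₂₃ ← Finₚ.combine-injective (fromℕ< k<J)
                        (combine (fromℕ< (y/Q<J p k p< k<J)) (encode qs qs≢0 ∣ k - η p ∣)) _ _ e
      with e₂ , e₃ ← Finₚ.combine-injective (fromℕ< (y/Q<J p k p< k<J)) (encode qs qs≢0 ∣ k - η p ∣) _ _ e₂₃
      with refl ← Finₚ.fromℕ<-injective _ _ k<J k′<J e₁ = refl , y≡
      where
      open ℤ-Solver.+-*-Solver
      Y Y′ : ℕ
      Y = y p k
      Y′ = y p′ k
      z z′ : ℕ
      z = ∣ k - η p ∣
      z′ = ∣ k - η p′ ∣
      Q∣squares : ℤ.+ Q ℤ∣.∣ z ² ℤ.- z′ ²
      Q∣squares = ℤ∣.∣ᵤ⇒∣ (product-∣ qs qs-prime qs-unique (All.map ℤ∣.∣⇒∣ᵤ (encode-squares qs qs≢0 {z} {z′} e₃)))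
      Q∣Y-Y′ : ℤ.+ Q ℤ∣.∣ ℤ.+ Y ℤ.- ℤ.+ Y′
      Q∣Y-Y′ = subst (ℤ.+ Q ℤ∣.∣_)
        (solve 5 (λ Y Y′ z z′ k → (Y :+ z :- k) :- (Y′ :+ z′ :- k) :- (z :- z′) := Y :- Y′) refl
          (ℤ.+ Y) (ℤ.+ Y′) (z ²) (z′ ²) (k ²))
        (ℤ∣.∣m∣n⇒∣m-n (ℤ∣.∣m∣n⇒∣m-n (Q∣y+[k-η]²-k² p k) (Q∣y+[k-η]²-k² p′ k)) Q∣squares)
      d : ℕ
      d = Y / Q
      d≡ : Y′ / Q ≡ d
      d≡ = sym (Finₚ.fromℕ<-injective _ _ (y/Q<J p k p< k<J) (y/Q<J p′ k p′< k′<J) e₂)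
      Y≡ : Y ≡ Y % Q + d * Q
      Y≡ = m≡m%n+[m/n]*n Y Q
      Y′≡ : Y′ ≡ Y′ % Q + d * Q
      Y′≡ = trans (m≡m%n+[m/n]*n Y′ Q) (cong (λ w → Y′ % Q + w * Q) d≡)
      remainders : Y % Q ≡ Y′ % Q
      remainders = ∣-residues-unique (m%n<n Y Q) (m%n<n Y′ Q) (subst (ℤ.+ Q ℤ∣.∣_)
        (trans (cong₂ (λ u v → ℤ.+ u ℤ.- ℤ.+ v) Y≡ Y′≡)
          (solve 3 (λ r r′ w → (r :+ w) :- (r′ :+ w) := r :- r′) refl (ℤ.+ (Y % Q)) (ℤ.+ (Y′ % Q)) (ℤ.+ (d * Q))))
        Q∣Y-Y′)
      y≡ : Y ≡ Y′
      y≡ = trans Y≡ (trans (cong (_+ d * Q) remainders) (sym Y′≡))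

  module _ {J H : ℕ} (H<JP₀ : H < J * P₀) (ps : List ℕ) (ps-unique : Unique ps)
    (ps-range : All (PrimeIn P₀ (P₀ + Q)) ps) (many : J * (J * product (map half qs)) < length ps) where

    private
      start : ∃[ m ] All (λ p → p ∣ m + c p) ps
      start = chinese-remainder c ps (All.map proj₁ ps-range) ps-unique

      m : ℕ
      m = proj₁ start

    module _ (α : ℕ → ℕ) (α-range : ∀ p → PrimeIn P₀ (P₀ + Q) p → p ∣ α p × m < α p × α p ≤ m + H) where

      private
        X : ℕ → ℕ
        X p = α p ∸ m

        P : Fin (length ps) → ℕ
        P = lookup ps

        range : ∀ i → PrimeIn P₀ (P₀ + Q) (P i)
        range i = All.lookup ps-range (∈-lookup i)

        P< : ∀ i → P i < P₀ + Q
        P< i = proj₂ (proj₂ (range i))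

        instance
          P≢0 : ∀ {i} → NonZero (P i)
          P≢0 {i} = prime⇒nonZero (proj₁ (range i))

        K : Fin (length ps) → ℕ
        K i = X (P i) / P i

        α≡m+X : ∀ i → α (P i) ≡ m + X (P i)
        α≡m+X i = sym (ℕₚ.m+[n∸m]≡n (ℕₚ.<⇒≤ (proj₁ (proj₂ (α-range (P i) (range i))))))

        K<J : ∀ i → K i < J
        K<J i = m<n*o⇒m/o<n (ℕₚ.≤-<-trans (ℕₚ.m≤n+o⇒m∸n≤o (α (P i)) m (proj₂ (proj₂ (α-range (P i) (range i)))))
          (ℕₚ.<-≤-trans H<JP₀ (ℕₚ.*-monoʳ-≤ J (proj₁ (proj₂ (range i))))))

        -- Adding either number to `m` gives a multiple of `p`, and both are below `p`, since
        -- `c p < Q ≤ P₀ ≤ p`.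
        X%p≡c : ∀ i → X (P i) % P i ≡ c (P i)
        X%p≡c i = ∣-residues-unique (m%n<n (X p) p) (ℕₚ.<-≤-trans (c<Q p) (ℕₚ.≤-trans Q≤P₀ (proj₁ (proj₂ (range i)))))
          (subst (ℤ.+ p ℤ∣.∣_)
            (solve 3 (λ m r c → (m :+ r) :- (m :+ c) := r :- c) refl (ℤ.+ m) (ℤ.+ (X p % p)) (ℤ.+ c p))
            (ℤ∣.∣m∣n⇒∣m-n (ℤ∣.∣ᵤ⇒∣ {i = ℤ.+ (m + X p % p)} p∣m+r)
                          (ℤ∣.∣ᵤ⇒∣ {i = ℤ.+ (m + c p)} (All.lookup (proj₂ start) (∈-lookup i)))))
          where
          open ℤ-Solver.+-*-Solver
          p : ℕ
          p = P i
          p∣m+r : p ∣ m + X p % p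
          p∣m+r = ∣m+n∣m⇒∣n {m = X p / p * p} (subst (p ∣_)
            (trans (α≡m+X i) (trans (cong (m +_) (m≡m%n+[m/n]*n (X p) p)) (ring₁ m (X p % p) (X p / p * p))))
            (proj₁ (α-range p (range i)))) (n∣m*n (X p / p))
            where
            ring₁ : ∀ m r k → m + (r + k) ≡ k + (m + r)
            ring₁ = solve-∀

        X≡ : ∀ i → X (P i) ≡ y (P i) (K i) + K i * P₀
        X≡ i = begin
          X p                                     ≡⟨ m≡m%n+[m/n]*n (X p) p ⟩
          X p % p + K i * p                       ≡⟨ cong₂ (λ u v → u + K i * v) (X%p≡c i)
                                                       (sym (ℕₚ.m∸n+n≡m (proj₁ (proj₂ (range i))))) ⟩
          c p + K i * (p ∸ P₀ + P₀)               ≡⟨ ring₁ (c p) (K i) (p ∸ P₀) P₀ ⟩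
          c p + K i * (p ∸ P₀) + K i * P₀         ∎
          where
          open ≡-Reasoning
          p : ℕ
          p = P i
          ring₁ : ∀ c k d P → c + k * (d + P) ≡ c + k * d + k * P
          ring₁ = solve-∀

      collision : ∃[ p ] ∃[ p′ ] (PrimeIn P₀ (P₀ + Q) p × PrimeIn P₀ (P₀ + Q) p′ × p ≢ p′ × α p ≡ α p′)
      collision
        with i , j , i<j , e ← Finₚ.pigeonhole many (λ i → code J (P i) (K i) (P< i) (K<J i))
        with K≡ , y≡ ← code-injective J (P i) (K i) (P< i) (K<J i) (P j) (K j) (P< j) (K<J j) e =
        P i , P j , range i , range j , lookup-distinct ps-unique i<j , (begin
          α (P i)      ≡⟨ α≡m+X i ⟩
          m + X (P i)  ≡⟨ cong (m +_) (trans (X≡ i) (trans (cong₂ (λ u v → u + v * P₀) y≡ K≡) (sym (X≡ j)))) ⟩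
          m + X (P j)  ≡⟨ sym (α≡m+X j) ⟩
          α (P j)      ∎)
        where open ≡-Reasoning

    forced-collision : ForcesCollision P₀ (P₀ + Q) H
    forced-collision = m , collision

-- Choice of the parameters

odd-prime : ∀ {q} → Prime q → 3 ≤ q → q ≡ suc (2 * (q / 2))
odd-prime {q} pq 3≤q = from (q % 2) (m%n<n q 2) (m≡m%n+[m/n]*n q 2)
  where
  from : ∀ r → r < 2 → q ≡ r + q / 2 * 2 → q ≡ suc (2 * (q / 2))
  from 1 _ e = trans e (cong suc (ℕₚ.*-comm (q / 2) 2))
  from (suc (suc _)) (s≤s (s≤s ())) _
  from 0 _ e with prime⇒irreducible pq (divides (q / 2) e)
  ... | inj₁ ()
  ... | inj₂ refl = contradiction 3≤q λ { (s≤s (s≤s ())) }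

odd-product : ∀ qs → All (λ q → q ≡ suc (2 * (q / 2))) qs → ∃[ G ] product qs ≡ suc (2 * G)
odd-product [] _ = 0 , refl
odd-product (q ∷ qs) (e ∷ es) with odd-product qs es
... | G , e′ = g + G + 2 * (g * G) , trans (cong₂ _*_ e e′) (ring₁ g G)
  where
  g : ℕ
  g = q / 2
  ring₁ : ∀ g G → suc (2 * g) * suc (2 * G) ≡ suc (2 * (g + G + 2 * (g * G)))
  ring₁ = solve-∀

-- ∏ (1 + 1/q) telescopes over all integers of [3, 3 + k).
product-half≤ : ∀ k → product (map half (primesFrom 3 k)) * 2 ^ π 3 k * 3 ≤ product (primesFrom 3 k) * (3 + k)
product-half≤ zero = ℕₚ.≤-refl
product-half≤ (suc k) with prime? (3 + k)
... | no _ = ℕₚ.≤-trans (product-half≤ k) (ℕₚ.*-monoʳ-≤ (product (primesFrom 3 k)) (ℕₚ.n≤1+n (3 + k)))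
... | yes pq = begin
  half q * B * (2 * 2 ^ r) * 3    ≡⟨ ring₁ (q / 2) B (2 ^ r) ⟩
  suc (suc (2 * (q / 2))) * (B * 2 ^ r * 3)  ≡⟨ cong (λ z → suc z * (B * 2 ^ r * 3)) (sym (odd-prime pq (ℕₚ.m≤m+n 3 k))) ⟩
  suc q * (B * 2 ^ r * 3)         ≤⟨ ℕₚ.*-monoʳ-≤ (suc q) (product-half≤ k) ⟩
  suc q * (Q * q)                 ≡⟨ ring₂ q Q ⟩
  q * Q * suc q                   ∎
  where
  open ℕₚ.≤-Reasoning
  q r B Q : ℕ
  q = 3 + k
  r = π 3 k
  B = product (map half (primesFrom 3 k))
  Q = product (primesFrom 3 k)
  ring₁ : ∀ g B R → suc g * B * (2 * R) * 3 ≡ suc (suc (2 * g)) * (B * R * 3)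
  ring₁ = solve-∀
  ring₂ : ∀ q Q → suc q * (Q * q) ≡ q * Q * suc q
  ring₂ = solve-∀

product≤^ : ∀ {b qs} → All (_≤ b) qs → product qs ≤ b ^ length qs
product≤^ [] = ℕₚ.≤-refl
product≤^ (q≤b ∷ qs≤b) = ℕₚ.*-mono-≤ q≤b (product≤^ qs≤b)

dense-block : ∀ Q M a k → (∃[ i ] (i < k × M < π (a + i * Q) Q)) ⊎ π a (k * Q) ≤ k * M
dense-block Q M a zero = inj₂ z≤n
dense-block Q M a (suc k) with dense-block Q M a k
... | inj₁ (i , i<k , h) = inj₁ (i , ℕₚ.m≤n⇒m≤1+n i<k , h)
... | inj₂ le with suc M ≤? π (a + k * Q) Q
...   | yes h  = inj₁ (k , ℕₚ.n<1+n k , h)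
...   | no ¬h = inj₂ (begin
  π a (Q + k * Q)                  ≡⟨ cong (π a) (ℕₚ.+-comm Q (k * Q)) ⟩
  π a (k * Q + Q)                  ≡⟨ π-+ a (k * Q) Q ⟩
  π a (k * Q) + π (a + k * Q) Q    ≤⟨ ℕₚ.+-mono-≤ le (ℕ.s≤s⁻¹ (ℕₚ.≰⇒> ¬h)) ⟩
  k * M + M                        ≡⟨ ℕₚ.+-comm (k * M) M ⟩
  M + k * M                        ∎)
  where open ℕₚ.≤-Reasoning

-- `ℓ` is `log₂ n` rounded down and `2 ^ (1 + t)` exceeds it. The `r` primes `q` are at most
-- `2 ^ (3 + t)`, so `Q ≤ 2 ^ u`, where `2 ^ u` is smaller than `n` by a factor of about `log n`. By
-- `s-small`, `2 ^ r` beats `4 ^ s` and a power of `log n`.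
module Parameters {n ℓ t u r s : ℕ} (2^ℓ≤n : 2 ^ ℓ ≤ n) (n<2^[1+ℓ] : n < 2 ^ suc ℓ)
  (ℓ≡ : ℓ ≡ suc (t + 4 + u)) (ℓ<2^[1+t] : ℓ < 2 ^ suc t) (t-large : 2 * (3 + t) ≤ 2 ^ suc t)
  ([3+t]r≤u : (3 + t) * r ≤ u) (s-small : 2 * s + 4 * t + 19 ≤ r) where

  private
    v j₀ : ℕ
    v = 3 + t
    -- With this length `primesFrom 3 j₀` covers the odd primes up to `2 ^ v` inclusive.
    j₀ = 2 ^ v ∸ 2

    3+j₀ : 3 + j₀ ≡ suc (2 ^ v)
    3+j₀ = cong suc (ℕₚ.m+[n∸m]≡n (ℕₚ.^-monoʳ-≤ 2 (s≤s (z≤n {2 + t}))))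

    r≤π : r ≤ π 3 j₀
    r≤π = ℕₚ.≮⇒≥ λ lt → ℕₚ.<⇒≱ (small lt) (subst (λ z → 2 ^ (2 + t) ≤ v * π 0 z) (sym 3+j₀) (chebyshev (2 + t)))
      where
      open ℕₚ.≤-Reasoning
      small : π 3 j₀ < r → v * π 0 (3 + j₀) < 2 ^ (2 + t)
      small lt = begin-strict
        v * π 0 (3 + j₀)     ≡⟨ cong (v *_) (π-+ 0 3 j₀) ⟩
        -- `π 0 3` is 1, for the prime 2, which the list `qs` must avoid.
        v * suc (π 3 j₀)     ≤⟨ ℕₚ.*-monoʳ-≤ v lt ⟩
        v * r                ≤⟨ [3+t]r≤u ⟩
        u                    ≤⟨ ℕₚ.m≤n+m u (suc (t + 4)) ⟩
        suc (t + 4 + u)      ≡⟨ sym ℓ≡ ⟩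
        ℓ                    <⟨ ℓ<2^[1+t] ⟩
        2 ^ suc t            ≤⟨ ℕₚ.^-monoʳ-≤ 2 (ℕₚ.n≤1+n (suc t)) ⟩
        2 ^ (2 + t)          ∎

    chosen : ∃[ j ] (j ≤ j₀ × π 3 j ≡ r)
    chosen = π-intermediate 3 j₀ r r≤π

    j : ℕ
    j = proj₁ chosen

    qs : List ℕ
    qs = primesFrom 3 j

    3+j≤ : 3 + j ≤ suc (2 ^ v)
    3+j≤ = subst (3 + j ≤_) 3+j₀ (ℕₚ.+-monoʳ-≤ 3 (proj₁ (proj₂ chosen)))

    Q B a J M N k : ℕ
    Q = product qs
    B = product (map half qs)
    -- Blocks start at `a` so that `Q ≤ P₀`. The exponent of `J` is chosen so that
    -- `J * a = 2 ^ (ℓ + 1 + s)`, which exceeds `n * 2 ^ s`.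
    a = 2 ^ u
    J = 2 ^ (s + t + 6)
    M = J * (J * B)
    N = 2 ^ ℓ

    qs-prime : All Prime qs
    qs-prime = All.map proj₁ (primesFrom-all 3 j)

    odd : ∃[ G ] Q ≡ suc (2 * G)
    odd = odd-product qs (All.map (λ (pq , 3≤q , _) → odd-prime pq 3≤q) (primesFrom-all 3 j))

    instance
      Q≢0 : NonZero Q
      Q≢0 = subst NonZero (sym (proj₂ odd)) _

    k = (suc N ∸ a) / Q

    Q≤a : Q ≤ a
    Q≤a = begin
      Q               ≤⟨ product≤^ (All.map (λ (_ , _ , q<) → ℕ.s≤s⁻¹ (ℕₚ.<-≤-trans q< 3+j≤)) (primesFrom-all 3 j)) ⟩
      (2 ^ v) ^ π 3 j ≡⟨ cong ((2 ^ v) ^_) (proj₂ (proj₂ chosen)) ⟩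
      (2 ^ v) ^ r     ≡⟨ ℕₚ.^-*-assoc 2 v r ⟩
      2 ^ (v * r)     ≤⟨ ℕₚ.^-monoʳ-≤ 2 [3+t]r≤u ⟩
      2 ^ u           ∎
      where open ℕₚ.≤-Reasoning

    B*2^r≤ : B * 2 ^ r ≤ Q * 2 ^ v
    B*2^r≤ = ℕₚ.*-cancelʳ-≤ (B * 2 ^ r) (Q * 2 ^ v) 3 (begin
      B * 2 ^ r * 3      ≡⟨ cong (λ z → B * 2 ^ z * 3) (sym (proj₂ (proj₂ chosen))) ⟩
      B * 2 ^ π 3 j * 3  ≤⟨ product-half≤ j ⟩
      Q * (3 + j)        ≤⟨ ℕₚ.*-monoʳ-≤ Q (ℕₚ.≤-trans 3+j≤ (ℕₚ.≤-trans (ℕₚ.+-monoˡ-≤ (2 ^ v) (ℕₚ.m^n>0 2 v)) (ring₁ (2 ^ v)))) ⟩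
      Q * (2 ^ v * 3)    ≡⟨ sym (ℕₚ.*-assoc Q (2 ^ v) 3) ⟩
      Q * 2 ^ v * 3      ∎)
      where
      open ℕₚ.≤-Reasoning
      ring₁ : ∀ x → x + x ≤ x * 3
      ring₁ x = subst (x + x ≤_) (eq x) (ℕₚ.m≤m+n (x + x) x)
        where
        eq : ∀ x → x + x + x ≡ x * 3
        eq = solve-∀

    a≤N : a ≤ suc N
    a≤N = ℕₚ.m≤n⇒m≤1+n (ℕₚ.^-monoʳ-≤ 2 (subst (u ≤_) (sym ℓ≡) (ℕₚ.m≤n+m u (suc (t + 4)))))

    a+kQ≤ : a + k * Q ≤ suc N
    a+kQ≤ = subst (a + k * Q ≤_) (ℕₚ.m+[n∸m]≡n a≤N) (ℕₚ.+-monoʳ-≤ a (m/n*n≤m (suc N ∸ a) Q))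

    kQ≤N : k * Q ≤ N
    kQ≤N = ℕ.s≤s⁻¹ (ℕₚ.≤-trans (ℕₚ.+-monoˡ-≤ (k * Q) (ℕₚ.m^n>0 2 u)) a+kQ≤)

    -- One `a` bounds the primes below `a`, the other those in the incomplete last block, whose
    -- length is less than `Q`.
    π-upper : π a (k * Q) ≤ k * M → π 0 (suc N) ≤ a + a + k * M
    π-upper h = begin
      π 0 (suc N)                                   ≡⟨ cong (π 0) split ⟩
      π 0 (a + (k * Q + ρ))                         ≡⟨ trans (π-+ 0 a (k * Q + ρ)) (cong (π 0 a +_) (π-+ a (k * Q) ρ)) ⟩
      π 0 a + (π a (k * Q) + π (a + k * Q) ρ)       ≤⟨ ℕₚ.+-mono-≤ (π≤ 0 a) (ℕₚ.+-mono-≤ h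
                                                         (ℕₚ.≤-trans (π≤ (a + k * Q) ρ)
                                                           (ℕₚ.≤-trans (ℕₚ.<⇒≤ (m%n<n (suc N ∸ a) Q)) Q≤a))) ⟩
      a + (k * M + a)                               ≡⟨ ring₁ a (k * M) ⟩
      a + a + k * M                                 ∎
      where
      open ℕₚ.≤-Reasoning
      ρ : ℕ
      ρ = (suc N ∸ a) % Q
      split : suc N ≡ a + (k * Q + ρ)
      split = trans (sym (ℕₚ.m+[n∸m]≡n a≤N)) (cong (a +_) (trans (m≡m%n+[m/n]*n (suc N ∸ a) Q) (ℕₚ.+-comm ρ (k * Q))))
      ring₁ : ∀ a c → a + (c + a) ≡ a + a + c
      ring₁ = solve-∀

    -- A quarter of the `2 ^ (t + 4 + u)` in Chebyshev's bound. Each of the two terms of `π-upper`,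
    -- times `2 ^ (1 + t)`, is at most `E`.
    E : ℕ
    E = 2 ^ (t + 2 + u)

    -- `k M = J² k B` with `B ≤ Q 2 ^ v / 2 ^ r` and `k Q ≤ N`. Comparing exponents leaves exactly
    -- `s-small`, whose `2 * s` comes from `J²`.
    kM-small : 2 ^ suc t * (k * M) ≤ E
    kM-small = ℕₚ.*-cancelʳ-≤ _ E (2 ^ r) {{ℕₚ.m^n≢0 2 r}} (begin
      T * (k * M) * 2 ^ r                   ≡⟨ ring₁ T k J B (2 ^ r) ⟩
      T * (J * J) * (k * (B * 2 ^ r))       ≤⟨ ℕₚ.*-monoʳ-≤ (T * (J * J)) (ℕₚ.*-monoʳ-≤ k B*2^r≤) ⟩
      T * (J * J) * (k * (Q * 2 ^ v))       ≡⟨ ring₂ (T * (J * J)) k Q (2 ^ v) ⟩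
      T * (J * J) * (2 ^ v * (k * Q))       ≤⟨ ℕₚ.*-monoʳ-≤ (T * (J * J)) (ℕₚ.*-monoʳ-≤ (2 ^ v) kQ≤N) ⟩
      T * (J * J) * (2 ^ v * N)             ≡⟨ cong₂ _*_ (cong (T *_) (sym (ℕₚ.^-distribˡ-+-* 2 e e))) (sym (ℕₚ.^-distribˡ-+-* 2 v ℓ)) ⟩
      T * 2 ^ (e + e) * 2 ^ (v + ℓ)         ≡⟨ cong (_* 2 ^ (v + ℓ)) (sym (ℕₚ.^-distribˡ-+-* 2 (suc t) (e + e))) ⟩
      2 ^ (suc t + (e + e)) * 2 ^ (v + ℓ)   ≡⟨ sym (ℕₚ.^-distribˡ-+-* 2 (suc t + (e + e)) (v + ℓ)) ⟩
      2 ^ (suc t + (e + e) + (v + ℓ))       ≡⟨ cong (λ z → 2 ^ (suc t + (e + e) + (v + z))) ℓ≡ ⟩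
      2 ^ (suc t + (e + e) + (v + suc (t + 4 + u)))  ≡⟨ cong (2 ^_) (ring₃ s t u) ⟩
      2 ^ (t + 2 + u + (2 * s + 4 * t + 19)) ≤⟨ ℕₚ.^-monoʳ-≤ 2 (ℕₚ.+-monoʳ-≤ (t + 2 + u) s-small) ⟩
      2 ^ (t + 2 + u + r)                   ≡⟨ ℕₚ.^-distribˡ-+-* 2 (t + 2 + u) r ⟩
      E * 2 ^ r                             ∎)
      where
      open ℕₚ.≤-Reasoning
      T e : ℕ
      T = 2 ^ suc t
      e = s + t + 6
      ring₁ : ∀ T k J B R → T * (k * (J * (J * B))) * R ≡ T * (J * J) * (k * (B * R))
      ring₁ = solve-∀
      ring₂ : ∀ x k Q V → x * (k * (Q * V)) ≡ x * (V * (k * Q))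
      ring₂ = solve-∀
      ring₃ : ∀ s t u → suc t + (s + t + 6 + (s + t + 6)) + (3 + t + suc (t + 4 + u)) ≡ t + 2 + u + (2 * s + 4 * t + 19)
      ring₃ = solve-∀

    -- Otherwise [0, 2^ℓ] would contain at most 2a + kM primes, where by kM-small
    -- the second term is a small proportion of the number given by Chebyshev's bound.
    block : ∃[ i ] (i < k × M < π (a + i * Q) Q)
    block = [ (λ b → b) , impossible ]′ (dense-block Q M a k)
      where
      open ℕₚ.≤-Reasoning
      ring₁ : ∀ T a c → T * (a + a + c) ≡ 2 * (T * a) + T * c
      ring₁ = solve-∀
      ring₂ : ∀ t u → suc (suc (t + 2 + u)) ≡ t + 4 + u
      ring₂ = solve-∀
      ring₃ : ∀ t u → suc (suc t + u) ≡ t + 2 + u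
      ring₃ = solve-∀
      2Ta : 2 * (2 ^ suc t * a) ≡ E
      2Ta = trans (cong (2 *_) (sym (ℕₚ.^-distribˡ-+-* 2 (suc t) u))) (cong (2 ^_) (ring₃ t u))
      impossible : π a (k * Q) ≤ k * M → ∃[ i ] (i < k × M < π (a + i * Q) Q)
      impossible le = contradiction (chebyshev (t + 4 + u)) (ℕₚ.<⇒≱ (begin-strict
        suc (t + 4 + u) * π 0 (suc (2 ^ suc (t + 4 + u)))  ≡⟨ cong (λ z → z * π 0 (suc (2 ^ z))) (sym ℓ≡) ⟩
        ℓ * π 0 (suc N)                 ≤⟨ ℕₚ.*-mono-≤ (ℕₚ.<⇒≤ ℓ<2^[1+t]) (π-upper le) ⟩
        2 ^ suc t * (a + a + k * M)     ≡⟨ ring₁ (2 ^ suc t) a (k * M) ⟩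
        2 * (2 ^ suc t * a) + 2 ^ suc t * (k * M)  ≤⟨ ℕₚ.+-mono-≤ (ℕₚ.≤-reflexive 2Ta) kM-small ⟩
        E + E                           ≡⟨ cong (E +_) (sym (ℕₚ.+-identityʳ E)) ⟩
        2 ^ suc (t + 2 + u)             <⟨ ℕₚ.^-monoʳ-< 2 (s≤s (s≤s z≤n)) (ℕₚ.≤-reflexive (ring₂ t u)) ⟩
        2 ^ (t + 4 + u)                 ∎))

    module _ (i : ℕ) (i<k : i < k) (many : M < π (a + i * Q) Q) where

      P₀ H : ℕ
      P₀ = a + i * Q
      H = n * 2 ^ s

      P₀+Q≤ : P₀ + Q ≤ suc N
      P₀+Q≤ = ℕₚ.≤-trans (ℕₚ.≤-reflexive (trans (ℕₚ.+-assoc a _ Q) (cong (a +_) (ℕₚ.+-comm _ Q))))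
        (ℕₚ.≤-trans (ℕₚ.+-monoʳ-≤ a (ℕₚ.*-monoˡ-≤ Q i<k)) a+kQ≤)

      H<JP₀ : H < J * P₀
      H<JP₀ = begin-strict
        n * 2 ^ s                       <⟨ ℕₚ.*-monoˡ-< (2 ^ s) {{ℕₚ.m^n≢0 2 s}} n<2^[1+ℓ] ⟩
        2 ^ suc ℓ * 2 ^ s               ≡⟨ sym (ℕₚ.^-distribˡ-+-* 2 (suc ℓ) s) ⟩
        2 ^ (suc ℓ + s)                 ≡⟨ cong (λ z → 2 ^ (suc z + s)) ℓ≡ ⟩
        2 ^ (suc (suc (t + 4 + u)) + s) ≡⟨ cong (2 ^_) (ring₁ s t u) ⟩
        2 ^ (s + t + 6 + u)             ≡⟨ ℕₚ.^-distribˡ-+-* 2 (s + t + 6) u ⟩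
        J * a                           ≤⟨ ℕₚ.*-monoʳ-≤ J (ℕₚ.m≤m+n a _) ⟩
        J * P₀                          ∎
        where
        open ℕₚ.≤-Reasoning
        ring₁ : ∀ s t u → suc (suc (t + 4 + u)) + s ≡ s + t + 6 + u
        ring₁ = solve-∀

      module K = Compression qs qs-prime (primesFrom-unique 3 j) (proj₁ odd) (proj₂ odd) P₀ (ℕₚ.≤-trans Q≤a (ℕₚ.m≤m+n a _))

      upTo : ∀ {p} → PrimeIn P₀ (P₀ + Q) p → PrimeUpTo n p
      upTo (pp , _ , p<) = pp , ℕₚ.≤-trans (ℕ.s≤s⁻¹ (ℕₚ.<-≤-trans p< P₀+Q≤)) 2^ℓ≤n

      n*2^s≤hℙ-of-block : n * 2 ^ s ≤ hℙ n
      n*2^s≤hℙ-of-block = ℕₚ.≮⇒≥ λ h<H → contradict (hℙ n) h<H forced (proj₂ (proj₁ (hℙ-isLeast n)))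
        where
        forced : ForcesCollision P₀ (P₀ + Q) H
        forced = K.forced-collision {J} {H} H<JP₀ (primesFrom P₀ Q) (primesFrom-unique P₀ Q) (primesFrom-all P₀ Q) many
        nonneg : ∀ {m a h} → I (ℤ.+ m) h a → a ≡ ℤ.+ ℤ.∣ a ∣ × m < ℤ.∣ a ∣ × ℤ.∣ a ∣ ≤ m + h
        nonneg {a = ℤ.+ _} (l , u) = refl , ℤₚ.drop‿+<+ l , ℤₚ.drop‿+≤+ u
        nonneg {a = ℤ.-[1+ _ ]} (() , _)
        contradict : ∀ h → h < H → ForcesCollision P₀ (P₀ + Q) H → ¬ (∀ m → HasDistinctMultiples (PrimeUpTo n) m h)
        contradict h h<H (m , collide) multiples =
          let (b , good , distinct) = multiples (ℤ.+ m)
              (p , p′ , pr , pr′ , p≢p′ , α≡) = collide (λ p → ℤ.∣ b p ∣) (λ p pr →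
                 let (inI , p∣b) = good p (upTo pr)
                     (_ , m< , ≤m+h) = nonneg inI
                 in ℤ∣.∣⇒∣ᵤ p∣b , m< , ℕₚ.≤-trans ≤m+h (ℕₚ.+-monoʳ-≤ m (ℕₚ.<⇒≤ h<H)))
          in distinct p p′ (upTo pr) (upTo pr′) p≢p′
            (trans (proj₁ (nonneg (proj₁ (good p (upTo pr)))))
              (trans (cong ℤ.+_ α≡) (sym (proj₁ (nonneg (proj₁ (good p′ (upTo pr′))))))))

  n*2^s≤hℙ : n * 2 ^ s ≤ hℙ n
  n*2^s≤hℙ = let (i , i<k , many) = block in n*2^s≤hℙ-of-block i i<k many

-- The size of s for large n

-- This is `(3 + t)³ ≤ 2 ^ t` for `t = 12 + d`. It fails at `t = 11`, whence the 12 in the threshold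
-- of `growth`.
cube≤2^ : ∀ d → (15 + d) ^ 3 ≤ 2 ^ (12 + d)
cube≤2^ zero = ℕₚ.≤ᵇ⇒≤ (15 ^ 3) (2 ^ 12) _
cube≤2^ (suc d) = begin
  (15 + suc d) ^ 3                   ≤⟨ ℕₚ.m≤m+n ((15 + suc d) ^ 3) _ ⟩
  (15 + suc d) ^ 3 + (2654 + 582 * d + 42 * d * d + d * d * d)  ≡⟨ ring₁ d ⟩
  2 * (15 + d) ^ 3                   ≤⟨ ℕₚ.*-monoʳ-≤ 2 (cube≤2^ d) ⟩
  2 * 2 ^ (12 + d)                   ≡⟨ cong (2 ^_) (sym (ℕₚ.+-suc 12 d)) ⟩
  2 ^ (12 + suc d)                   ∎
  where
  open ℕₚ.≤-Reasoning
  ring₁ : ∀ d → (15 + suc d) * ((15 + suc d) * ((15 + suc d) * 1)) + (2654 + 582 * d + 42 * d * d + d * d * d)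
              ≡ 2 * ((15 + d) * ((15 + d) * ((15 + d) * 1)))
  ring₁ = solve-∀

-- `s-large` is the division-free form of `2 s τ ≥ (1 - 2 / M) (1 + ℓ)`, that is, `s` is nearly half
-- of `ℓ / log₂ ℓ`.
record Growth (M n : ℕ) : Set where
  field
    ℓ τ s      : ℕ
    2^ℓ≤n      : 2 ^ ℓ ≤ n
    n<2^[1+ℓ]  : n < 2 ^ suc ℓ
    2^[1+τ]≤ℓ  : 2 ^ suc τ ≤ ℓ
    1≤τ        : 1 ≤ τ
    s-large    : M * suc ℓ ≤ 2 * suc ℓ + M * (2 * s * τ)
    n*2^s≤hℙ   : n * 2 ^ s ≤ hℙ n

growth : ∀ M n → 2 ^ 2 ^ (12 + 4 * M) ≤ n → Growth M n
growth M n n-large = record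
  { ℓ = ℓ ; τ = τ ; s = s ; 2^ℓ≤n = 2^ℓ≤n ; n<2^[1+ℓ] = n<b^[1+⌊log⌋] n 2≤2
  ; 2^[1+τ]≤ℓ = subst (λ z → 2 ^ z ≤ ℓ) t≡ 2^t≤ℓ ; 1≤τ = s≤s z≤n ; s-large = s-large
  ; n*2^s≤hℙ = Parameters.n*2^s≤hℙ {n} {ℓ} {t} {u} {r} {s} 2^ℓ≤n (n<b^[1+⌊log⌋] n 2≤2) ℓ≡
      (n<b^[1+⌊log⌋] ℓ 2≤2) t-large [3+t]r≤u s-small }
  where
  open ℕₚ.≤-Reasoning
  2≤2 : 2 ≤ 2
  2≤2 = ℕₚ.≤-refl
  ℓ t d u r s τ : ℕ
  ℓ = ⌊log⌋ 2 n
  t = ⌊log⌋ 2 ℓ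
  d = t ∸ 12
  -- `τ = t - 1`: the lost unit gives `4 ^ (2 ^ τ) ≤ n`, from which `2 ^ τ < log n` follows.
  τ = 11 + d
  u = ℓ ∸ suc (t + 4)
  r = u / (3 + t)
  s = (r ∸ (4 * t + 19)) / 2
  T≤t : 12 + 4 * M ≤ t
  T≤t = b^e≤n⇒e≤⌊log⌋ 2≤2 (b^e≤n⇒e≤⌊log⌋ 2≤2 n-large)
  t≡ : t ≡ 12 + d
  t≡ = sym (ℕₚ.m+[n∸m]≡n (ℕₚ.≤-trans (ℕₚ.m≤m+n 12 (4 * M)) T≤t))
  4M≤t : 4 * M ≤ t
  4M≤t = ℕₚ.≤-trans (ℕₚ.m≤n+m (4 * M) 12) T≤t
  2^ℓ≤n : 2 ^ ℓ ≤ n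
  2^ℓ≤n = b^⌊log⌋≤n 2 (ℕₚ.≤-trans (ℕₚ.m^n>0 2 (2 ^ (12 + 4 * M))) n-large)
  2^t≤ℓ : 2 ^ t ≤ ℓ
  2^t≤ℓ = b^⌊log⌋≤n 2 (ℕₚ.≤-trans (ℕₚ.m^n>0 2 (12 + 4 * M)) (b^e≤n⇒e≤⌊log⌋ 2≤2 n-large))
  cube≤2^t : (3 + t) ^ 3 ≤ 2 ^ t
  cube≤2^t = subst (λ z → (3 + z) ^ 3 ≤ 2 ^ z) (sym t≡) (cube≤2^ d)
  cube≤ℓ : (3 + t) ^ 3 ≤ ℓ
  cube≤ℓ = ℕₚ.≤-trans cube≤2^t 2^t≤ℓ
  quadratic≤cube : (3 + t) * (4 * t + 19) + suc (t + 4) ≤ (3 + t) ^ 3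
  quadratic≤cube = subst (λ z → (3 + z) * (4 * z + 19) + suc (z + 4) ≤ (3 + z) ^ 3) (sym t≡)
    (ℕₚ.≤-trans (ℕₚ.m≤m+n _ (2353 + 547 * d + 41 * d * d + d * d * d)) (ℕₚ.≤-reflexive (ring₁ d)))
    where
    ring₁ : ∀ d → (3 + (12 + d)) * (4 * (12 + d) + 19) + suc ((12 + d) + 4) + (2353 + 547 * d + 41 * d * d + d * d * d)
                ≡ (3 + (12 + d)) * ((3 + (12 + d)) * ((3 + (12 + d)) * 1))
    ring₁ = solve-∀
  ℓ≡ : ℓ ≡ suc (t + 4 + u)
  ℓ≡ = sym (ℕₚ.m+[n∸m]≡n (ℕₚ.≤-trans (ℕₚ.≤-trans (ℕₚ.m≤n+m (suc (t + 4)) _) quadratic≤cube) cube≤ℓ))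
  t-large : 2 * (3 + t) ≤ 2 ^ suc t
  t-large = ℕₚ.*-monoʳ-≤ 2 (ℕₚ.≤-trans (ℕₚ.m≤m*n (3 + t) ((3 + t) ^ 2) {{ℕₚ.m^n≢0 (3 + t) 2}}) cube≤2^t)
  [3+t]r≤u : (3 + t) * r ≤ u
  [3+t]r≤u = subst (_≤ u) (ℕₚ.*-comm r (3 + t)) (m/n*n≤m u (3 + t))
  c≤r : 4 * t + 19 ≤ r
  c≤r = subst (_≤ r) (m*n/n≡m (4 * t + 19) (3 + t)) (/-monoˡ-≤ (3 + t)
    (subst (_≤ u) (ℕₚ.*-comm (3 + t) (4 * t + 19)) (ℕₚ.m+n≤o⇒m≤o∸n _ (ℕₚ.≤-trans quadratic≤cube cube≤ℓ))))
  r≡ : r ≡ (r ∸ (4 * t + 19)) + (4 * t + 19)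
  r≡ = sym (ℕₚ.m∸n+n≡m c≤r)
  s-small : 2 * s + 4 * t + 19 ≤ r
  s-small = begin
    2 * s + 4 * t + 19             ≡⟨ ℕₚ.+-assoc (2 * s) (4 * t) 19 ⟩
    2 * s + (4 * t + 19)           ≡⟨ cong (_+ (4 * t + 19)) (ℕₚ.*-comm 2 s) ⟩
    s * 2 + (4 * t + 19)           ≤⟨ ℕₚ.+-monoˡ-≤ (4 * t + 19) (m/n*n≤m (r ∸ (4 * t + 19)) 2) ⟩
    r ∸ (4 * t + 19) + (4 * t + 19) ≡⟨ sym r≡ ⟩
    r                              ∎
  r≤ : r ≤ 2 * s + (4 * t + 20)
  r≤ = begin
    r                              ≡⟨ r≡ ⟩
    x + (4 * t + 19)               ≡⟨ cong (_+ (4 * t + 19)) (m≡m%n+[m/n]*n x 2) ⟩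
    x % 2 + s * 2 + (4 * t + 19)   ≤⟨ ℕₚ.+-monoˡ-≤ (4 * t + 19) (ℕₚ.+-monoˡ-≤ (s * 2) (ℕ.s≤s⁻¹ (m%n<n x 2))) ⟩
    1 + s * 2 + (4 * t + 19)       ≡⟨ ring₁ s t ⟩
    2 * s + (4 * t + 20)           ∎
    where
    x : ℕ
    x = r ∸ (4 * t + 19)
    ring₁ : ∀ s t → 1 + s * 2 + (4 * t + 19) ≡ 2 * s + (4 * t + 20)
    ring₁ = solve-∀
  -- Up to smaller terms `ℓ` is `r (3 + t) = r τ + 4 r`, and `r` exceeds `2 s` by at most
  -- `4 t + 20`.
  1+ℓ≤ : suc ℓ ≤ 2 * s * τ + 4 * (3 + t) ^ 2 + 4 * r
  1+ℓ≤ = begin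
    suc ℓ                                       ≡⟨ cong suc ℓ≡ ⟩
    suc (suc (t + 4 + u))                       ≡⟨ cong (λ z → suc (suc (t + 4 + z))) (m≡m%n+[m/n]*n u (3 + t)) ⟩
    suc (suc (t + 4 + (u % (3 + t) + r * (3 + t))))
      ≤⟨ s≤s (s≤s (ℕₚ.+-monoʳ-≤ (t + 4) (ℕₚ.+-monoˡ-≤ (r * (3 + t)) (ℕ.s≤s⁻¹ (m%n<n u (3 + t)))))) ⟩
    suc (suc (t + 4 + (2 + t + r * (3 + t))))   ≡⟨ cong (λ z → suc (suc (z + 4 + (2 + z + r * (3 + z))))) t≡ ⟩
    suc (suc (12 + d + 4 + (2 + (12 + d) + r * (3 + (12 + d)))))  ≡⟨ ring₁ d r ⟩
    32 + 2 * d + 4 * r + r * τ                  ≤⟨ ℕₚ.+-monoʳ-≤ (32 + 2 * d + 4 * r) (ℕₚ.*-monoˡ-≤ τ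
                                                     (subst (λ z → r ≤ 2 * s + (4 * z + 20)) t≡ r≤)) ⟩
    32 + 2 * d + 4 * r + (2 * s + (4 * (12 + d) + 20)) * τ  ≤⟨ ℕₚ.m≤m+n _ (120 + 6 * d) ⟩
    32 + 2 * d + 4 * r + (2 * s + (4 * (12 + d) + 20)) * (11 + d) + (120 + 6 * d)  ≡⟨ ring₂ d r s ⟩
    2 * s * τ + 4 * (3 + (12 + d)) ^ 2 + 4 * r  ≡⟨ cong (λ z → 2 * s * τ + 4 * (3 + z) ^ 2 + 4 * r) (sym t≡) ⟩
    2 * s * τ + 4 * (3 + t) ^ 2 + 4 * r         ∎
    where
    ring₁ : ∀ d r → suc (suc (12 + d + 4 + (2 + (12 + d) + r * (3 + (12 + d))))) ≡ 32 + 2 * d + 4 * r + r * (11 + d)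
    ring₁ = solve-∀
    ring₂ : ∀ d r s → 32 + 2 * d + 4 * r + (2 * s + (4 * (12 + d) + 20)) * (11 + d) + (120 + 6 * d)
                    ≡ 2 * s * (11 + d) + 4 * ((3 + (12 + d)) * ((3 + (12 + d)) * 1)) + 4 * r
    ring₂ = solve-∀
  s-large : M * suc ℓ ≤ 2 * suc ℓ + M * (2 * s * τ)
  s-large = begin
    M * suc ℓ                                                 ≤⟨ ℕₚ.*-monoʳ-≤ M 1+ℓ≤ ⟩
    M * (2 * s * τ + 4 * (3 + t) ^ 2 + 4 * r)                 ≡⟨ ring₁ M (2 * s * τ) ((3 + t) ^ 2) r ⟩
    -- Since `4 M ≤ t`, the two error terms are at most `(3 + t)³ ≤ ℓ` and `(3 + t) r ≤ u ≤ ℓ`.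
    4 * M * (3 + t) ^ 2 + 4 * M * r + M * (2 * s * τ)         ≤⟨ ℕₚ.+-monoˡ-≤ (M * (2 * s * τ)) (ℕₚ.+-mono-≤
      (ℕₚ.≤-trans (ℕₚ.*-monoˡ-≤ ((3 + t) ^ 2) 4M≤3+t) (ℕₚ.m≤n⇒m≤1+n cube≤ℓ))
      (ℕₚ.≤-trans (ℕₚ.*-monoˡ-≤ r 4M≤3+t) (ℕₚ.≤-trans [3+t]r≤u (ℕₚ.≤-trans (ℕₚ.m∸n≤m ℓ (suc (t + 4))) (ℕₚ.n≤1+n ℓ))))) ⟩
    suc ℓ + suc ℓ + M * (2 * s * τ)                           ≡⟨ cong (λ z → suc ℓ + z + M * (2 * s * τ)) (sym (ℕₚ.+-identityʳ (suc ℓ))) ⟩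
    2 * suc ℓ + M * (2 * s * τ)                               ∎
    where
    4M≤3+t : 4 * M ≤ 3 + t
    4M≤3+t = ℕₚ.≤-trans 4M≤t (ℕₚ.m≤n+m t 3)
    ring₁ : ∀ M x y r → M * (x + 4 * y + 4 * r) ≡ 4 * M * y + 4 * M * r + M * x
    ring₁ = solve-∀

-- Real bounds

ι-+ : ∀ m n → ι (m + n) ≡ ι m ℚ.+ ι n
ι-+ zero n = sym (ℚₚ.+-identityˡ (ι n))
ι-+ (suc m) n = trans (ι-suc (m + n)) (trans (cong (1ℚ ℚ.+_) (ι-+ m n))
  (trans (sym (ℚₚ.+-assoc 1ℚ (ι m) (ι n))) (cong (ℚ._+ ι n) (sym (ι-suc m)))))

ι-* : ∀ m n → ι (m * n) ≡ ι m ℚ.* ι n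
ι-* zero n = sym (ℚₚ.*-zeroˡ (ι n))
ι-* (suc m) n = trans (ι-+ n (m * n)) (trans (cong (ι n ℚ.+_) (ι-* m n))
  (trans (solve 2 (λ m n → n :+ m :* n := (con 1ℚ :+ m) :* n) refl (ι m) (ι n)) (cong (ℚ._* ι n) (sym (ι-suc m)))))
  where open ℚ-Solver.+-*-Solver

ι-^ : ∀ m n → ι (m ^ n) ≡ ι m ^ℚ n
ι-^ m zero = refl
ι-^ m (suc n) = trans (ι-* m (m ^ n)) (cong (ι m ℚ.*_) (ι-^ m n))

ι-mono-< : ∀ {m n} → m < n → ι m ℚ.< ι n
ι-mono-< {m} m<n = ℚₚ.<-≤-trans (subst (ι m ℚ.<_) (trans (ℚₚ.+-comm (ι m) 1ℚ) (sym (ι-suc m))) (q<q+1 (ι m))) (ι-mono m<n)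

^ℚ-mono-< : ∀ {a b} n → 0ℚ ℚ.≤ a → a ℚ.< b → a ^ℚ suc n ℚ.< b ^ℚ suc n
^ℚ-mono-< {a} {b} n 0≤a a<b = ℚₚ.≤-<-trans (≤*ˡ {a} 0≤a (^-mono {a} {b} n 0≤a (ℚₚ.<⇒≤ a<b)))
  (<*ʳ {b ^ℚ n} (^>0 {b} n (ℚₚ.≤-<-trans 0≤a a<b)) a<b)

*-cancel-≤ : ∀ {a b c} → 0ℚ ℚ.< c → a ℚ.* c ℚ.≤ b ℚ.* c → a ℚ.≤ b
*-cancel-≤ {c = c} 0<c h = ℚₚ.≮⇒≥ λ b<a → <⇒≱ (<*ʳ {c} 0<c b<a) h

-- Raising the lower corner `(a , c)` to `(a ⊔ a₀ , c ⊔ c₀)` stays inside the box, so `q` remains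
-- below the product. Positive `a₀` and `c₀` then give factors of known sign.
∈*ℝ⇒ : ∀ x y {a₀ c₀ q} → a₀ ∈ x → c₀ ∈ y → q ∈ x *ℝ y →
       ∃[ a ] ∃[ c ] (a ∈ x × c ∈ y × a₀ ℚ.≤ a × c₀ ℚ.≤ c × q ℚ.< a ℚ.* c)
∈*ℝ⇒ x y {a₀} {c₀} {q} ha₀ hc₀ (a , b , c , d , ha , hb , hc , hd , h₁ , h₂ , h₃ , h₄) =
  s , t , hs , ht , ℚₚ.p≤q⊔p a a₀ , ℚₚ.p≤q⊔p c c₀ ,
  Product.<box₂ {a = s}
    (Product.<box₁ {c = c} h₁ h₃ (ℚₚ.p≤p⊔q a a₀) s≤b)
    (Product.<box₁ {c = d} h₂ h₄ (ℚₚ.p≤p⊔q a a₀) s≤b)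
    (ℚₚ.p≤p⊔q c c₀) (ℚₚ.<⇒≤ (∈∉⇒< y ht hd))
  where
  s t : ℚ
  s = a ℚ.⊔ a₀
  t = c ℚ.⊔ c₀
  hs : s ∈ x
  hs = ⊔-∈ x ha ha₀
  ht : t ∈ y
  ht = ⊔-∈ y hc hc₀
  s≤b : s ℚ.≤ b
  s≤b = ℚₚ.<⇒≤ (∈∉⇒< x hs hb)

*ℝ>0 : ∀ x y {a c} → 0ℚ ℚ.< a → a ∈ x → 0ℚ ℚ.< c → c ∈ y → ∃[ e ] (0ℚ ℚ.< e × e ∈ x *ℝ y)
*ℝ>0 x y {a} {c} 0<a ha 0<c hc =
  let (e , 0<e , e<ac) = ℚₚ.<-dense (*>0 {a} {c} 0<a 0<c)
      (b , hb)         = bounded x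
      (d , hd)         = bounded y
      a≤b              = ℚₚ.<⇒≤ (∈∉⇒< x ha hb)
      c≤d              = ℚₚ.<⇒≤ (∈∉⇒< y hc hd)
  in e , 0<e , a , b , c , d , ha , hb , hc , hd , e<ac ,
     ℚₚ.<-≤-trans e<ac (≤*ˡ {a} (ℚₚ.<⇒≤ 0<a) c≤d) ,
     ℚₚ.<-≤-trans e<ac (≤*ʳ {c} (ℚₚ.<⇒≤ 0<c) a≤b) ,
     ℚₚ.<-≤-trans e<ac (*-mono-≤ {a} {b} {c} {d} (ℚₚ.<⇒≤ 0<a) a≤b (ℚₚ.<⇒≤ 0<c) c≤d)

∉⇒>0 : ∀ y → 0ℝ <ℝ y → ∀ {d} → d ∉ y → 0ℚ ℚ.< d
∉⇒>0 y 0<y hd = let (r , 0<r , r∈y) = 0<⇒∃ y 0<y in ℚₚ.<-trans 0<r (∈∉⇒< y r∈y hd)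

reciprocal>0 : ∀ y (0<y : 0ℝ <ℝ y) → ∃[ e ] (0ℚ ℚ.< e × e ∈ reciprocal y 0<y)
reciprocal>0 y 0<y =
  let (d , hd)          = bounded y
      0<d               = ∉⇒>0 y 0<y hd
      (e , 0<e , de≡1)  = 1/pos {d} 0<d
      (f , 0<f , f<e)   = ℚₚ.<-dense 0<e
  in f , 0<f , d , hd , subst (f ℚ.* d ℚ.<_) (trans (ℚₚ.*-comm e d) de≡1) (<*ʳ {d} 0<d f<e)

∈log⇒approx≤ : ∀ x (0<x : 0ℝ <ℝ x) {q b} → b ∉ x → q ∈ log x 0<x → ∀ k → 0ℚ ℚ.≤ compound q k → approx q k ℚ.≤ b
∈log⇒approx≤ x 0<x {q} {b} hb q∈ k 0≤c =
  -- `exp (fromℚ q)` only involves points strictly below `q`, so a larger `q′` is taken first.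
  let (q′ , q<q′ , r , hr , r∈x) = rounded (log x 0<x) q∈ in
  ℚₚ.≤-trans (Logarithm.∉exp⇒≥ (fromℚ q′) q k hr q<q′ 0≤c) (ℚₚ.<⇒≤ (∈∉⇒< x r∈x hb))

∈logℕ⇒approx≤ : ∀ n (1≤n : 1 ≤ n) {q} → q ∈ logℕ n 1≤n → ∀ k → 0ℚ ℚ.≤ compound q k → approx q k ℚ.≤ ι n
∈logℕ⇒approx≤ (suc n) _ = ∈log⇒approx≤ (fromℕ (suc n)) (fromℕ>0 n) (ℚₚ.<-irrefl refl)

compound≥0 : ∀ {y} k → 0ℚ ℚ.≤ y → 0ℚ ℚ.≤ compound y k
compound≥0 k 0≤y = +≥0 0≤1 (*≥0 0≤y (recip≥0 k))

approx-nonpos : ∀ {p} k → p ℚ.≤ 0ℚ → 0ℚ ℚ.≤ compound p k → approx p k ℚ.≤ 1ℚ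
approx-nonpos {p} k p≤0 0≤c = ^≤1 {compound p k} (suc k) 0≤c
  (subst (compound p k ℚ.≤_) (trans (cong (1ℚ ℚ.+_) (ℚₚ.*-zeroˡ (recip k))) (ℚₚ.+-identityʳ 1ℚ)) (compound-mono k p≤0))

-- If `e^y ≤ b` and `p ≤ s y`, then `e^p ≤ b^s`. At a fixed level `K` this is Bernoulli's
-- `1 + s y / K ≤ (1 + y / K)^s`.
approx-pow : ∀ {b p y} s → 0ℚ ℚ.≤ y → p ℚ.≤ ι s ℚ.* y → (∀ k → approx y k ℚ.≤ ι b) →
             ∀ k → 0ℚ ℚ.≤ compound p k → approx p k ℚ.≤ ι (b ^ s)
approx-pow {b} {p} {y} s 0≤y p≤sy bound k 0≤c = begin
  compound p k ^ℚ suc k               ≤⟨ ^-mono {compound p k} {compound y k ^ℚ s} (suc k) 0≤c compound≤ ⟩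
  (compound y k ^ℚ s) ^ℚ suc k        ≡⟨ ^-assocʳ (compound y k) s (suc k) ⟩
  compound y k ^ℚ (s * suc k)         ≡⟨ cong (compound y k ^ℚ_) (ℕₚ.*-comm s (suc k)) ⟩
  compound y k ^ℚ (suc k * s)         ≡⟨ sym (^-assocʳ (compound y k) (suc k) s) ⟩
  approx y k ^ℚ s                     ≤⟨ ^-mono {approx y k} {ι b} s (approx≥0 y k (compound≥0 k 0≤y)) (bound k) ⟩
  ι b ^ℚ s                            ≡⟨ sym (ι-^ b s) ⟩
  ι (b ^ s)                           ∎
  where
  open ℚₚ.≤-Reasoning
  compound≤ : compound p k ℚ.≤ compound y k ^ℚ s
  compound≤ = ℚₚ.≤-trans
    (subst (λ z → compound p k ℚ.≤ 1ℚ ℚ.+ z) (ℚₚ.*-assoc (ι s) y (recip k)) (compound-mono k p≤sy))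
    (bernoulli (y ℚ.* recip k) s (compound≥0 k 0≤y))

-- The approximation of `e^a` at level `K (ℓ + 1)` is the power `ℓ + 1` of that of `e^(a / (ℓ + 1))`
-- at level `K`.
approx-root : ∀ {a} ℓ b → 0ℚ ℚ.≤ a → (∀ k → approx a k ℚ.≤ ι (b ^ suc ℓ)) → ∀ k → approx (a ℚ.* recip ℓ) k ℚ.≤ ι b
approx-root {a} ℓ b 0≤a bound k = ℚₚ.≮⇒≥ λ lt → <⇒≱ (^ℚ-mono-< {ι b} ℓ (ι≥0 b) lt) (begin
  approx y k ^ℚ suc ℓ                ≡⟨ ^-assocʳ (compound y k) (suc k) (suc ℓ) ⟩
  compound y k ^ℚ (suc k * suc ℓ)    ≡⟨ cong (λ z → (1ℚ ℚ.+ z) ^ℚ (suc k * suc ℓ)) y/k ⟩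
  approx a (ℓ + k * suc ℓ)           ≤⟨ bound (ℓ + k * suc ℓ) ⟩
  ι (b ^ suc ℓ)                      ≡⟨ ι-^ b (suc ℓ) ⟩
  ι b ^ℚ suc ℓ                       ∎)
  where
  open ℚₚ.≤-Reasoning
  y : ℚ
  y = a ℚ.* recip ℓ
  y/k : y ℚ.* recip k ≡ a ℚ.* recip (ℓ + k * suc ℓ)
  y/k = trans (ℚₚ.*-assoc a (recip ℓ) (recip k))
    (cong (a ℚ.*_) (trans (ℚₚ.*-comm (recip ℓ) (recip k)) (sym (recip-* k ℓ))))

log2 : ℝ
log2 = logℕ 2 (s≤s z≤n)

0<log2 : 0ℝ <ℝ log2
0<log2 = log>0 {fromℕ 2} (fromℕ>0 1) (1ℚ , ℚₚ.<-irrefl refl , ι-mono-< {1} {2} (s≤s (s≤s z≤n)))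

∈log2⇒≤1 : ∀ {a} → 0ℚ ℚ.≤ a → a ∈ log2 → a ℚ.≤ 1ℚ
∈log2⇒≤1 {a} 0≤a ha = 0≤-⇒≤ (subst (0ℚ ℚ.≤_)
  (trans (cong (ℚ._- (1ℚ ℚ.+ a)) (ι-suc 1)) (solve 1 (λ a → (con 1ℚ :+ con 1ℚ) :- (con 1ℚ :+ a) := con 1ℚ :- a) refl a))
  (≤⇒0≤- (subst (ℚ._≤ ι 2) (Logarithm.approx0 a) (∈logℕ⇒approx≤ 2 (s≤s z≤n) ha 0 (compound≥0 0 0≤a)))))
  where open ℚ-Solver.+-*-Solver

approx1≤3 : ∀ k → approx 1ℚ k ℚ.≤ ι 3
approx1≤3 k =
  let (q , q≮1 , q∈) = 1<logℕ 3 (s≤s z≤n) (s≤s (s≤s (s≤s z≤n)))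
      (q′ , q<q′ , q′∈) = rounded (logℕ 3 (s≤s z≤n)) q∈
  in ∈logℕ⇒approx≤ 3 (s≤s z≤n)
        (closed (logℕ 3 (s≤s z≤n)) (ℚₚ.≤-<-trans (ℚₚ.≮⇒≥ q≮1) q<q′) q′∈) k (compound≥0 k 0≤1)

-- Since e ≤ 3, we have e^w ≤ 3^w < 4^w ≤ n.
∈logℕ : ∀ {n w} (1≤n : 1 ≤ n) → 1 ≤ w → 2 ^ (2 * w) ≤ n → ι w ∈ logℕ n 1≤n
∈logℕ {suc n} {w@(suc w-1)} _ _ 4^w≤n = ι (3 ^ w) ,
  (λ (p , k , p<w , 0≤c , lt) → <⇒≱ lt (approx-pow {3} {p} {1ℚ} w 0≤1
    (ℚₚ.<⇒≤ (subst (p ℚ.<_) (sym (ℚₚ.*-identityʳ (ι w))) p<w)) approx1≤3 k 0≤c)) ,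
  ι-mono-< (ℕₚ.<-≤-trans (ℕₚ.^-monoˡ-< w (s≤s (s≤s (s≤s (s≤s z≤n)))))
    (subst (_≤ suc n) (sym (ℕₚ.^-*-assoc 2 2 w)) 4^w≤n))

-- Since `log 2 ≤ 1`, subtracting `ε` costs at least `a₁ r`. This makes the bound proportional to
-- `a₁`, which can later be cancelled.
∈log2/2-ε⇒ : ∀ ε {r a} → 0ℚ ℚ.≤ r → r ∈ ε → a ∈ (log2/2 -ℝ ε) →
             ∃[ a₁ ] (0ℚ ℚ.< a₁ × a₁ ∈ log2 × a ℚ.≤ a₁ ℚ.* (½ ℚ.- r))
∈log2/2-ε⇒ ε {r} {a} 0≤r r∈ε (α , β , α∈ , β∉ε , a<α-β) =
  let (e , 0<e , e∈) = 0<⇒∃ log2 0<log2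
      (a₁ , h , a₁∈ , h<½ , e≤a₁ , _ , α<a₁h) = ∈*ℝ⇒ log2 (fromℚ ½) e∈ (ℚₚ.positive⁻¹ ½) α∈
      0<a₁ = ℚₚ.<-≤-trans 0<e e≤a₁
  in a₁ , 0<a₁ , a₁∈ , bound 0<a₁ a₁∈ h<½ α<a₁h
  where
  open ℚₚ.≤-Reasoning
  open ℚ-Solver.+-*-Solver
  bound : ∀ {a₁ h} → 0ℚ ℚ.< a₁ → a₁ ∈ log2 → h ℚ.< ½ → α ℚ.< a₁ ℚ.* h → a ℚ.≤ a₁ ℚ.* (½ ℚ.- r)
  bound {a₁} {h} 0<a₁ a₁∈ h<½ α<a₁h = ℚₚ.<⇒≤ (begin-strict
    a                       <⟨ a<α-β ⟩
    α ℚ.- β                 ≤⟨ ℚₚ.+-mono-≤ (ℚₚ.≤-trans (ℚₚ.<⇒≤ α<a₁h) (≤*ˡ {a₁} (ℚₚ.<⇒≤ 0<a₁) (ℚₚ.<⇒≤ h<½)))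
                                           (ℚₚ.neg-antimono-≤ a₁r≤β) ⟩
    a₁ ℚ.* ½ ℚ.- a₁ ℚ.* r   ≡⟨ solve 3 (λ a h r → a :* h :- a :* r := a :* (h :- r)) refl a₁ ½ r ⟩
    a₁ ℚ.* (½ ℚ.- r)        ∎)
    where
    a₁r≤β : a₁ ℚ.* r ℚ.≤ β
    a₁r≤β = ℚₚ.≤-trans (≤*ʳ {r} 0≤r (∈log2⇒≤1 (ℚₚ.<⇒≤ 0<a₁) a₁∈))
      (subst (ℚ._≤ β) (sym (ℚₚ.*-identityˡ r)) (ℚₚ.<⇒≤ (∈∉⇒< ε r∈ε β∉ε)))

-- With x = log n, a₁ < log 2, a₂ < log n and τ a₁ < log log n, any p below the exponent
-- satisfies p τ ≤ (1/2 - r) a₂, and hence (1 + ℓ) p ≤ s a₂ ≤ s (1 + ℓ) log 2.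
module Exponent (ε x : ℝ) (0<x : 0ℝ <ℝ x) (1<x : 1ℝ <ℝ x) {n ℓ τ s M : ℕ} {r : ℚ}
  (∈x⇒approx≤ : ∀ {q} → q ∈ x → ∀ k → 0ℚ ℚ.≤ compound q k → approx q k ℚ.≤ ι n)
  (n≤2^[1+ℓ] : n ≤ 2 ^ suc ℓ) (2^τ∈x : ι (2 ^ τ) ∈ x) (1≤τ : 1 ≤ τ) (0≤r : 0ℚ ℚ.≤ r) (r∈ε : r ∈ ε)
  (1≤M : 1 ≤ M) (1≤Mr : 1ℚ ℚ.≤ ι M ℚ.* r)
  (s-large : M * suc ℓ ≤ 2 * suc ℓ + M * (2 * s * τ)) where

  open ℚ-Solver.+-*-Solver
  open ℚₚ.≤-Reasoning

  private
    loglog : ℝ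
    loglog = log x 0<x

    0<loglog : 0ℝ <ℝ loglog
    0<loglog = log>0 {x} 0<x 1<x

    l σ θ m : ℚ
    l = ι (suc ℓ)
    σ = ι s
    θ = ι τ
    m = ι M

    -- `e^(τ a) ≤ 2^τ < log n`, because `e^a ≤ 2`.
    τa∈loglog : ∀ {a} → 0ℚ ℚ.< a → a ∈ log2 → θ ℚ.* a ∈ loglog
    τa∈loglog {a} 0<a a∈ = ι (2 ^ τ) , (λ (p , k , p< , 0≤c , lt) → <⇒≱ lt
      (approx-pow {2} {p} {a} τ 0≤a (ℚₚ.<⇒≤ p<) (λ k → ∈logℕ⇒approx≤ 2 (s≤s z≤n) a∈ k (compound≥0 k 0≤a)) k 0≤c)) , 2^τ∈x
      where
      0≤a : 0ℚ ℚ.≤ a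
      0≤a = ℚₚ.<⇒≤ 0<a

    s-largeℚ : m ℚ.* l ℚ.≤ ι 2 ℚ.* l ℚ.+ m ℚ.* (ι 2 ℚ.* σ ℚ.* θ)
    s-largeℚ = subst₂ ℚ._≤_ (ι-* M (suc ℓ))
      (trans (ι-+ (2 * suc ℓ) (M * (2 * s * τ))) (cong₂ ℚ._+_ (ι-* 2 (suc ℓ))
        (trans (ι-* M (2 * s * τ)) (cong (m ℚ.*_) (trans (ι-* (2 * s) τ) (cong (ℚ._* θ) (ι-* 2 s)))))))
      (ι-mono s-large)

    ι-pos : ∀ {k} → 1 ≤ k → 0ℚ ℚ.< ι k
    ι-pos = ι-mono-< {0}

    ι2*½ : ι 2 ℚ.* ½ ≡ 1ℚ
    ι2*½ = refl

    -- After multiplication by `2 M (1 + ℓ)`, the loss `2 (1 + ℓ)` in `s-large` is paid for by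
    -- `M r ≥ 1`.
    scale : ∀ {p a₂} → 0ℚ ℚ.≤ a₂ → p ℚ.* θ ℚ.≤ (½ ℚ.- r) ℚ.* a₂ → p ℚ.* l ℚ.≤ σ ℚ.* a₂
    scale {p} {a₂} 0≤a₂ h = *-cancel-≤ {c = c} (*>0 {ι 2 ℚ.* m} (*>0 {ι 2} (ι-pos {2} (s≤s z≤n)) (ι-pos 1≤M)) (ι-pos 1≤τ)) (begin
      p ℚ.* l ℚ.* c                                  ≡⟨ solve 5 (λ p l w m t → p :* l :* (w :* m :* t) := w :* m :* l :* (p :* t)) refl p l (ι 2) m θ ⟩
      ι 2 ℚ.* m ℚ.* l ℚ.* (p ℚ.* θ)                  ≤⟨ ≤*ˡ {ι 2 ℚ.* m ℚ.* l} (*≥0 {ι 2 ℚ.* m} (*≥0 {ι 2} (ι≥0 2) (ι≥0 M)) (ι≥0 (suc ℓ))) h ⟩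
      ι 2 ℚ.* m ℚ.* l ℚ.* ((½ ℚ.- r) ℚ.* a₂)         ≡⟨ solve 6 (λ w m l h r a → w :* m :* l :* ((h :- r) :* a) :=
                                                          ((w :* h) :* (m :* l) :- (m :* r) :* (w :* l)) :* a) refl (ι 2) m l ½ r a₂ ⟩
      ((ι 2 ℚ.* ½) ℚ.* (m ℚ.* l) ℚ.- (m ℚ.* r) ℚ.* (ι 2 ℚ.* l)) ℚ.* a₂
        ≤⟨ ≤*ʳ {a₂} 0≤a₂ (ℚₚ.+-mono-≤ (ℚₚ.≤-reflexive (trans (cong (ℚ._* (m ℚ.* l)) ι2*½) (ℚₚ.*-identityˡ (m ℚ.* l))))
             (ℚₚ.neg-antimono-≤ (≤*ʳ {ι 2 ℚ.* l} (*≥0 {ι 2} (ι≥0 2) (ι≥0 (suc ℓ))) 1≤Mr))) ⟩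
      (m ℚ.* l ℚ.- 1ℚ ℚ.* (ι 2 ℚ.* l)) ℚ.* a₂        ≤⟨ ≤*ʳ {a₂} 0≤a₂ (ℚₚ.+-monoˡ-≤ (ℚ.- (1ℚ ℚ.* (ι 2 ℚ.* l))) s-largeℚ) ⟩
      (ι 2 ℚ.* l ℚ.+ m ℚ.* (ι 2 ℚ.* σ ℚ.* θ) ℚ.- 1ℚ ℚ.* (ι 2 ℚ.* l)) ℚ.* a₂
        ≡⟨ solve 6 (λ w l m s t a → (w :* l :+ m :* (w :* s :* t) :- con 1ℚ :* (w :* l)) :* a := s :* a :* (w :* m :* t))
             refl (ι 2) l m σ θ a₂ ⟩
      σ ℚ.* a₂ ℚ.* c                                 ∎)
      where
      c : ℚ
      c = ι 2 ℚ.* m ℚ.* θ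

    approx≤-positive : ∀ {p A a₁ c c₂ a₂ d} k → 0ℚ ℚ.≤ compound p k → 0ℚ ℚ.≤ p → 0ℚ ℚ.< a₁ → a₁ ∈ log2 →
      A ≡ a₁ ℚ.* (½ ℚ.- r) → 0ℚ ℚ.≤ A → p ℚ.< A ℚ.* c → c ℚ.< a₂ ℚ.* c₂ → 0ℚ ℚ.≤ a₂ → a₂ ∈ x →
      d ∉ loglog → c₂ ℚ.* d ℚ.< 1ℚ → approx p k ℚ.≤ ι (2 ^ s)
    approx≤-positive {p} {A} {a₁} {c} {c₂} {a₂} {d} k 0≤c 0≤p 0<a₁ a₁∈ A≡ 0≤A p<Ac c<a₂c₂ 0≤a₂ a₂∈x d∉ c₂d<1 =
      -- `e^a₂ ≤ n ≤ 2^(ℓ + 1)` gives `e^(a₂ / (ℓ + 1)) ≤ 2`, whose power `s` bounds `e^p`.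
      approx-pow {2} {p} {a₂ ℚ.* recip ℓ} s (*≥0 0≤a₂ (recip≥0 ℓ)) p≤ (approx-root ℓ 2 0≤a₂ (λ j →
        ℚₚ.≤-trans (∈x⇒approx≤ a₂∈x j (compound≥0 j 0≤a₂)) (ι-mono n≤2^[1+ℓ]))) k 0≤c
      where
      0≤d : 0ℚ ℚ.≤ d
      0≤d = ℚₚ.<⇒≤ (∉⇒>0 loglog 0<loglog d∉)
      pθ≤ : p ℚ.* θ ℚ.≤ (½ ℚ.- r) ℚ.* a₂
      -- The rational `a₁` standing for `log 2` appears on the left through `τ a₁ < d` and on the
      -- right through `A`.
      pθ≤ = *-cancel-≤ {c = a₁} 0<a₁ (begin
        p ℚ.* θ ℚ.* a₁                 ≡⟨ ℚₚ.*-assoc p θ a₁ ⟩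
        p ℚ.* (θ ℚ.* a₁)               ≤⟨ ≤*ˡ {p} 0≤p (ℚₚ.<⇒≤ (∈∉⇒< loglog (τa∈loglog 0<a₁ a₁∈) d∉)) ⟩
        p ℚ.* d                        ≤⟨ ≤*ʳ {d} 0≤d (ℚₚ.≤-trans (ℚₚ.<⇒≤ p<Ac) (≤*ˡ {A} 0≤A (ℚₚ.<⇒≤ c<a₂c₂))) ⟩
        A ℚ.* (a₂ ℚ.* c₂) ℚ.* d        ≡⟨ solve 4 (λ a b c d → a :* (b :* c) :* d := a :* b :* (c :* d)) refl A a₂ c₂ d ⟩
        A ℚ.* a₂ ℚ.* (c₂ ℚ.* d)        ≤⟨ ≤*ˡ {A ℚ.* a₂} (*≥0 0≤A 0≤a₂) (ℚₚ.<⇒≤ c₂d<1) ⟩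
        A ℚ.* a₂ ℚ.* 1ℚ                ≡⟨ trans (ℚₚ.*-identityʳ (A ℚ.* a₂)) (cong (ℚ._* a₂) A≡) ⟩
        a₁ ℚ.* (½ ℚ.- r) ℚ.* a₂        ≡⟨ solve 3 (λ a h b → a :* h :* b := h :* b :* a) refl a₁ (½ ℚ.- r) a₂ ⟩
        (½ ℚ.- r) ℚ.* a₂ ℚ.* a₁        ∎)
      p≤ : p ℚ.≤ σ ℚ.* (a₂ ℚ.* recip ℓ)
      p≤ = begin
        p                              ≡⟨ sym (trans (cong (p ℚ.*_) (ι*recip ℓ)) (ℚₚ.*-identityʳ p)) ⟩
        p ℚ.* (l ℚ.* recip ℓ)          ≡⟨ sym (ℚₚ.*-assoc p l (recip ℓ)) ⟩
        p ℚ.* l ℚ.* recip ℓ            ≤⟨ ≤*ʳ {recip ℓ} (recip≥0 ℓ) (scale {p} 0≤a₂ pθ≤) ⟩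
        σ ℚ.* a₂ ℚ.* recip ℓ           ≡⟨ ℚₚ.*-assoc σ a₂ (recip ℓ) ⟩
        σ ℚ.* (a₂ ℚ.* recip ℓ)         ∎

    V : ℝ
    V = x ÷ℝ (loglog , 0<loglog)

  approx≤2^s : ∀ {p} → p ∈ (log2/2 -ℝ ε) *ℝ V → ∀ k → 0ℚ ℚ.≤ compound p k → approx p k ℚ.≤ ι (2 ^ s)
  approx≤2^s {p} p∈ k 0≤cp =
    let (e₁ , 0<e₁ , e₁∈) = 0<⇒∃ x 0<x
        (e₂ , 0<e₂ , e₂∈) = reciprocal>0 loglog 0<loglog
        (e , 0<e , e∈) = *ℝ>0 x (reciprocal loglog 0<loglog) 0<e₁ e₁∈ 0<e₂ e₂∈
        (a , c , a∈ , c∈ , _ , e≤c , p<ac) = ∈*ℝ⇒ (log2/2 -ℝ ε) V {c₀ = e} (proj₂ (inhabited (log2/2 -ℝ ε))) e∈ p∈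
        (a₁ , 0<a₁ , a₁∈ , a≤) = ∈log2/2-ε⇒ ε 0≤r r∈ε a∈
        (a₂ , c₂ , a₂∈ , (d , d∉ , c₂d<1) , e₁≤a₂ , _ , c<a₂c₂) = ∈*ℝ⇒ x (reciprocal loglog 0<loglog) {e₁} {e₂} e₁∈ e₂∈ c∈
        0≤c = ℚₚ.≤-trans (ℚₚ.<⇒≤ 0<e) e≤c
        p<Ac = ℚₚ.<-≤-trans p<ac (≤*ʳ {c} 0≤c a≤)
    in cases 0≤c p<Ac (ℚₚ.≤-total p 0ℚ) (ℚₚ.≤-total (a₁ ℚ.* (½ ℚ.- r)) 0ℚ)
         (λ 0≤p 0≤A → approx≤-positive k 0≤cp 0≤p 0<a₁ a₁∈ refl 0≤A p<Ac c<a₂c₂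
           (ℚₚ.≤-trans (ℚₚ.<⇒≤ 0<e₁) e₁≤a₂) a₂∈ d∉ c₂d<1)
    where
    nonpos : p ℚ.≤ 0ℚ → approx p k ℚ.≤ ι (2 ^ s)
    nonpos p≤0 = ℚₚ.≤-trans (approx-nonpos k p≤0 0≤cp) (ι-mono {1} (ℕₚ.m^n>0 2 s))
    -- For large `ε` the factor `½ - r` may be negative; then `p ≤ 0` and the bound 1 suffices.
    cases : ∀ {A c} → 0ℚ ℚ.≤ c → p ℚ.< A ℚ.* c → p ℚ.≤ 0ℚ ⊎ 0ℚ ℚ.≤ p → A ℚ.≤ 0ℚ ⊎ 0ℚ ℚ.≤ A →
            (0ℚ ℚ.≤ p → 0ℚ ℚ.≤ A → approx p k ℚ.≤ ι (2 ^ s)) → approx p k ℚ.≤ ι (2 ^ s)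
    cases _ _ (inj₁ p≤0) _ _ = nonpos p≤0
    cases {A} {c} 0≤c p<Ac (inj₂ _) (inj₁ A≤0) _ = nonpos (ℚₚ.≤-trans (ℚₚ.<⇒≤ p<Ac)
      (subst (A ℚ.* c ℚ.≤_) (ℚₚ.*-zeroˡ c) (≤*ʳ {c} 0≤c A≤0)))
    cases _ _ (inj₂ 0≤p) (inj₂ 0≤A) positive = positive 0≤p 0≤A

-- The two inequalities of the theorem

fromℕ*exp≤ : ∀ n X {b} → (∀ {p} → p ∈ X → ∀ k → 0ℚ ℚ.≤ compound p k → approx p k ℚ.≤ ι b) → 1 ≤ n →
             fromℕ n *ℝ exp X ≤ℝ fromℕ (n * b)
fromℕ*exp≤ n X {b} bound 1≤n q q∈ =
  let (a , c , a<n , (p , k , p∈X , 0≤cp , c<) , 0≤a , _ , q<ac) =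
        ∈*ℝ⇒ (fromℕ n) (exp X) {0ℚ} (ι-mono-< {0} 1≤n) (proj₂ (inhabited (exp X))) q∈
  in ℚₚ.<-≤-trans q<ac (ℚₚ.≤-trans (≤*ˡ {a} 0≤a (ℚₚ.≤-trans (ℚₚ.<⇒≤ c<) (bound p∈X k 0≤cp)))
       (ℚₚ.≤-trans (≤*ʳ {ι b} (ι≥0 b) (ℚₚ.<⇒≤ a<n)) (ℚₚ.≤-reflexive (sym (ι-* n b)))))

hℙ≤F : ∀ n → hℙ n ≤ F n
hℙ≤F n = proj₂ (hℙ-isLeast n) (F n) (weaken (proj₁ (F-isLeast n)))
  where
  weaken : ∀ {H} → Sufficient (UpTo n) H → Sufficient (PrimeUpTo n) H
  weaken (1≤H , h) = 1≤H , λ m → let (a , good , distinct) = h m in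
    a , (λ i pi → good i (primeUpTo⇒upTo n pi)) ,
    (λ i j pi pj → distinct i j (primeUpTo⇒upTo n pi) (primeUpTo⇒upTo n pj))

hℙ-lower-bound : ∀ ε {r M} n → 0ℚ ℚ.≤ r → r ∈ ε → 1 ≤ M → 1ℚ ℚ.≤ ι M ℚ.* r → Growth M n → (n≥3 : 3 ≤ n) →
                 fromℕ (hℙ n) ≥ℝ fromℕ n *ℝ exp ((log2/2 -ℝ ε) *ℝ log-over-loglog n n≥3)
hℙ-lower-bound ε {r} {M} n 0≤r r∈ε 1≤M 1≤Mr g n≥3 q q∈ =
  ℚₚ.<-≤-trans (fromℕ*exp≤ n ((log2/2 -ℝ ε) *ℝ log-over-loglog n n≥3) {2 ^ s} approx≤2^s 1≤n q q∈) (ι-mono n*2^s≤hℙ)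
  where
  open Growth g
  1≤n : 1 ≤ n
  1≤n = ℕₚ.≤-trans (s≤s z≤n) n≥3
  1<log : 1ℝ <ℝ logℕ n 1≤n
  1<log = 1<logℕ n 1≤n n≥3
  open Exponent ε (logℕ n 1≤n) (1<⇒0< {logℕ n 1≤n} 1<log) 1<log {n} {ℓ} {τ} {s} {M} {r}
    (∈logℕ⇒approx≤ n 1≤n) (ℕₚ.<⇒≤ n<2^[1+ℓ])
    (∈logℕ 1≤n (ℕₚ.m^n>0 2 τ) (ℕₚ.≤-trans (ℕₚ.^-monoʳ-≤ 2 2^[1+τ]≤ℓ) 2^ℓ≤n))
    1≤τ 0≤r r∈ε 1≤M 1≤Mr s-large

theorem1p3 : (∀ (n : ℕ) → n ≥ 1 → F n ≥ hℙ n) ×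
    (∀ (ε : ℝ) → 0ℝ <ℝ ε →
    ∃[ n₀ ] (∀ (n : ℕ) → n ≥ n₀ → (n≥3 : 3 ≤ n) →
    fromℕ (hℙ n) ≥ℝ fromℕ n *ℝ exp ((log2/2 -ℝ ε) *ℝ log-over-loglog n n≥3)))
theorem1p3 = (λ n _ → hℙ≤F n) , λ ε 0<ε →
  let (r , 0<r , r∈ε) = 0<⇒∃ ε 0<ε
      (e , 0<e , re≡1) = 1/pos {r} 0<r
      (M , e≤M) = archimedean e
      1≤Mr = subst (ℚ._≤ ι (suc M) ℚ.* r) (trans (ℚₚ.*-comm e r) re≡1)
               (≤*ʳ {r} (ℚₚ.<⇒≤ 0<r) (ℚₚ.≤-trans e≤M (ι≤ι-suc M)))
  -- `suc M` is at least `1 / r`, so the relative loss `2 / suc M` in `s` is covered by a rational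
  -- `r` below `ε`.
  in 2 ^ 2 ^ (12 + 4 * suc M) , λ n n≥n₀ n≥3 →
     hℙ-lower-bound ε n (ℚₚ.<⇒≤ 0<r) r∈ε (s≤s z≤n) 1≤Mr (growth (suc M) n n≥n₀) n≥3
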